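{- There exists a function $t(k) = O(k^{48} \log^{13} k)$ such that for every integer $k \geq 1$, every directed graph of directed treewidth at least $t(k)$ contains a bramble of congestion at most $8$ and size at least $k$.
   Context: Directed treewidth is the directed-graph width parameter of Johnson, Robertson, Seymour and Thomas. A bramble in a directed graph $G$ is a family $\mathcal{B}$ of strongly connected subgraphs of $G$ such that for every two $B_1, B_2 \in \mathcal{B}$, either $B_1$ and $B_2$ share a vertex, or $G$ contains both an arc with tail in $B_1$ and head in $B_2$ and an arc with tail in $B_2$ and head in $B_1$. The size of a bramble is its number of elements; its congestion is the maximum, over vertices $v$ of $G$, of the number of elements of the bramble containing $v$. -}

module Defs where

open import Data.Nat using (ℕ; zero; suc; _+_; _*_; _∸_; _^_; _≤_; _⊔_)
open import Data.Nat.Logarithm using (⌈log₂_⌉)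
open import Data.Bool using (Bool; true; false; _∨_)
open import Data.Fin using (Fin; zero; suc; toℕ)
import Data.Fin as Fin
open import Data.Fin.Subset using (Subset; _∈_; _∉_; _∪_; ⋃; ∣_∣)
open import Data.Fin.Subset.Properties using (_∈?_)
open import Data.Vec using (Vec; lookup; tabulate)
open import Data.List using (List; []; _∷_; length; map; filter; foldr; allFin)
open import Data.List.Relation.Unary.All using (All)
open import Data.List.Relation.Unary.Unique.Propositional using (Unique)
import Data.List.Membership.Propositional as LM
open import Data.Product using (Σ; ∃; ∃-syntax; _×_; _,_)
open import Data.Sum using (_⊎_)
open import Relation.Nullary using (¬_)
open import Relation.Nullary.Decidable using (⌊_⌋; _⊎-dec_)
open import Relation.Binary.PropositionalEquality using (_≡_)

Digraph : ℕ → Set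
Digraph n = Vec (Subset n) n

Arc : ∀ {n} → Digraph n → Fin n → Fin n → Set
Arc G u v = v ∈ lookup G u

data Walk {n} (G : Digraph n) : Fin n → Fin n → Set where
  []  : ∀ {v} → Walk G v v
  _∷_ : ∀ {u w v} → Arc G u w → Walk G w v → Walk G u v

walkVerts : ∀ {n} {G : Digraph n} {u v} → Walk G u v → List (Fin n)
walkVerts {v = v} []      = v ∷ []
walkVerts {u = u} (_ ∷ p) = u ∷ walkVerts p

Subgraph : ℕ → Set
Subgraph n = Subset n × Digraph n

sgVerts : ∀ {n} → Subgraph n → Subset n
sgVerts (X , _) = X

sgArcs : ∀ {n} → Subgraph n → Digraph n
sgArcs (_ , A) = A

IsSubgraph : ∀ {n} → Digraph n → Subgraph n → Set
IsSubgraph G (X , A) =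
  ∀ u v → Arc A u v → (u ∈ X × v ∈ X) × Arc G u v

StronglyConnected : ∀ {n} → Subgraph n → Set
StronglyConnected (X , A) =
  (∃[ v ] v ∈ X) × (∀ u v → u ∈ X → v ∈ X → Walk A u v)

Touch : ∀ {n} → Digraph n → Subgraph n → Subgraph n → Set
Touch G (X , _) (Y , _) =
  (∃[ v ] (v ∈ X × v ∈ Y))
  ⊎ ((∃[ u ] ∃[ w ] (u ∈ X × w ∈ Y × Arc G u w))
     × (∃[ u ] ∃[ w ] (u ∈ Y × w ∈ X × Arc G u w)))

record Bramble {n} (G : Digraph n) : Set where
  field
    elems    : List (Subgraph n)
    distinct : Unique elems
    subgr    : All (IsSubgraph G) elems
    strong   : All StronglyConnected elems
    touching : ∀ {B₁ B₂} → B₁ LM.∈ elems → B₂ LM.∈ elems → Touch G B₁ B₂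

  size : ℕ
  size = length elems

  load : Fin n → ℕ
  load v = length (filter (λ B → v ∈? sgVerts B) elems)

  HasCongestionAtMost : ℕ → Set
  HasCongestionAtMost c = ∀ v → load v ≤ c

-- Arboreal decompositions (Johnson, Robertson, Seymour, Thomas).
--
-- The arborescence R has nodes Fin (suc m) with root zero; node (suc i)
-- has parent (par i), with toℕ (par i) ≤ toℕ i.  Thus R has the m arcs
-- par i → suc i, indexed by i : Fin m.  Every arborescence on m+1 nodes
-- is isomorphic to one of this form (number nodes in BFS order).

data Desc {m} (par : Fin m → Fin (suc m)) (s : Fin (suc m)) : Fin (suc m) → Set where
  here  : Desc par s s
  below : ∀ {i} → Desc par s (par i) → Desc par s (suc i)

Normal : ∀ {n} → Digraph n → (W : Subset n) → (Fin n → Set) → Set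
Normal G W Z =
  (∀ v → Z v → v ∉ W)
  × (∀ u v (p : Walk G u v) → All (_∉ W) (walkVerts p) → Z u → Z v →
       All Z (walkVerts p))

record ArborealDecomposition {n} (G : Digraph n) : Set where
  field
    m     : ℕ
    par   : Fin m → Fin (suc m)
    par<  : ∀ i → toℕ (par i) ≤ toℕ i
    bag   : Fin n → Fin (suc m)
    guard : Fin m → Subset n
    normal : ∀ i → Normal G (guard i) (λ v → Desc par (suc i) (bag v))

  β : Fin (suc m) → Subset n
  β t = tabulate (λ v → ⌊ bag v Fin.≟ t ⌋)

  incident : Fin (suc m) → List (Fin m)
  incident t = filter (λ i → (suc i Fin.≟ t) ⊎-dec (par i Fin.≟ t)) (allFin m)

  Γ : Fin (suc m) → Subset n
  Γ t = β t ∪ ⋃ (map guard (incident t))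

  width : ℕ
  width = foldr _⊔_ 0 (map (λ t → ∣ Γ t ∣) (allFin (suc m))) ∸ 1

DTWAtLeast : ∀ {n} → Digraph n → ℕ → Set
DTWAtLeast G c = (D : ArborealDecomposition G) → c ≤ ArborealDecomposition.width D

BigO-k48log13 : (ℕ → ℕ) → Set
BigO-k48log13 t =
  ∃[ C ] ∃[ N ] (∀ k → N ≤ k → t k ≤ C * (k ^ 48 * ⌈log₂ k ⌉ ^ 13))

{-# OPTIONS --safe #-}

-- Suppose that every set W of at most 2w + 1 vertices has a set S of at most w vertices such that each
-- strong component of G − S contains at most w elements of W.  Then splitting off strong components one
-- at a time gives an arboreal decomposition of width at most 3w + 2.  So large directed treewidth
-- provides a haven: every small S leaves a strong component with the majority of some fixed W.
-- A path that meets all these components is cut into segments that still meet them for all S of size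
-- less than b; by Menger's theorem any two sets of at most b cut points are linked by disjoint routes.
--
-- Group the cut points into q² subpaths P i j, each with b entries followed by b exits, and link P i j
-- in both directions to the hubs P i i and P j j by b disjoint routes each.  If all pairs of linkages
-- intersect sparsely, one route per linkage can be chosen so that the choices are disjoint; member i of
-- the bramble consists of the hub P i i with all P i j and P j i, and the congestion is 3.
--
-- Otherwise two linkages intersect densely.  Linkages back thread the routes of each into one walk
-- that uses a vertex at most three times.  Cut both walks into blocks: an intersection with another one
-- to its north-east and one to its south-west in the same pair of blocks lies on a closed walk inside
-- these two blocks.  Dependent random choice yields q closed walks and, for each ordered pair of them,
-- a connecting closed walk, all in different blocks; the congestion is 6.

module Submission where

open import Defs
open import Data.Nat using (ℕ; zero; suc; _+_; _*_; _∸_; _^_; _≤_; _<_; z≤n; s≤s; s≤s⁻¹; _⊔_; NonZero; nonZero)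
import Data.Nat.Properties as ℕ
open import Data.Fin using (Fin; zero; suc; toℕ; fromℕ<; punchOut; punchIn; inject≤; combine; remQuot; _↑ˡ_; _↑ʳ_)
import Data.Fin.Properties as Fin
open import Data.List using (List; []; _∷_; _++_; length; map; filter; concat; foldr; lookup; tabulate; allFin; deduplicate; cartesianProduct)
import Data.List.Properties as List
open import Data.List.Membership.Propositional using (_∈_; _∉_; find; lose)
open import Data.List.Membership.Propositional.Properties
open import Data.List.Relation.Binary.Subset.Propositional using (_⊆_)
open import Data.List.Relation.Unary.Any using (Any; here; there; index; any?)
open import Data.List.Relation.Unary.Any.Properties using (lookup-index)
open import Data.List.Relation.Unary.All using (All; []; _∷_)
import Data.List.Relation.Unary.All as All
open import Data.List.Relation.Unary.AllPairs using ([]; _∷_)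
open import Data.List.Relation.Unary.Unique.Propositional using (Unique)
open import Data.Product using (Σ; ∃; ∃-syntax; ∃₂; _×_; _,_; proj₁; proj₂)
open import Data.Sum using (_⊎_; inj₁; inj₂; [_,_]′)
open import Data.Empty using (⊥; ⊥-elim)
open import Data.Unit using (⊤; tt)
open import Function using (_∘_; id; case_of_)
open import Relation.Nullary using (¬_; Dec; yes; no; contradiction; does)
open import Relation.Nullary.Decidable using (⌊_⌋; _×-dec_; _⊎-dec_; ¬?; map′; decidable-stable)
open import Relation.Unary using (Decidable)
open import Relation.Binary.PropositionalEquality using (_≡_; _≢_; refl; sym; trans; cong; cong₂; subst; subst₂)
open import Relation.Binary using (tri<; tri≈; tri>)
open import Data.List.Relation.Unary.Unique.DecPropositional.Properties using (deduplicate-!)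
import Data.List.Relation.Unary.Unique.Propositional.Properties as Unique
import Data.Fin.Subset.Properties as Sub
import Data.List.Relation.Unary.All.Properties as All
import Data.Fin.Subset as Sub
open import Data.Fin.Subset using (Subset; ⁅_⁆; ∣_∣; ⋃; _∪_)
open import Data.Bool using (Bool; true; false; if_then_else_)
import Data.Vec as Vec
import Data.Vec.Properties as Vec
open import Data.List.Relation.Unary.Linked using (Linked; []; [-]; _∷_)
import Data.Bool as Bool
import Data.Product.Properties as Product
open import Algebra.Properties.Semiring.Sum ℕ.+-*-semiring using (sum; ∑-distrib-+; ∑-comm; *-distribˡ-sum; *-distribʳ-sum; sum-cong-≗; sum-remove)
open import Data.Nat.Tactic.RingSolver using (solve-∀)
import Data.Fin as Fin
open import Data.Nat.Logarithm using (⌈log₂_⌉; ⌈log₂⌉-mono-≤)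

-- The delicate point of the dense case is threading. The exits are therefore visited along the
-- cycles of the permutation, where the return already lands on the next exit; the path itself is
-- walked only when a cycle closes, forwards from the start of that cycle to the start of the next
-- one. These stretches are pairwise disjoint, and routes out, routes back and stretches are the
-- three uses of a vertex.
--
-- Two threads can be followed only forwards, so one crossing never closes a walk: two crossings in
-- opposite orders are needed, hence the two opposite corners.
--
-- Expectations are finite sums and small vertex sets are searched exhaustively, so everything is
-- constructive.
--
-- Constants: `2aB` blocks, each with two halves of cost `B`, need a haven of order `w = 4aB²`.
-- Density forces `B = a ^ 11`, and with `a = q ^ 2` the width `3w + 2` stays below
-- `a ^ 24 = q ^ 48`. Members of the family may coincide as subgraphs; merging them loses a factor
-- of at most 8, so `q` must be at least `8k`.

abstract
  injective⇒surjective : ∀ {k} (f : Fin k → Fin k) → (∀ {i j} → f i ≡ f j → i ≡ j) →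
                         ∀ y → ∃ λ x → f x ≡ y
  injective⇒surjective {suc k} f inj y with Fin.any? (λ x → f x Fin.≟ y)
  ... | yes hit = hit
  ... | no miss = ⊥-elim (ℕ.1+n≰n (Fin.injective⇒≤ {f = λ x → punchOut (λ e → miss (x , sym e))}
                    (λ e → inj (Fin.punchOut-injective (λ e → miss (_ , sym e)) (λ e → miss (_ , sym e)) e))))

Unique-lookup-injective : ∀ {A : Set} {xs : List A} → Unique xs → ∀ {i j} → lookup xs i ≡ lookup xs j → i ≡ j
Unique-lookup-injective (_ ∷ _) {zero}  {zero}  e = refl
Unique-lookup-injective (a ∷ _) {zero}  {suc j} e = contradiction e (All.lookup a (∈-lookup j))
Unique-lookup-injective (a ∷ _) {suc i} {zero}  e = contradiction (sym e) (All.lookup a (∈-lookup i))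
Unique-lookup-injective (_ ∷ u) {suc i} {suc j} e = cong suc (Unique-lookup-injective u e)

-- Routes

-- `Walk` over an arbitrary relation: the induction for Menger's theorem changes the arc set at
-- every step. Vertices may repeat.
data Route {A : Set} (R : A → A → Set) : A → A → Set where
  ⟨_⟩ : ∀ v → Route R v v
  _◂_ : ∀ {u w v} → R u w → Route R w v → Route R u v

infixr 5 _◂_

module _ {A : Set} {R : A → A → Set} where

  verts : ∀ {u v} → Route R u v → List A
  verts ⟨ v ⟩           = v ∷ []
  verts (_◂_ {u} _ p) = u ∷ verts p

  infixr 5 _⁀_

  _⁀_ : ∀ {u v w} → Route R u v → Route R v w → Route R u w
  ⟨ _ ⟩   ⁀ q = q
  (e ◂ p) ⁀ q = e ◂ (p ⁀ q)

  source∈ : ∀ {u v} (p : Route R u v) → u ∈ verts p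
  source∈ ⟨ _ ⟩   = here refl
  source∈ (e ◂ p) = here refl

  target∈ : ∀ {u v} (p : Route R u v) → v ∈ verts p
  target∈ ⟨ _ ⟩   = here refl
  target∈ (e ◂ p) = there (target∈ p)

  ∈-⁀⁻ : ∀ {u v w x} (p : Route R u v) (q : Route R v w) →
         x ∈ verts (p ⁀ q) → x ∈ verts p ⊎ x ∈ verts q
  ∈-⁀⁻ ⟨ _ ⟩   q m         = inj₂ m
  ∈-⁀⁻ (e ◂ p) q (here eq) = inj₁ (here eq)
  ∈-⁀⁻ (e ◂ p) q (there m) with ∈-⁀⁻ p q m
  ... | inj₁ l = inj₁ (there l)
  ... | inj₂ r = inj₂ r

  ∈-⁀⁺ʳ : ∀ {u v w x} (p : Route R u v) (q : Route R v w) → x ∈ verts q → x ∈ verts (p ⁀ q)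
  ∈-⁀⁺ʳ ⟨ _ ⟩   q m = m
  ∈-⁀⁺ʳ (e ◂ p) q m = there (∈-⁀⁺ʳ p q m)

  ∈-⁀⁺ˡ : ∀ {u v w x} (p : Route R u v) (q : Route R v w) → x ∈ verts p → x ∈ verts (p ⁀ q)
  ∈-⁀⁺ˡ ⟨ _ ⟩   q (here refl) = source∈ q
  ∈-⁀⁺ˡ (e ◂ p) q (here eq)   = here eq
  ∈-⁀⁺ˡ (e ◂ p) q (there m)   = there (∈-⁀⁺ˡ p q m)

  -- Only containments are recorded: later arguments ask where a route may go, never how long it is.
  record Split {u v} (p : Route R u v) (x : A) : Set where
    field
      before  : Route R u x
      after   : Route R x v
      before⊆ : verts before ⊆ verts p
      after⊆  : verts after ⊆ verts p

  split : ∀ {u v x} (p : Route R u v) → x ∈ verts p → Split p x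
  split ⟨ v ⟩   (here refl) = record { before = ⟨ v ⟩ ; after = ⟨ v ⟩ ; before⊆ = id ; after⊆ = id }
  split (e ◂ p) (here refl) = record
    { before = ⟨ _ ⟩ ; after = e ◂ p ; before⊆ = λ { (here refl) → here refl } ; after⊆ = id }
  split (e ◂ p) (there m) = record
    { before = e ◂ before ; after = after
    ; before⊆ = λ { (here eq) → here eq ; (there z) → there (before⊆ z) }
    ; after⊆ = there ∘ after⊆ }
    where open Split (split p m)

mapRoute : ∀ {A : Set} {R R′ : A → A → Set} → (∀ {u v} → R u v → R′ u v) →
           ∀ {u v} → Route R u v → Route R′ u v
mapRoute f ⟨ v ⟩   = ⟨ v ⟩
mapRoute f (e ◂ p) = f e ◂ mapRoute f p

verts-mapRoute : ∀ {A : Set} {R R′ : A → A → Set} (f : ∀ {u v} → R u v → R′ u v) →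
                 ∀ {u v} (p : Route R u v) → verts (mapRoute f p) ≡ verts p
verts-mapRoute f ⟨ v ⟩   = refl
verts-mapRoute f (e ◂ p) = cong (_ ∷_) (verts-mapRoute f p)

module Hits {A : Set} {R : A → A → Set} (Q : A → Set) (Q? : Decidable Q) where

  -- Whether the target lies in `Q` is left open, so a trivial route always qualifies.
  data FirstHit : ∀ {u v} → Route R u v → Set where
    ⟨⟩  : ∀ {v} → FirstHit ⟨ v ⟩
    _◂_ : ∀ {u w v} {e : R u w} {p : Route R w v} → ¬ Q u → FirstHit p → FirstHit (e ◂ p)

  data LastHit : ∀ {u v} → Route R u v → Set where
    ⟨⟩  : ∀ {v} → LastHit ⟨ v ⟩
    cons : ∀ {u w v} {e : R u w} {p : Route R w v} → (∀ {z} → z ∈ verts p → ¬ Q z) → LastHit (e ◂ p)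

  firstHit-end : ∀ {u v z} {p : Route R u v} → FirstHit p → z ∈ verts p → Q z → z ≡ v
  firstHit-end ⟨⟩       (here eq)   qz = eq
  firstHit-end (¬q ◂ h) (here refl) qz = contradiction qz ¬q
  firstHit-end (¬q ◂ h) (there m)   qz = firstHit-end h m qz

  lastHit-start : ∀ {u v z} {p : Route R u v} → LastHit p → z ∈ verts p → Q z → z ≡ u
  lastHit-start ⟨⟩       (here eq) qz = eq
  lastHit-start (cons h) (here eq) qz = eq
  lastHit-start (cons h) (there m) qz = contradiction qz (h m)

  prefix : ∀ {u v x} {p : Route R u v} → FirstHit p → x ∈ verts p →
           Σ (Route R u x) λ b → verts b ⊆ verts p × (∀ {z} → z ∈ verts b → Q z → z ≡ x)
  prefix ⟨⟩       (here refl) = ⟨ _ ⟩ , id , λ { (here eq) _ → eq }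
  prefix (¬q ◂ h) (here refl) = ⟨ _ ⟩ , (λ { (here eq) → here eq }) , λ { (here eq) _ → eq }
  prefix (_◂_ {e = e} ¬q h) (there m) with prefix h m
  ... | b , b⊆ , b-end = e ◂ b
      , (λ { (here eq) → here eq ; (there z) → there (b⊆ z) })
      , λ { (here refl) qz → contradiction qz ¬q ; (there z) qz → b-end z qz }

  suffix : ∀ {u v x} {p : Route R u v} → LastHit p → x ∈ verts p →
           Σ (Route R x v) λ b → verts b ⊆ verts p × (∀ {z} → z ∈ verts b → Q z → z ≡ x)
  suffix ⟨⟩ (here refl) = ⟨ _ ⟩ , id , λ { (here eq) _ → eq }
  suffix {p = e ◂ p} (cons h) (here refl) = e ◂ p , id , lastHit-start {p = e ◂ p} (cons h)
  suffix {p = e ◂ p} (cons h) (there m) = after , (λ z∈ → there (after⊆ z∈)) , λ z∈ qz → contradiction qz (h (after⊆ z∈))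
    where open Split (split p m)

  toFirstHit : ∀ {u v} (p : Route R u v) → Q v →
               ∃ λ t → Q t × Σ (Route R u t) λ b → FirstHit b × verts b ⊆ verts p
  toFirstHit {u} p qv with Q? u
  toFirstHit {u} p qv       | yes qu = u , qu , ⟨ u ⟩ , ⟨⟩ , λ { (here refl) → source∈ p }
  toFirstHit     ⟨ v ⟩   qv | no ¬qu = contradiction qv ¬qu
  toFirstHit     (e ◂ p) qv | no ¬qu with toFirstHit p qv
  ... | t , qt , b , h , b⊆ = t , qt , e ◂ b , ¬qu ◂ h , λ { (here eq) → here eq ; (there z) → there (b⊆ z) }

  fromLastHit : ∀ {u v} (p : Route R u v) → Any Q (verts p) →
                ∃ λ s → Q s × Σ (Route R s v) λ b → LastHit b × verts b ⊆ verts p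
  fromLastHit ⟨ v ⟩   (here qv) = v , qv , ⟨ v ⟩ , ⟨⟩ , id
  fromLastHit (e ◂ p) hit with any? Q? (verts p)
  ... | yes later with fromLastHit p later
  ...   | s , qs , b , h , b⊆ = s , qs , b , h , there ∘ b⊆
  fromLastHit (e ◂ p) (here qu)     | no none = _ , qu , e ◂ p , cons (λ z qz → none (lose z qz)) , id
  fromLastHit (e ◂ p) (there later) | no none = contradiction later none

-- Menger's theorem

module Menger {n : ℕ} where

  V : Set
  V = Fin n

  _∈V?_ : (v : V) (xs : List V) → Dec (v ∈ xs)
  v ∈V? xs = any? (v Fin.≟_) xs

  ArcIn : List (V × V) → V → V → Set
  ArcIn E u v = (u , v) ∈ E

  record Linkage (R : V → V → Set) (A B : List V) (k : ℕ) : Set where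
    field
      src tgt  : Fin k → V
      route    : ∀ i → Route R (src i) (tgt i)
      src∈     : ∀ i → src i ∈ A
      tgt∈     : ∀ i → tgt i ∈ B
      disjoint : ∀ {i j v} → v ∈ verts (route i) → v ∈ verts (route j) → i ≡ j

  mapLinkage : ∀ {R R′ A B k} → (∀ {u v} → R u v → R′ u v) → Linkage R A B k → Linkage R′ A B k
  mapLinkage f L = record
    { src = src ; tgt = tgt ; route = mapRoute f ∘ route ; src∈ = src∈ ; tgt∈ = tgt∈
    ; disjoint = λ {i} {j} p q → disjoint (subst (_ ∈_) (verts-mapRoute f (route i)) p)
                                          (subst (_ ∈_) (verts-mapRoute f (route j)) q) }
    where open Linkage L

  Separates : (V → V → Set) → List V → List V → List V → Set
  Separates R A B S = ∀ {u v} → u ∈ A → v ∈ B → (p : Route R u v) → ∃ λ z → z ∈ verts p × z ∈ S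

  module _ {R : V → V → Set} where

    -- Disjoint routes into a list P of their own number end at every position of P,
    -- so they can be indexed by these positions and cut at their first hit of P.
    record FanIn (A P : List V) : Set where
      open Hits {R = R} (_∈ P) (_∈V? P)
      field
        src      : Fin (length P) → V
        src∈     : ∀ c → src c ∈ A
        route    : ∀ c → Route R (src c) (lookup P c)
        first    : ∀ c → FirstHit (route c)
        disjoint : ∀ {c d v} → v ∈ verts (route c) → v ∈ verts (route d) → c ≡ d

      lookup-injective : ∀ {c d} → lookup P c ≡ lookup P d → c ≡ d
      lookup-injective {c} {d} e = disjoint (target∈ (route c)) (subst (_∈ verts (route d)) (sym e) (target∈ (route d)))

    record FanOut (Q B : List V) : Set where
      open Hits {R = R} (_∈ Q) (_∈V? Q)
      field
        tgt      : Fin (length Q) → V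
        tgt∈     : ∀ c → tgt c ∈ B
        route    : ∀ c → Route R (lookup Q c) (tgt c)
        last     : ∀ c → LastHit (route c)
        disjoint : ∀ {c d v} → v ∈ verts (route c) → v ∈ verts (route d) → c ≡ d

      lookup-injective : ∀ {c d} → lookup Q c ≡ lookup Q d → c ≡ d
      lookup-injective {c} {d} e = disjoint (source∈ (route c)) (subst (_∈ verts (route d)) (sym e) (source∈ (route d)))

    module _ {A P : List V} (L : Linkage R A P (length P)) where
      open Linkage L
      open Hits {R = R} (_∈ P) (_∈V? P)

      private
        cut : ∀ i → ∃ λ t → t ∈ P × Σ (Route R (src i) t) λ b → FirstHit b × verts b ⊆ verts (route i)
        cut i = toFirstHit (route i) (tgt∈ i)

        position : Fin (length P) → Fin (length P)
        position i = index (proj₁ (proj₂ (cut i)))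

        at-position : ∀ i → proj₁ (cut i) ≡ lookup P (position i)
        at-position i = lookup-index (proj₁ (proj₂ (cut i)))

        on-cut : ∀ i → proj₁ (cut i) ∈ verts (route i)
        on-cut i = proj₂ (proj₂ (proj₂ (proj₂ (cut i)))) (target∈ (proj₁ (proj₂ (proj₂ (cut i)))))

        pick : ∀ c → ∃ λ i → position i ≡ c
        pick = injective⇒surjective position λ {i} {j} e →
          disjoint (on-cut i) (subst (_∈ verts (route j)) (sym (trans (at-position i) (trans (cong (lookup P) e) (sym (at-position j))))) (on-cut j))

        piece : ∀ c → Σ (Route R (src (proj₁ (pick c))) (lookup P c)) λ b → FirstHit b × verts b ⊆ verts (route (proj₁ (pick c)))
        piece c with pick c
        ... | i , refl = subst (λ t → Σ (Route R (src i) t) λ b → FirstHit b × verts b ⊆ verts (route i))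
                               (at-position i) (proj₂ (proj₂ (cut i)))

      toFanIn : FanIn A P
      toFanIn = record
        { src = λ c → src (proj₁ (pick c)) ; src∈ = λ c → src∈ (proj₁ (pick c))
        ; route = λ c → proj₁ (piece c) ; first = λ c → proj₁ (proj₂ (piece c))
        ; disjoint = λ {c} {d} p q → trans (sym (proj₂ (pick c))) (trans
            (cong position (disjoint (proj₂ (proj₂ (piece c)) p) (proj₂ (proj₂ (piece d)) q))) (proj₂ (pick d))) }

    module _ {Q B : List V} (L : Linkage R Q B (length Q)) where
      open Linkage L
      open Hits {R = R} (_∈ Q) (_∈V? Q)

      private
        cut : ∀ i → ∃ λ s → s ∈ Q × Σ (Route R s (tgt i)) λ b → LastHit b × verts b ⊆ verts (route i)
        cut i = fromLastHit (route i) (lose (source∈ (route i)) (src∈ i))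

        position : Fin (length Q) → Fin (length Q)
        position i = index (proj₁ (proj₂ (cut i)))

        at-position : ∀ i → proj₁ (cut i) ≡ lookup Q (position i)
        at-position i = lookup-index (proj₁ (proj₂ (cut i)))

        on-cut : ∀ i → proj₁ (cut i) ∈ verts (route i)
        on-cut i = proj₂ (proj₂ (proj₂ (proj₂ (cut i)))) (source∈ (proj₁ (proj₂ (proj₂ (cut i)))))

        pick : ∀ c → ∃ λ i → position i ≡ c
        pick = injective⇒surjective position λ {i} {j} e →
          disjoint (on-cut i) (subst (_∈ verts (route j)) (sym (trans (at-position i) (trans (cong (lookup Q) e) (sym (at-position j))))) (on-cut j))

        piece : ∀ c → Σ (Route R (lookup Q c) (tgt (proj₁ (pick c)))) λ b → LastHit b × verts b ⊆ verts (route (proj₁ (pick c)))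
        piece c with pick c
        ... | i , refl = subst (λ s → Σ (Route R s (tgt i)) λ b → LastHit b × verts b ⊆ verts (route i))
                               (at-position i) (proj₂ (proj₂ (cut i)))

      toFanOut : FanOut Q B
      toFanOut = record
        { tgt = λ c → tgt (proj₁ (pick c)) ; tgt∈ = λ c → tgt∈ (proj₁ (pick c))
        ; route = λ c → proj₁ (piece c) ; last = λ c → proj₁ (proj₂ (piece c))
        ; disjoint = λ {c} {d} p q → trans (sym (proj₂ (pick c))) (trans
            (cong position (disjoint (proj₂ (proj₂ (piece c)) p) (proj₂ (proj₂ (piece d)) q))) (proj₂ (pick d))) }

  uncons-arc : ∀ {x y u v : V} {E} → (u , v) ∈ (x , y) ∷ E → (u ≡ x × v ≡ y) ⊎ (u , v) ∈ E
  uncons-arc (here refl) = inj₁ (refl , refl)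
  uncons-arc (there m)   = inj₂ m

  module _ {E : List (V × V)} {x y : V} {A B : List V} {S : List V} where

    E⁺ : List (V × V)
    E⁺ = (x , y) ∷ E

    -- The new arc can be used only after `x` has been visited, so everything up to the first vertex
    -- of `x ∷ S` runs in `E`.
    avoid-source : ∀ {u v} (p : Route (ArcIn E⁺) u v) →
      (∃ λ z → z ∈ x ∷ S × Σ (Route (ArcIn E) u z) λ q → verts q ⊆ verts p)
      ⊎ (Σ (Route (ArcIn E) u v) λ q → verts q ⊆ verts p × (∀ {z} → z ∈ verts q → z ∉ x ∷ S))
    avoid-source {u} p with u ∈V? (x ∷ S)
    ... | yes u∈ = inj₁ (u , u∈ , ⟨ u ⟩ , λ { (here refl) → source∈ p })
    avoid-source ⟨ v ⟩ | no u∉ = inj₂ (⟨ v ⟩ , id , λ { (here refl) → u∉ })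
    avoid-source (e ◂ p) | no u∉ with uncons-arc e
    ... | inj₁ (refl , _) = contradiction (here refl) u∉
    ... | inj₂ e′ with avoid-source p
    ...   | inj₁ (z , z∈ , q , q⊆) = inj₁ (z , z∈ , e′ ◂ q , λ { (here eq) → here eq ; (there m) → there (q⊆ m) })
    ...   | inj₂ (q , q⊆ , q∉) = inj₂ (e′ ◂ q
            , (λ { (here eq) → here eq ; (there m) → there (q⊆ m) })
            , λ { (here refl) → u∉ ; (there m) → q∉ m })

    -- The part after the last use of the new arc starts at `y` and runs in `E`.
    avoid-target : ∀ {u v} (p : Route (ArcIn E⁺) u v) →
      (Σ (Route (ArcIn E) y v) λ q → verts q ⊆ verts p)
      ⊎ (Σ (Route (ArcIn E) u v) λ q → verts q ⊆ verts p)
    avoid-target ⟨ v ⟩ = inj₂ (⟨ v ⟩ , id)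
    avoid-target (e ◂ p) with avoid-target p
    ... | inj₁ (q , q⊆) = inj₁ (q , there ∘ q⊆)
    ... | inj₂ (q , q⊆) with uncons-arc e
    ...   | inj₁ (_ , refl) = inj₁ (q , there ∘ q⊆)
    ...   | inj₂ e′ = inj₂ (e′ ◂ q , λ { (here eq) → here eq ; (there m) → there (q⊆ m) })

    module _ (sep : Separates (ArcIn E) A B S) where

      separates-new : Separates (ArcIn E⁺) A B (x ∷ S)
      separates-new u∈ v∈ p with avoid-source p
      ... | inj₁ (z , z∈ , q , q⊆) = z , q⊆ (target∈ q) , z∈
      ... | inj₂ (q , q⊆ , q∉) with sep u∈ v∈ q
      ...   | z , z∈q , z∈S = contradiction (there z∈S) (q∉ z∈q)

      -- A route avoiding `x ∷ S` would lie in `E` and miss `S`. So every route reaches `x ∷ S`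
      -- through `E`, and `S′` cuts that part.
      separates-before : ∀ {S′} → Separates (ArcIn E) A (x ∷ S) S′ → Separates (ArcIn E⁺) A B S′
      separates-before sep′ u∈ v∈ p with avoid-source p
      ... | inj₁ (z , z∈ , q , q⊆) with sep′ u∈ z∈ q
      ...   | w , w∈q , w∈S′ = w , q⊆ w∈q , w∈S′
      separates-before sep′ u∈ v∈ p | inj₂ (q , q⊆ , q∉) with sep u∈ v∈ q
      ...   | z , z∈q , z∈S = contradiction (there z∈S) (q∉ z∈q)

      separates-after : ∀ {S′} → Separates (ArcIn E) (y ∷ S) B S′ → Separates (ArcIn E⁺) A B S′
      separates-after sep′ u∈ v∈ p with avoid-target p
      ... | inj₁ (q , q⊆) with sep′ (here refl) v∈ q
      ...   | w , w∈q , w∈S′ = w , q⊆ w∈q , w∈S′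
      separates-after sep′ u∈ v∈ p | inj₂ (q , q⊆) with sep u∈ v∈ q
      ...   | z , z∈q , z∈S with sep′ (there z∈S) v∈ (Split.after (split q z∈q))
      ...     | w , w∈ , w∈S′ = w , q⊆ (Split.after⊆ (split q z∈q) w∈) , w∈S′

      module Glue (F : FanIn {ArcIn E} A (x ∷ S)) (F′ : FanOut {ArcIn E} (y ∷ S) B) where

        private
          module F  = FanIn F
          module F′ = FanOut F′
          module H₁ = Hits {R = ArcIn E} (_∈ x ∷ S) (_∈V? (x ∷ S))
          module H₂ = Hits {R = ArcIn E} (_∈ y ∷ S) (_∈V? (y ∷ S))

        -- The first route up to `v` followed by the second from `v` on leads from `A` to `B` within
        -- `E`, so it hits `S` at some `z`. As the first part meets `x ∷ S` only at its end and the
        -- second meets `y ∷ S` only at its start, `z` is `v`.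
        crossing : ∀ {c d v} → v ∈ verts (F.route c) → v ∈ verts (F′.route d) →
                   v ∈ S × v ≡ lookup (x ∷ S) c × v ≡ lookup (y ∷ S) d
        crossing {c} {d} v∈f v∈b with H₁.prefix (F.first c) v∈f | H₂.suffix (F′.last d) v∈b
        ... | p , p⊆ , p-end | q , q⊆ , q-start
          with sep (F.src∈ c) (F′.tgt∈ d) (p ⁀ q)
        ... | z , z∈ , z∈S = meets (∈-⁀⁻ p q z∈)
          where
          at-S : ∀ {v} → v ≡ z → v ∈ verts (F.route c) → v ∈ verts (F′.route d) →
                 v ∈ S × v ≡ lookup (x ∷ S) c × v ≡ lookup (y ∷ S) d
          at-S refl v∈f v∈b = z∈S , H₁.firstHit-end (F.first c) v∈f (there z∈S) , H₂.lastHit-start (F′.last d) v∈b (there z∈S)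
          meets : z ∈ verts p ⊎ z ∈ verts q → _
          meets (inj₁ z∈p) = at-S (sym (p-end z∈p (there z∈S))) v∈f v∈b
          meets (inj₂ z∈q) = at-S (sym (q-start z∈q (there z∈S))) v∈f v∈b

        crossing-index : ∀ {c d v} → v ∈ verts (F.route c) → v ∈ verts (F′.route d) → c ≡ d
        crossing-index v∈f v∈b with crossing v∈f v∈b
        ... | v∈S , v≡f , v≡b =
          trans (F.lookup-injective {d = suc (index v∈S)} (trans (sym v≡f) (lookup-index v∈S)))
                (sym (F′.lookup-injective {d = suc (index v∈S)} (trans (sym v≡b) (lookup-index v∈S))))

        widen : ∀ {u v} → Route (ArcIn E) u v → Route (ArcIn E⁺) u v
        widen = mapRoute there

        -- The lists `x ∷ S` and `y ∷ S` agree position by position except at the head, where the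
        -- deleted arc joins them.
        bridge : ∀ c → Σ (Route (ArcIn E⁺) (lookup (x ∷ S) c) (lookup (y ∷ S) c)) λ r →
                   ∀ {v} → v ∈ verts r → v ≡ lookup (x ∷ S) c ⊎ v ≡ lookup (y ∷ S) c
        bridge zero    = here refl ◂ ⟨ y ⟩ , λ { (here e) → inj₁ e ; (there (here e)) → inj₂ e }
        bridge (suc c) = ⟨ _ ⟩ , λ { (here e) → inj₁ e }

        joined : ∀ c → Route (ArcIn E⁺) (F.src c) (F′.tgt c)
        joined c = widen (F.route c) ⁀ (proj₁ (bridge c) ⁀ widen (F′.route c))

        joined⁻ : ∀ c {v} → v ∈ verts (joined c) → v ∈ verts (F.route c) ⊎ v ∈ verts (F′.route c)
        joined⁻ c m with ∈-⁀⁻ (widen (F.route c)) _ m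
        ... | inj₁ l = inj₁ (subst (_ ∈_) (verts-mapRoute there (F.route c)) l)
        ... | inj₂ r with ∈-⁀⁻ (proj₁ (bridge c)) _ r
        ...   | inj₂ r′ = inj₂ (subst (_ ∈_) (verts-mapRoute there (F′.route c)) r′)
        ...   | inj₁ l with proj₂ (bridge c) l
        ...     | inj₁ e = inj₁ (subst (_∈ verts (F.route c)) (sym e) (target∈ (F.route c)))
        ...     | inj₂ e = inj₂ (subst (_∈ verts (F′.route c)) (sym e) (source∈ (F′.route c)))

        joined-disjoint : ∀ {c d v} → v ∈ verts (joined c) → v ∈ verts (joined d) → c ≡ d
        joined-disjoint {c} {d} p q with joined⁻ c p | joined⁻ d q
        ... | inj₁ p′ | inj₁ q′ = F.disjoint p′ q′
        ... | inj₂ p′ | inj₂ q′ = F′.disjoint p′ q′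
        ... | inj₁ p′ | inj₂ q′ = crossing-index p′ q′
        ... | inj₂ p′ | inj₁ q′ = sym (crossing-index q′ p′)

        glued : Linkage (ArcIn E⁺) A B (suc (length S))
        glued = record
          { src = F.src ; tgt = F′.tgt ; route = joined
          ; src∈ = F.src∈ ; tgt∈ = F′.tgt∈ ; disjoint = joined-disjoint }

  abstract
    -- Göring's proof: delete an arc (x , y); a small separator S of the rest yields
    -- the two sets x ∷ S and y ∷ S, and linkages into the first and out of the second are glued along S.
    menger : ∀ E A B k → Linkage (ArcIn E) A B k ⊎ (∃ λ S → length S < k × Separates (ArcIn E) A B S)
    -- Without arcs all routes are trivial: the common vertices `C` of `A` and `B` are linked to
    -- themselves, and they separate.
    menger [] A B k = trivial
      where
      C : List V
      C = deduplicate Fin._≟_ (filter (_∈V? B) A)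
      C! : Unique C
      C! = deduplicate-! Fin._≟_ (filter (_∈V? B) A)
      C∈ : ∀ {v} → v ∈ C → v ∈ A × v ∈ B
      C∈ v∈C = ∈-filter⁻ (_∈V? B) {xs = A} (∈-deduplicate⁻ Fin._≟_ (filter (_∈V? B) A) v∈C)
      trivial : Linkage (ArcIn []) A B k ⊎ (∃ λ S → length S < k × Separates (ArcIn []) A B S)
      trivial with k ℕ.≤? length C
      ... | no k≰ = inj₂ (C , ℕ.≰⇒> k≰ , λ { u∈A u∈B ⟨ u ⟩ → u , here refl
                     , ∈-deduplicate⁺ Fin._≟_ (∈-filter⁺ (_∈V? B) u∈A u∈B) })
      ... | yes k≤ = inj₁ (record
              { src = pick ; tgt = pick ; route = λ i → ⟨ pick i ⟩
              ; src∈ = λ i → proj₁ (C∈ (∈-lookup (inject≤ i k≤))) ; tgt∈ = λ i → proj₂ (C∈ (∈-lookup (inject≤ i k≤)))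
              ; disjoint = λ { {i} {j} (here p) (here q) →
                  Fin.inject≤-injective k≤ k≤ i j (Unique-lookup-injective C! (trans (sym p) q)) } })
              where
              pick : Fin k → V
              pick i = lookup C (inject≤ i k≤)
    menger ((x , y) ∷ E) A B k with menger E A B k
    ... | inj₁ L = inj₁ (mapLinkage there L)
    ... | inj₂ (S , S<k , sep) with suc (length S) ℕ.<? k
    ...   | yes small = inj₂ (x ∷ S , small , separates-new sep)
    ...   | no ¬small with menger E A (x ∷ S) k
    ...     | inj₂ (S′ , S′<k , sep′) = inj₂ (S′ , S′<k , separates-before {y = y} sep sep′)
    ...     | inj₁ L₁ with menger E (y ∷ S) B k
    ...       | inj₂ (S′ , S′<k , sep′) = inj₂ (S′ , S′<k , separates-after {x = x} sep sep′)
    -- Both `length S < k` and `k ≤ suc (length S)` hold, so the linkages have exactly as many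
    -- routes as `x ∷ S` and `y ∷ S` have positions.
    ...       | inj₁ L₂ = inj₁ (glue (ℕ.≤-antisym (ℕ.≮⇒≥ ¬small) S<k) L₁ L₂)
      where
      glue : k ≡ suc (length S) → Linkage (ArcIn E) A (x ∷ S) k → Linkage (ArcIn E) (y ∷ S) B k →
             Linkage (ArcIn ((x , y) ∷ E)) A B k
      glue refl L₁ L₂ = Glue.glued sep (toFanIn L₁) (toFanOut L₂)

-- Strong components and havens

count : ∀ {A : Set} {P : A → Set} → Decidable P → List A → ℕ
count P? xs = length (filter P? xs)

count-mono : ∀ {A : Set} {P Q : A → Set} (P? : Decidable P) (Q? : Decidable Q) →
             (∀ {x} → P x → Q x) → ∀ xs → count P? xs ≤ count Q? xs
count-mono P? Q? f [] = z≤n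
count-mono P? Q? f (x ∷ xs) with P? x | Q? x
... | yes p | yes q = s≤s (count-mono P? Q? f xs)
... | yes p | no ¬q = contradiction (f p) ¬q
... | no ¬p | yes q = ℕ.m≤n⇒m≤1+n (count-mono P? Q? f xs)
... | no ¬p | no ¬q = count-mono P? Q? f xs

abstract
  majorities-meet : ∀ {A : Set} {P Q : A → Set} (P? : Decidable P) (Q? : Decidable Q) xs →
                    length xs < count P? xs + count Q? xs → ∃ λ x → P x × Q x
  majorities-meet P? Q? (x ∷ xs) lt with P? x | Q? x
  ... | yes p | yes q = x , p , q
  ... | yes p | no ¬q = majorities-meet P? Q? xs (s≤s⁻¹ lt)
  ... | no ¬p | yes q = majorities-meet P? Q? xs (s≤s⁻¹ (subst (suc (length (x ∷ xs)) ≤_) (ℕ.+-suc _ _) lt))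
  ... | no ¬p | no ¬q = majorities-meet P? Q? xs (ℕ.<⇒≤ lt)

collect : ∀ {n} {P : Fin n → Set} {B : Set} → (∀ i → P i ⊎ B) → (∀ i → P i) ⊎ B
collect {zero}  d = inj₁ λ ()
collect {suc n} d with d zero | collect (d ∘ suc)
... | inj₂ b | _      = inj₂ b
... | inj₁ _ | inj₂ b = inj₂ b
... | inj₁ p | inj₁ f = inj₁ λ { zero → p ; (suc i) → f i }

abstract
  -- Small vertex sets are lists of bounded length, so statements about all of them are decided by
  -- finite search, and a failure comes with a witness.
  search : ∀ {n} {P : List (Fin n) → Set} → Decidable P → ∀ k →
           (∀ xs → length xs ≤ k → P xs) ⊎ (∃ λ xs → length xs ≤ k × ¬ P xs)
  search P? k with P? []
  search P? k       | no ¬p = inj₂ ([] , z≤n , ¬p)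
  search P? zero    | yes p = inj₁ λ { [] _ → p }
  search {P = P} P? (suc k) | yes p with collect (λ x → lift x (search (λ xs → P? (x ∷ xs)) k))
    where
    lift : ∀ x → (∀ xs → length xs ≤ k → P (x ∷ xs)) ⊎ (∃ λ xs → length xs ≤ k × ¬ P (x ∷ xs)) →
           (∀ xs → length xs ≤ k → P (x ∷ xs)) ⊎ (∃ λ xs → length xs ≤ suc k × ¬ P xs)
    lift x (inj₁ f) = inj₁ f
    lift x (inj₂ (xs , l , ¬q)) = inj₂ (x ∷ xs , s≤s l , ¬q)
  ... | inj₁ f = inj₁ λ { [] _ → p ; (x ∷ xs) (s≤s l) → f x xs l }
  ... | inj₂ b = inj₂ b

module Reachability {n : ℕ} (G : Digraph n) where

  open Menger {n} public

  Reach : (V → Set) → V → V → Set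
  Reach Q u v = Σ (Route (Arc G) u v) λ p → ∀ {z} → z ∈ verts p → Q z

  stay : ∀ {Q u} → Q u → Reach Q u u
  stay q = ⟨ _ ⟩ , λ { (here refl) → q }

  reach-trans : ∀ {Q u v w} → Reach Q u v → Reach Q v w → Reach Q u w
  reach-trans (p , p-in) (q , q-in) = p ⁀ q , λ z∈ → [ p-in , q-in ]′ (∈-⁀⁻ p q z∈)

  reach-mono : ∀ {Q Q′ u v} → (∀ {z} → Q z → Q′ z) → Reach Q u v → Reach Q′ u v
  reach-mono f (p , p-in) = p , f ∘ p-in

  reach-source : ∀ {Q u v} → Reach Q u v → Q u
  reach-source (p , p-in) = p-in (source∈ p)

  reach-target : ∀ {Q u v} → Reach Q u v → Q v
  reach-target (p , p-in) = p-in (target∈ p)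

  reach-before : ∀ {Q u v z} (r : Reach Q u v) → z ∈ verts (proj₁ r) → Reach Q u z
  reach-before (p , p-in) m = Split.before s , p-in ∘ Split.before⊆ s
    where s = split p m

  reach-after : ∀ {Q u v z} (r : Reach Q u v) → z ∈ verts (proj₁ r) → Reach Q z v
  reach-after (p , p-in) m = Split.after s , p-in ∘ Split.after⊆ s
    where s = split p m

  arc? : ∀ u v → Dec (Arc G u v)
  arc? u v = v Sub.∈? _

  module _ {Q : V → Set} (Q? : Decidable Q) where

    Inside : V × V → Set
    Inside (u , v) = Arc G u v × Q u × Q v

    inside? : Decidable Inside
    inside? (u , v) = arc? u v ×-dec Q? u ×-dec Q? v

    arcs : List (V × V)
    arcs = filter inside? (cartesianProduct (allFin n) (allFin n))

    arcs⁺ : ∀ {u v} → Arc G u v → Q u → Q v → (u , v) ∈ arcs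
    arcs⁺ a qu qv = ∈-filter⁺ inside? (∈-cartesianProduct⁺ (∈-allFin _) (∈-allFin _)) (a , qu , qv)

    arcs⁻ : ∀ {u v} → (u , v) ∈ arcs → Arc G u v × Q u × Q v
    arcs⁻ m = proj₂ (∈-filter⁻ inside? {xs = cartesianProduct (allFin n) (allFin n)} m)

    arcs-route⁺ : ∀ {u v} (p : Route (Arc G) u v) → (∀ {z} → z ∈ verts p → Q z) → Route (ArcIn arcs) u v
    arcs-route⁺ ⟨ v ⟩   p-in = ⟨ v ⟩
    arcs-route⁺ (a ◂ p) p-in = arcs⁺ a (p-in (here refl)) (p-in (there (source∈ p))) ◂ arcs-route⁺ p (p-in ∘ there)

    arcs-route⁻ : ∀ {u v} → Q u → Route (ArcIn arcs) u v → Reach Q u v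
    arcs-route⁻ qu ⟨ v ⟩   = stay qu
    arcs-route⁻ qu (a ◂ p) with arcs⁻ a
    ... | arc , _ , qw with arcs-route⁻ qw p
    ...   | p′ , p-in = arc ◂ p′ , λ { (here refl) → qu ; (there m) → p-in m }

    abstract
      -- Menger's theorem with `k = 1`: either there is one route, or the empty list separates and
      -- there is none.
      reach? : ∀ u v → Dec (Reach Q u v)
      reach? u v with Q? u
      ... | no ¬qu = no (¬qu ∘ reach-source)
      ... | yes qu with menger arcs (u ∷ []) (v ∷ []) 1
      ...   | inj₂ ([] , _ , sep) = no λ (p , p-in) →
                case proj₂ (proj₂ (sep (here refl) (here refl) (arcs-route⁺ p p-in))) of λ ()
      ...   | inj₂ (_ ∷ _ , s≤s () , _)
      ...   | inj₁ L with Linkage.src L zero | Linkage.tgt L zero | Linkage.route L zero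
                        | Linkage.src∈ L zero | Linkage.tgt∈ L zero
      ...     | _ | _ | p | here refl | here refl = yes (arcs-route⁻ qu p)

  mengerG : ∀ A B k → Linkage (Arc G) A B k ⊎ (∃ λ S → length S < k × Separates (Arc G) A B S)
  mengerG A B k with menger (arcs {Q = λ _ → ⊤} (λ _ → yes tt)) A B k
  ... | inj₁ L = inj₁ (mapLinkage (λ m → proj₁ (arcs⁻ (λ _ → yes tt) m)) L)
  ... | inj₂ (S , l , sep) = inj₂ (S , l , λ u∈ v∈ p → back p (sep u∈ v∈ (mapRoute in-arcs p)))
    where
    in-arcs : ∀ {u v} → Arc G u v → (u , v) ∈ arcs {Q = λ _ → ⊤} (λ _ → yes tt)
    in-arcs a = arcs⁺ (λ _ → yes tt) a tt tt
    back : ∀ {u v} (p : Route (Arc G) u v) → (∃ λ z → z ∈ verts (mapRoute in-arcs p) × z ∈ S) →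
           ∃ λ z → z ∈ verts p × z ∈ S
    back p (z , z∈ , z∈S) = z , subst (z ∈_) (verts-mapRoute in-arcs p) z∈ , z∈S

  SC : List V → V → V → Set
  SC S u v = Reach (_∉ S) u v × Reach (_∉ S) v u

  abstract
    sc? : ∀ S u v → Dec (SC S u v)
    sc? S u v = reach? (λ z → ¬? (z ∈V? S)) u v ×-dec reach? (λ z → ¬? (z ∈V? S)) v u

  sc-refl : ∀ {S u} → u ∉ S → SC S u u
  sc-refl u∉ = stay u∉ , stay u∉

  sc-sym : ∀ {S u v} → SC S u v → SC S v u
  sc-sym (p , q) = q , p

  sc-trans : ∀ {S u v w} → SC S u v → SC S v w → SC S u w
  sc-trans (p , q) (p′ , q′) = reach-trans p p′ , reach-trans q′ q

  sc-mono : ∀ {S S′ u v} → S ⊆ S′ → SC S′ u v → SC S u v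
  sc-mono S⊆ (p , q) = reach-mono (_∘ S⊆) p , reach-mono (_∘ S⊆) q

  sc-on : ∀ {S u v z} (r : Reach (_∉ S) u v) → Reach (_∉ S) v u → z ∈ verts (proj₁ r) → SC S u z
  sc-on r r′ m = reach-before r m , reach-trans (reach-after r m) r′

  Balanced : ℕ → List V → List V → Set
  Balanced w S W = ∀ v → v ∉ S → count (sc? S v) W ≤ w

  balanced? : ∀ w S W → Dec (Balanced w S W)
  balanced? w S W with Fin.all? (λ v → v ∈V? S ⊎-dec (count (sc? S v) W ℕ.≤? w))
  ... | yes f = yes λ v v∉ → [ (λ v∈ → contradiction v∈ v∉) , id ]′ (f v)
  ... | no ¬f = no λ b → ¬f λ v → decide v b
    where
    decide : ∀ v → Balanced w S W → v ∈ S ⊎ count (sc? S v) W ≤ w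
    decide v b with v ∈V? S
    ... | yes v∈ = inj₁ v∈
    ... | no v∉ = inj₂ (b v v∉)

  -- In the instance below, `Big S` is the strong component of `G − S` with the majority of `W`; the
  -- set `W` itself is forgotten. The field `common` lets a route cross from one such set into
  -- another.
  record Haven (w : ℕ) : Set₁ where
    field
      Big    : List V → V → Set
      big?   : ∀ S → Decidable (Big S)
      exist  : ∀ S → length S ≤ w → ∃ (Big S)
      avoid  : ∀ {S z} → Big S z → z ∉ S
      mono   : ∀ {S S′ z} → S ⊆ S′ → Big S′ z → Big S z
      conn   : ∀ {S u v} → Big S u → Big S v → Reach (Big S) u v
      common : ∀ {S S′ u v} → Big S u → Big S′ v → ∃ λ x → Big S x × Big S′ x

  module _ (w : ℕ) (W : List V) (W≤ : length W ≤ suc (2 * w))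
           (unbalanced : ∀ S → length S ≤ w → ¬ Balanced w S W) where

    private
      Big : List V → V → Set
      Big S z = z ∉ S × w < count (sc? S z) W

      big-sc : ∀ {S u v} → Big S u → SC S u v → Big S v
      big-sc (u∉ , lt) sc = reach-target (proj₁ sc)
        , ℕ.≤-trans lt (count-mono (sc? _ _) (sc? _ _) (sc-trans (sc-sym sc)) W)

      -- Each component holds at least `w + 1` of at most `2w + 1` elements of `W`, so two of them
      -- share one. This fixes the bound on `W`.
      meet : ∀ {S S′ u v} → Big S u → Big S′ v → ∃ λ x → SC S u x × SC S′ v x
      meet {S} {S′} {u} {v} (_ , lt) (_ , lt′) = majorities-meet (sc? S u) (sc? S′ v) W
        (ℕ.≤-trans (s≤s W≤) (subst (_≤ count (sc? S u) W + count (sc? S′ v) W) two (ℕ.+-mono-≤ lt lt′)))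
        where
        two : suc w + suc w ≡ suc (suc (2 * w))
        two = cong suc (trans (ℕ.+-suc w w) (cong (λ z → suc (w + z)) (sym (ℕ.+-identityʳ w))))

    majority-haven : Haven w
    majority-haven = record
      { Big = Big
      ; big? = λ S z → ¬? (z ∈V? S) ×-dec (w ℕ.<? count (sc? S z) W)
      ; exist = exist
      ; avoid = proj₁
      ; mono = λ S⊆ (z∉ , lt) → z∉ ∘ S⊆ , ℕ.≤-trans lt (count-mono (sc? _ _) (sc? _ _) (sc-mono S⊆) W)
      ; conn = λ bu bv → let x , su , sv = meet bu bv ; s = sc-trans su (sc-sym sv) in
                 proj₁ (proj₁ s) , λ m → big-sc bu (sc-on (proj₁ s) (proj₂ s) m)
      ; common = λ bu bv → let x , su , sv = meet bu bv in x , big-sc bu su , big-sc bv sv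
      }
      where
      exist : ∀ S → length S ≤ w → ∃ (Big S)
      exist S S≤ with Fin.any? (λ v → ¬? (v ∈V? S) ×-dec (w ℕ.<? count (sc? S v) W))
      ... | yes b = b
      ... | no none = contradiction
              (λ v v∉ → ℕ.≮⇒≥ (λ lt → none (v , v∉ , lt)))
              (unbalanced S S≤)

  Separable : ℕ → Set
  Separable w = ∀ W → length W ≤ suc (2 * w) → ∃ λ S → length S ≤ w × Balanced w S W

  separable-or-haven : ∀ w → Separable w ⊎ Haven w
  separable-or-haven w with search separator? (suc (2 * w))
    where
    separator? : ∀ W → Dec (∃ λ S → length S ≤ w × Balanced w S W)
    separator? W with search (λ S → ¬? (balanced? w S W)) w
    ... | inj₁ none = no λ (S , S≤ , b) → none S S≤ b
    ... | inj₂ (S , S≤ , ¬¬b) = yes (S , S≤ , decidable-stable (balanced? w S W) ¬¬b)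
  ... | inj₁ s = inj₁ s
  ... | inj₂ (W , W≤ , none) = inj₂ (majority-haven w W W≤ λ S S≤ b → none (S , S≤ , b))

-- Arboreal decompositions

fromList : ∀ {n} → List (Fin n) → Subset n
fromList xs = ⋃ (map ⁅_⁆ xs)

∈-fromList⁺ : ∀ {n} {v : Fin n} {xs} → v ∈ xs → v Sub.∈ fromList xs
∈-fromList⁺ {v = v} {x ∷ xs} (here refl) = Sub.x∈p∪q⁺ (inj₁ (Sub.x∈⁅x⁆ v))
∈-fromList⁺ {xs = x ∷ xs} (there m)      = Sub.x∈p∪q⁺ (inj₂ (∈-fromList⁺ m))

∈-fromList⁻ : ∀ {n} {v : Fin n} xs → v Sub.∈ fromList xs → v ∈ xs
∈-fromList⁻ []       m = contradiction m Sub.∉⊥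
∈-fromList⁻ (x ∷ xs) m with Sub.x∈p∪q⁻ ⁅ x ⁆ _ m
... | inj₁ l = here (Sub.x∈⁅y⁆⇒x≡y x l)
... | inj₂ r = there (∈-fromList⁻ xs r)

∣p∪q∣≤∣p∣+∣q∣ : ∀ {n} (p q : Subset n) → ∣ p ∪ q ∣ ≤ ∣ p ∣ + ∣ q ∣
∣p∪q∣≤∣p∣+∣q∣ Vec.[] Vec.[] = z≤n
∣p∪q∣≤∣p∣+∣q∣ (true Vec.∷ p) (true Vec.∷ q)   = s≤s (ℕ.≤-trans (∣p∪q∣≤∣p∣+∣q∣ p q) (ℕ.+-monoʳ-≤ ∣ p ∣ (ℕ.n≤1+n _)))
∣p∪q∣≤∣p∣+∣q∣ (true Vec.∷ p) (false Vec.∷ q)  = s≤s (∣p∪q∣≤∣p∣+∣q∣ p q)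
∣p∪q∣≤∣p∣+∣q∣ (false Vec.∷ p) (true Vec.∷ q)  = subst (suc ∣ p ∪ q ∣ ≤_) (sym (ℕ.+-suc _ _)) (s≤s (∣p∪q∣≤∣p∣+∣q∣ p q))
∣p∪q∣≤∣p∣+∣q∣ (false Vec.∷ p) (false Vec.∷ q) = ∣p∪q∣≤∣p∣+∣q∣ p q

∣fromList∣≤ : ∀ {n} (xs : List (Fin n)) → ∣ fromList xs ∣ ≤ length xs
∣fromList∣≤ {n} [] = ℕ.≤-reflexive (Sub.∣⊥∣≡0 n)
∣fromList∣≤ (x ∷ xs) = ℕ.≤-trans (∣p∪q∣≤∣p∣+∣q∣ ⁅ x ⁆ (fromList xs))
  (ℕ.+-mono-≤ (ℕ.≤-reflexive (Sub.∣⁅x⁆∣≡1 x)) (∣fromList∣≤ xs))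

∈-⋃⁻ : ∀ {n} {v : Fin n} ps → v Sub.∈ ⋃ ps → ∃ λ p → p ∈ ps × v Sub.∈ p
∈-⋃⁻ []       m = contradiction m Sub.∉⊥
∈-⋃⁻ (p ∷ ps) m with Sub.x∈p∪q⁻ p _ m
... | inj₁ l = p , here refl , l
... | inj₂ r with ∈-⋃⁻ ps r
...   | q , q∈ , v∈ = q , there q∈ , v∈

∈-Vec-tabulate⁻ : ∀ {n} {f : Fin n → Bool} {v} → v Sub.∈ Vec.tabulate f → f v ≡ true
∈-Vec-tabulate⁻ {f = f} {v} m = trans (sym (Vec.lookup∘tabulate f v)) (Vec.[]=⇒lookup m)

∈-Vec-tabulate⁺ : ∀ {n} {f : Fin n → Bool} {v} → f v ≡ true → v Sub.∈ Vec.tabulate f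
∈-Vec-tabulate⁺ {f = f} {v} e = Vec.lookup⇒[]= v _ (trans (Vec.lookup∘tabulate f v) e)

⌊⌋⁻ : ∀ {P : Set} (d : Dec P) → ⌊ d ⌋ ≡ true → P
⌊⌋⁻ (yes p) _ = p

⌊⌋⁺ : ∀ {P : Set} (d : Dec P) → P → ⌊ d ⌋ ≡ true
⌊⌋⁺ (yes _) _ = refl
⌊⌋⁺ (no ¬p) p = contradiction p ¬p

upd : ∀ {A : Set} → ℕ → A → (ℕ → A) → ℕ → A
upd k x f j with j ℕ.≟ k
... | yes _ = x
... | no _  = f j

upd-hit : ∀ {A : Set} k {x : A} {f} → upd k x f k ≡ x
upd-hit k with k ℕ.≟ k
... | yes _ = refl
... | no ≢ = contradiction refl ≢

upd-miss : ∀ {A : Set} {k j} {x : A} {f} → j ≢ k → upd k x f j ≡ f j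
upd-miss {k = k} {j} ≢ with j ℕ.≟ k
... | yes e = contradiction e ≢
... | no _ = refl

-- `Desc` on natural numbers: the tree grows node by node, and the old nodes need no re-embedding
-- into a larger `Fin`.
data Below (par : ℕ → ℕ) (s : ℕ) : ℕ → Set where
  here  : Below par s s
  below : ∀ {j} → Below par s (par j) → Below par s (suc j)

module Decompose {n : ℕ} (G : Digraph n) (w : ℕ) where

  open Reachability G

  -- `W` guards the arc into the node and `S` balances `W`. The core `X` will contain the bag and
  -- all incident guards, whence the bound `(2w + 1) + (w + 1)`.
  record Node : Set where
    field
      W S  : List V
      S≤   : length S ≤ suc w
      size : length (W ++ S) ≤ suc (2 * w) + suc w
      bal  : Balanced w S W
    X : List V
    X = W ++ S

  -- A vertex outside the core of its node is only parked there. By `closed`, the vertices of its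
  -- strong component outside the core are parked with it, so the component can be split off as a
  -- leaf; `avoids` and `convex` are normality of the guards.
  record Partial : Set where
    field
      m       : ℕ
      par     : ℕ → ℕ
      par≤    : ∀ {j} → j < m → par j ≤ j
      bag     : V → ℕ
      bag≤    : ∀ v → bag v ≤ m
      node    : ℕ → Node
    open Node
    field
      guard⊆  : ∀ {j} → j < m → W (node (suc j)) ⊆ X (node (par j))
      avoids  : ∀ {j v} → j < m → Below par (suc j) (bag v) → v ∉ W (node (suc j))
      convex  : ∀ {j u v z} → j < m → (r : Reach (_∉ W (node (suc j))) u v) →
                Below par (suc j) (bag u) → Below par (suc j) (bag v) →
                z ∈ verts (proj₁ r) → Below par (suc j) (bag z)
      closed  : ∀ {v u} → v ∉ X (node (bag v)) → SC (X (node (bag v))) v u → bag u ≡ bag v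

    Done : V → Set
    Done v = v ∈ X (node (bag v))

  module _ (sep : Separable w) where

    newNode : (W : List V) → length W ≤ suc (2 * w) → V → Node
    newNode W W≤ v with sep W W≤
    ... | S , S≤ , b = record
      -- Putting `v` into the core guarantees progress; enlarging `S` cannot destroy balance.
      { W = W ; S = v ∷ S ; S≤ = s≤s S≤
      ; size = subst (_≤ suc (2 * w) + suc w) (sym (List.length-++ W)) (ℕ.+-mono-≤ W≤ (s≤s S≤))
      ; bal = λ u u∉ → ℕ.≤-trans (count-mono (sc? (v ∷ S) u) (sc? S u) (sc-mono there) W) (b u (u∉ ∘ there)) }

    newNode-W : ∀ W W≤ v → Node.W (newNode W W≤ v) ≡ W
    newNode-W W W≤ v with sep W W≤
    ... | _ = refl

    newNode-∋ : ∀ W W≤ v → v ∈ Node.X (newNode W W≤ v)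
    newNode-∋ W W≤ v with sep W W≤
    ... | _ = ∈-++⁺ʳ W (here refl)

    start : V → Partial
    start v = record
      { m = 0 ; par = λ _ → 0 ; par≤ = λ () ; bag = λ _ → 0 ; bag≤ = λ _ → z≤n
      ; node = λ _ → newNode [] z≤n v
      ; guard⊆ = λ () ; avoids = λ () ; convex = λ () ; closed = λ _ _ → refl }

    module Step (P : Partial) (v : V) (¬done : ¬ Partial.Done P v) where
      open Partial P
      open Node

      t : ℕ
      t = bag v

      T : Node
      T = node t

      -- The strong component of v outside the core of its node becomes a new leaf.
      D : V → Set
      D = SC (X T) v

      D? : Decidable D
      D? = sc? (X T) v

      -- Besides `S T`, only those elements of `W T` guard the leaf that share the component of `v`
      -- outside `S T`. Balance bounds them by `w`, so the guard has at most `(w + 1) + w` elements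
      -- and separability applies to it again.
      g : List V
      g = S T ++ filter (sc? (S T) v) (W T)

      v∉S : v ∉ S T
      v∉S = ¬done ∘ ∈-++⁺ʳ (W T)

      g≤ : length g ≤ suc (2 * w)
      g≤ = subst (_≤ suc (2 * w)) (sym (List.length-++ (S T)))
             (ℕ.≤-trans (ℕ.+-mono-≤ (S≤ T) (bal T v v∉S))
                        (s≤s (ℕ.≤-reflexive (cong (w +_) (sym (ℕ.+-identityʳ w))))))

      new : Node
      new = newNode g g≤ v

      par′ : ℕ → ℕ
      par′ = upd m t par

      node′ : ℕ → Node
      node′ = upd (suc m) new node

      bag′ : V → ℕ
      bag′ u = if does (D? u) then suc m else bag u

      bag′-in : ∀ {u} → D u → bag′ u ≡ suc m
      bag′-in {u} d with D? u
      ... | yes _ = refl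
      ... | no ¬d = contradiction d ¬d

      bag′-out : ∀ {u} → ¬ D u → bag′ u ≡ bag u
      bag′-out {u} ¬d with D? u
      ... | yes d = contradiction d ¬d
      ... | no _ = refl

      node′-old : ∀ {k} → k ≤ m → node′ k ≡ node k
      node′-old k≤m = upd-miss (ℕ.<⇒≢ (s≤s k≤m))

      node′-new : node′ (suc m) ≡ new
      node′-new = upd-hit (suc m)

      W-new : W (node′ (suc m)) ≡ g
      W-new = trans (cong W node′-new) (newNode-W g g≤ v)

      par′-old : ∀ {j} → j < m → par′ j ≡ par j
      par′-old j<m = upd-miss (ℕ.<⇒≢ j<m)

      par′-new : par′ m ≡ t
      par′-new = upd-hit m

      below-old⁻ : ∀ {s k} → k ≤ m → Below par′ s k → Below par s k
      below-old⁻ k≤m = go _ ℕ.≤-refl k≤m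
        where
        -- Transporting `b` hides that it is a subterm, so `N` serves as fuel: it bounds the node,
        -- and parents have smaller numbers.
        go : ∀ N {s k} → k ≤ N → k ≤ m → Below par′ s k → Below par s k
        go N k≤N k≤m here = here
        go (suc N) {s} (s≤s j≤N) k≤m (below {j} b) =
          below (go N (ℕ.≤-trans (par≤ k≤m) j≤N) (ℕ.≤-trans (par≤ k≤m) (ℕ.<⇒≤ k≤m)) (subst (Below par′ s) (par′-old k≤m) b))

      below-old⁺ : ∀ {s k} → k ≤ m → Below par s k → Below par′ s k
      below-old⁺ k≤m here = here
      below-old⁺ {s} k≤m (below {j} b) =
        below (subst (Below par′ s) (sym (par′-old k≤m)) (below-old⁺ (ℕ.≤-trans (par≤ k≤m) (ℕ.<⇒≤ k≤m)) b))

      below-≤ : ∀ {s k} → k ≤ m → Below par s k → s ≤ k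
      below-≤ k≤m here = ℕ.≤-refl
      below-≤ k≤m (below b) = ℕ.≤-trans (below-≤ (ℕ.≤-trans (par≤ k≤m) (ℕ.<⇒≤ k≤m)) b) (ℕ.≤-trans (par≤ k≤m) (ℕ.n≤1+n _))

      D-bag : ∀ {u} → D u → bag u ≡ t
      D-bag = closed ¬done

      below-bag⁻ : ∀ {s u} → s ≤ m → Below par′ s (bag′ u) → Below par s (bag u)
      below-bag⁻ {s} {u} s≤m b = by (D? u)
        where
        leaf : Below par′ s (suc m) → Below par s t
        leaf here      = contradiction s≤m ℕ.1+n≰n
        leaf (below b) = below-old⁻ (bag≤ v) (subst (Below par′ s) par′-new b)
        by : Dec (D u) → Below par s (bag u)
        by (yes d) = subst (Below par s) (sym (D-bag d)) (leaf (subst (Below par′ s) (bag′-in d) b))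
        by (no ¬d) = below-old⁻ (bag≤ u) (subst (Below par′ s) (bag′-out ¬d) b)

      below-bag⁺ : ∀ {s u} → Below par s (bag u) → Below par′ s (bag′ u)
      below-bag⁺ {s} {u} b = by (D? u)
        where
        by : Dec (D u) → Below par′ s (bag′ u)
        by (yes d) = subst (Below par′ s) (sym (bag′-in d))
          (below (subst (Below par′ s) (sym par′-new) (below-old⁺ (bag≤ v) (subst (Below par s) (D-bag d) b))))
        by (no ¬d) = subst (Below par′ s) (sym (bag′-out ¬d)) (below-old⁺ (bag≤ u) b)

      below-new⁻ : ∀ {u} → Below par′ (suc m) (bag′ u) → D u
      below-new⁻ {u} b = by (D? u)
        where
        by : Dec (D u) → D u
        by (yes d) = d
        by (no ¬d) = contradiction (ℕ.≤-trans (below-≤ (bag≤ u) (below-old⁻ (bag≤ u) (subst (Below par′ (suc m)) (bag′-out ¬d) b))) (bag≤ u)) ℕ.1+n≰n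

      below-new⁺ : ∀ {u} → D u → Below par′ (suc m) (bag′ u)
      below-new⁺ d = subst (Below par′ (suc m)) (sym (bag′-in d)) here

      D∉X : ∀ {u} → D u → u ∉ X T
      D∉X d = reach-target (proj₁ d)

      D∉g : ∀ {u} → D u → u ∉ g
      D∉g d u∈ with ∈-++⁻ (S T) u∈
      ... | inj₁ l = D∉X d (∈-++⁺ʳ (W T) l)
      ... | inj₂ r = D∉X d (∈-++⁺ˡ (proj₁ (∈-filter⁻ (sc? (S T) v) {xs = W T} r)))

      -- Outside `g` the walk avoids `S T`, and it closes up inside `D`; hence all its vertices lie
      -- in the component of `v` outside `S T`. An element of `W T` on it would then belong to `g`.
      -- So the walk avoids the whole core and stays in `D`.
      D-convex : ∀ {a b z} (r : Reach (_∉ g) a b) → D a → D b → z ∈ verts (proj₁ r) → D z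
      D-convex {a} {b} r da db m = sc-trans da (sc-on r-X (proj₂ ab) m)
        where
        ab : SC (X T) a b
        ab = sc-trans (sc-sym da) db
        X-S : ∀ {x y} → SC (X T) x y → SC (S T) x y
        X-S = sc-mono (∈-++⁺ʳ (W T))
        r-S : Reach (_∉ S T) a b
        r-S = reach-mono (_∘ ∈-++⁺ˡ) r
        r-X : Reach (_∉ X T) a b
        r-X = proj₁ r , λ m z∈X → [ (λ z∈W → proj₂ r m (∈-++⁺ʳ (S T) (∈-filter⁺ (sc? (S T) v) z∈W
                                        (sc-trans (X-S da) (sc-on r-S (proj₂ (X-S ab)) m)))))
                                  , (λ z∈S → proj₂ r m (∈-++⁺ˡ z∈S)) ]′ (∈-++⁻ (W T) z∈X)

      <-cases : ∀ {j} → j < suc m → j < m ⊎ j ≡ m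
      <-cases (s≤s j≤m) = ℕ.m≤n⇒m<n∨m≡n j≤m

      next : Partial
      next = record
        { m = suc m ; par = par′ ; par≤ = par≤′ ; bag = bag′ ; bag≤ = bag≤′ ; node = node′
        ; guard⊆ = guard⊆′ ; avoids = avoids′ ; convex = convex′ ; closed = closed′ }
        where
        par≤′ : ∀ {j} → j < suc m → par′ j ≤ j
        par≤′ j< with <-cases j<
        ... | inj₁ j<m  = subst (_≤ _) (sym (par′-old j<m)) (par≤ j<m)
        ... | inj₂ refl = subst (_≤ m) (sym par′-new) (bag≤ v)

        bag≤′ : ∀ u → bag′ u ≤ suc m
        bag≤′ u with D? u
        ... | yes _ = ℕ.≤-refl
        ... | no _ = ℕ.m≤n⇒m≤1+n (bag≤ u)

        guard⊆′ : ∀ {j} → j < suc m → W (node′ (suc j)) ⊆ X (node′ (par′ j))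
        guard⊆′ {j} j< m∈ with <-cases j<
        ... | inj₁ j<m rewrite par′-old j<m | node′-old j<m | node′-old (ℕ.≤-trans (par≤ j<m) (ℕ.<⇒≤ j<m)) = guard⊆ j<m m∈
        ... | inj₂ refl rewrite par′-new | node′-old (bag≤ v) =
              [ ∈-++⁺ʳ (W T) , (λ r → ∈-++⁺ˡ (proj₁ (∈-filter⁻ (sc? (S T) v) {xs = W T} r))) ]′
              (∈-++⁻ (S T) (subst (_ ∈_) W-new m∈))

        avoids′ : ∀ {j u} → j < suc m → Below par′ (suc j) (bag′ u) → u ∉ W (node′ (suc j))
        avoids′ {j} j< b u∈ with <-cases j<
        ... | inj₁ j<m  rewrite node′-old j<m = avoids j<m (below-bag⁻ j<m b) u∈
        ... | inj₂ refl = D∉g (below-new⁻ b) (subst (_ ∈_) W-new u∈)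

        convex′ : ∀ {j a b z} → j < suc m → (r : Reach (_∉ W (node′ (suc j))) a b) →
                  Below par′ (suc j) (bag′ a) → Below par′ (suc j) (bag′ b) →
                  z ∈ verts (proj₁ r) → Below par′ (suc j) (bag′ z)
        convex′ {j} j< r ba bb m∈ with <-cases j<
        ... | inj₁ j<m rewrite node′-old j<m =
              below-bag⁺ (convex j<m r (below-bag⁻ j<m ba) (below-bag⁻ j<m bb) m∈)
        ... | inj₂ refl = below-new⁺ (D-convex (reach-mono (λ z∉ → z∉ ∘ subst (_ ∈_) (sym W-new)) r)
                                               (below-new⁻ ba) (below-new⁻ bb) m∈)

        X-new : X (node′ (suc m)) ≡ X new
        X-new = cong X node′-new

        g⊆new : g ⊆ X new
        g⊆new z∈ = ∈-++⁺ˡ (subst (_ ∈_) (sym (newNode-W g g≤ v)) z∈)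

        closed′ : ∀ {a b} → a ∉ X (node′ (bag′ a)) → SC (X (node′ (bag′ a))) a b → bag′ b ≡ bag′ a
        closed′ {a} {b} a∉ ab = by (D? a)
          where
          by : Dec (D a) → bag′ b ≡ bag′ a
          -- The new core contains `g`, so the closed walk through `a` and `b` avoids `g` and
          -- `D-convex` applies to it.
          by (yes da) = trans (bag′-in db) (sym (bag′-in da))
            where
            ab-g : SC g a b
            ab-g = sc-mono (subst (λ k → g ⊆ X (node′ k)) (sym (bag′-in da)) (subst (g ⊆_) (sym X-new) g⊆new)) ab
            db : D b
            db = D-convex (reach-trans (proj₁ ab-g) (proj₂ ab-g)) da da
                   (∈-⁀⁺ˡ (proj₁ (proj₁ ab-g)) (proj₁ (proj₂ ab-g)) (target∈ (proj₁ (proj₁ ab-g))))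
          -- If `b` were in `D`, both old bags would be `t`, and the component shared by `a` and `b`
          -- would put `a` into `D`.
          by (no ¬da) = trans (bag′-out ¬db) (trans bag-eq (sym (bag′-out ¬da)))
            where
            same : X (node′ (bag′ a)) ≡ X (node (bag a))
            same = trans (cong (X ∘ node′) (bag′-out ¬da)) (cong X (node′-old (bag≤ a)))
            ab-old : SC (X (node (bag a))) a b
            ab-old = subst (λ Y → SC Y a b) same ab
            bag-eq : bag b ≡ bag a
            bag-eq = closed (subst (a ∉_) same a∉) ab-old
            ¬db : ¬ D b
            ¬db db = ¬da (sc-trans db (sc-sym (subst (λ k → SC (X (node k)) a b) (trans (sym bag-eq) (D-bag db)) ab-old)))

      done-new : Partial.Done next v
      done-new = subst (λ k → v ∈ X (node′ k)) (sym (bag′-in (sc-refl ¬done)))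
                   (subst (λ N → v ∈ X N) (sym node′-new) (newNode-∋ g g≤ v))

      done-old : ∀ {u} → Done u → Partial.Done next u
      done-old {u} d = subst (λ k → u ∈ X (node′ k)) (sym (bag′-out ¬Du))
                         (subst (λ N → u ∈ X N) (sym (node′-old (bag≤ u))) d)
        where
        ¬Du : ¬ D u
        ¬Du du = D∉X du (subst (λ k → u ∈ X (node k)) (D-bag du) d)

    run : V → (vs : List V) → Σ Partial λ P → ∀ {v} → v ∈ vs → Partial.Done P v
    run r [] = start r , λ ()
    run r (v ∷ vs) with run r vs
    ... | P , done with v ∈V? Node.X (Partial.node P (Partial.bag P v))
    ...   | yes d = P , λ { (here refl) → d ; (there m) → done m }
    ...   | no ¬d = Step.next P v ¬d , λ { (here refl) → Step.done-new P v ¬d ; (there m) → Step.done-old P v ¬d (done m) }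

  fromWalk : ∀ {u v} → Walk G u v → Route (Arc G) u v
  fromWalk []      = ⟨ _ ⟩
  fromWalk (a ∷ p) = a ◂ fromWalk p

  verts-fromWalk : ∀ {u v} (p : Walk G u v) → verts (fromWalk p) ≡ walkVerts p
  verts-fromWalk []      = refl
  verts-fromWalk (a ∷ p) = cong (_ ∷_) (verts-fromWalk p)

  module Finish (P : Partial) (done : ∀ v → Partial.Done P v) where
    open Partial P
    open Node

    parF : Fin m → Fin (suc m)
    parF i = fromℕ< (s≤s (ℕ.≤-trans (par≤ (Fin.toℕ<n i)) (ℕ.<⇒≤ (Fin.toℕ<n i))))

    toℕ-parF : ∀ i → toℕ (parF i) ≡ par (toℕ i)
    toℕ-parF i = Fin.toℕ-fromℕ< _

    bagF : V → Fin (suc m)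
    bagF v = fromℕ< (s≤s (bag≤ v))

    toℕ-bagF : ∀ v → toℕ (bagF v) ≡ bag v
    toℕ-bagF v = Fin.toℕ-fromℕ< _

    desc⁻ : ∀ {s k} → Desc parF s k → Below par (toℕ s) (toℕ k)
    desc⁻ here = here
    desc⁻ {s} (below {i} d) = below (subst (Below par (toℕ s)) (toℕ-parF i) (desc⁻ d))

    desc⁺ : ∀ {s k} (s′ k′ : Fin (suc m)) → toℕ s′ ≡ s → toℕ k′ ≡ k → Below par s k → Desc parF s′ k′
    desc⁺ s′ k′ es ek here with refl ← Fin.toℕ-injective (trans es (sym ek)) = here
    desc⁺ s′ (suc i) es refl (below b) = below (desc⁺ s′ (parF i) es (toℕ-parF i) b)

    guardF : Fin m → Subset n
    guardF i = fromList (W (node (suc (toℕ i))))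

    desc-bag⁻ : ∀ i {v} → Desc parF (suc i) (bagF v) → Below par (suc (toℕ i)) (bag v)
    desc-bag⁻ i {v} d = subst (Below par (suc (toℕ i))) (toℕ-bagF v) (desc⁻ d)

    desc-bag⁺ : ∀ i {v} → Below par (suc (toℕ i)) (bag v) → Desc parF (suc i) (bagF v)
    desc-bag⁺ i {v} = desc⁺ (suc i) (bagF v) refl (toℕ-bagF v)

    decomposition : ArborealDecomposition G
    decomposition = record
      { m = m ; par = parF
      ; par< = λ i → subst (_≤ toℕ i) (sym (toℕ-parF i)) (par≤ (Fin.toℕ<n i))
      ; bag = bagF ; guard = guardF
      ; normal = λ i →
          (λ v d v∈ → avoids (Fin.toℕ<n i) (desc-bag⁻ i d) (∈-fromList⁻ _ v∈))
        , (λ u v p out du dv → All.tabulate λ {z} z∈ → desc-bag⁺ i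
             (convex (Fin.toℕ<n i)
                     (fromWalk p , λ m∈ z∈W → All.lookup out (subst (_ ∈_) (verts-fromWalk p) m∈) (∈-fromList⁺ z∈W))
                     (desc-bag⁻ i du) (desc-bag⁻ i dv) (subst (z ∈_) (sym (verts-fromWalk p)) z∈))) }

    open ArborealDecomposition decomposition using (β; Γ; incident; width)

    -- Three sources: the bag is in the core because all vertices are done, the entering guard is
    -- `W`, and the leaving guards are covered by `guard⊆`.
    Γ⊆ : ∀ t {v} → v Sub.∈ Γ t → v ∈ X (node (toℕ t))
    Γ⊆ t {v} v∈ with Sub.x∈p∪q⁻ (β t) _ v∈
    ... | inj₁ l with refl ← ⌊⌋⁻ (bagF v Fin.≟ t) (∈-Vec-tabulate⁻ l) =
          subst (λ k → v ∈ X (node k)) (sym (toℕ-bagF v)) (done v)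
    ... | inj₂ r with ∈-⋃⁻ (map guardF (incident t)) r
    ...   | p , p∈ , v∈p with ∈-map⁻ guardF p∈
    ...     | i , i∈ , refl with proj₂ (∈-filter⁻ (λ i → (suc i Fin.≟ t) ⊎-dec (parF i Fin.≟ t)) {xs = allFin m} i∈)
    ...       | inj₁ refl = ∈-++⁺ˡ (∈-fromList⁻ (W (node (suc (toℕ i)))) v∈p)
    ...       | inj₂ refl = subst (λ k → v ∈ X (node k)) (sym (toℕ-parF i)) (guard⊆ (Fin.toℕ<n i) (∈-fromList⁻ _ v∈p))

    ∣Γ∣≤ : ∀ t → ∣ Γ t ∣ ≤ suc (2 * w) + suc w
    ∣Γ∣≤ t = ℕ.≤-trans (Sub.p⊆q⇒∣p∣≤∣q∣ (∈-fromList⁺ ∘ Γ⊆ t))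
               (ℕ.≤-trans (∣fromList∣≤ (X (node (toℕ t)))) (size (node (toℕ t))))

    width≤ : width ≤ suc (2 * w) + suc w
    width≤ = ℕ.≤-trans (ℕ.m∸n≤m _ 1) (bounded (allFin (suc m)))
      where
      bounded : ∀ ts → foldr _⊔_ 0 (map (λ t → ∣ Γ t ∣) ts) ≤ suc (2 * w) + suc w
      bounded []       = z≤n
      bounded (t ∷ ts) = ℕ.⊔-lub (∣Γ∣≤ t) (bounded ts)

haven : ∀ {n} (G : Digraph n) w {c} → suc (2 * w) + suc w < c → DTWAtLeast G c → Reachability.Haven G w
-- `run` needs a root vertex, so the empty digraph is treated separately.
haven {zero} G w lt dtw = contradiction (ℕ.≤-trans (dtw trivial) z≤n) (ℕ.<⇒≱ lt)
  where
  trivial : ArborealDecomposition G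
  trivial = record { m = 0 ; par = λ () ; par< = λ () ; bag = λ () ; guard = λ () ; normal = λ () }
haven {suc n} G w lt dtw with Reachability.separable-or-haven G w
... | inj₂ h = h
... | inj₁ sep = contradiction (ℕ.≤-trans (dtw (Finish.decomposition (proj₁ all-done) done)) (Finish.width≤ (proj₁ all-done) done)) (ℕ.<⇒≱ lt)
  where
  open Decompose G w
  all-done : Σ Partial λ P → ∀ {v} → v ∈ allFin (suc n) → Partial.Done P v
  all-done = run sep zero (allFin (suc n))
  done : ∀ v → Partial.Done (proj₁ all-done) v
  done v = proj₂ all-done (∈-allFin v)

-- A path meeting all large components

castRoute : ∀ {A : Set} {R : A → A → Set} {u u′ v v′} → u ≡ u′ → v ≡ v′ → Route R u v → Route R u′ v′
castRoute refl refl p = p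

∈-castRoute⁻ : ∀ {A : Set} {R : A → A → Set} {u u′ v v′ z} (e : u ≡ u′) (e′ : v ≡ v′) (p : Route R u v) →
               z ∈ verts (castRoute e e′ p) → z ∈ verts p
∈-castRoute⁻ refl refl p m = m

-- A linkage that uses every source and every target, indexed by its sources. Recording the map `to`
-- matters because composing two matchings gives the permutation that a thread follows.
record Matching {A : Set} (R : A → A → Set) {k} (X Y : Fin k → A) : Set where
  field
    to           : Fin k → Fin k
    to-injective : ∀ {i j} → to i ≡ to j → i ≡ j
    route        : ∀ i → Route R (X i) (Y (to i))
    disjoint     : ∀ {i j v} → v ∈ verts (route i) → v ∈ verts (route j) → i ≡ j

module _ {n k : ℕ} {R : Fin n → Fin n → Set} {X Y : Fin k → Fin n}
         (L : Menger.Linkage R (tabulate X) (tabulate Y) k) where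
  private
    open Menger.Linkage L

    α β : Fin k → Fin k
    α i = proj₁ (∈-tabulate⁻ (src∈ i))
    β i = proj₁ (∈-tabulate⁻ (tgt∈ i))

    src≡ : ∀ i → src i ≡ X (α i)
    src≡ i = proj₂ (∈-tabulate⁻ (src∈ i))

    tgt≡ : ∀ i → tgt i ≡ Y (β i)
    tgt≡ i = proj₂ (∈-tabulate⁻ (tgt∈ i))

    α-injective : ∀ {i j} → α i ≡ α j → i ≡ j
    α-injective {i} {j} e = disjoint (source∈ (route i))
      (subst (_∈ verts (route j)) (trans (src≡ j) (trans (cong X (sym e)) (sym (src≡ i)))) (source∈ (route j)))

    β-injective : ∀ {i j} → β i ≡ β j → i ≡ j
    β-injective {i} {j} e = disjoint (target∈ (route i))
      (subst (_∈ verts (route j)) (trans (tgt≡ j) (trans (cong Y (sym e)) (sym (tgt≡ i)))) (target∈ (route j)))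

    pick : ∀ a → ∃ λ i → α i ≡ a
    pick = injective⇒surjective α α-injective

  toMatching : Matching R X Y
  toMatching = record
    { to = λ a → β (proj₁ (pick a))
    ; to-injective = λ e → pick-injective (β-injective e)
    ; route = λ a → castRoute (start a) (tgt≡ _) (route (proj₁ (pick a)))
    ; disjoint = λ {a} {b} p q → pick-injective (disjoint (∈-castRoute⁻ (start a) (tgt≡ _) (route (proj₁ (pick a))) p)
                                                        (∈-castRoute⁻ (start b) (tgt≡ _) (route (proj₁ (pick b))) q)) }
    where
    start : ∀ a → src (proj₁ (pick a)) ≡ X a
    start a = trans (src≡ _) (cong X (proj₂ (pick a)))
    pick-injective : ∀ {a b} → proj₁ (pick a) ≡ proj₁ (pick b) → a ≡ b
    pick-injective e = trans (sym (proj₂ (pick _))) (trans (cong α e) (proj₂ (pick _)))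

nth : ∀ {A : Set} → A → List A → ℕ → A
nth d []       l       = d
nth d (x ∷ xs) zero    = x
nth d (x ∷ xs) (suc l) = nth d xs l

nth-∈ : ∀ {A : Set} {d : A} xs {l} → l < length xs → nth d xs l ∈ xs
nth-∈ (x ∷ xs) {zero}  _       = here refl
nth-∈ (x ∷ xs) {suc l} (s≤s p) = there (nth-∈ xs p)

nth-linked : ∀ {A : Set} {R : A → A → Set} {d : A} {xs} → Linked R xs → ∀ {l} → suc l < length xs →
             R (nth d xs l) (nth d xs (suc l))
nth-linked [-]            (s≤s ())
nth-linked (r ∷ rs) {zero}  _ = r
nth-linked (r ∷ rs) {suc l} (s≤s p) = nth-linked rs p

nth-injective : ∀ {A : Set} {d : A} {xs} → Unique xs → ∀ {l l′} → l < length xs → l′ < length xs →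
                nth d xs l ≡ nth d xs l′ → l ≡ l′
nth-injective (_ ∷ u) {zero}  {zero}   p q e = refl
nth-injective {xs = x ∷ xs} (a ∷ u) {zero}  {suc l′} p (s≤s q) e = contradiction e (All.lookup a (nth-∈ xs q))
nth-injective {xs = x ∷ xs} (a ∷ u) {suc l} {zero}   (s≤s p) q e = contradiction (sym e) (All.lookup a (nth-∈ xs p))
nth-injective (_ ∷ u) {suc l} {suc l′} (s≤s p) (s≤s q) e = cong suc (nth-injective u p q e)

∈-nth : ∀ {A : Set} {d z : A} {xs} → z ∈ xs → ∃ λ l → l < length xs × nth d xs l ≡ z
∈-nth (here refl) = 0 , s≤s z≤n , refl
∈-nth (there m) with ∈-nth m
... | l , p , e = suc l , s≤s p , e

lists : ∀ n → ℕ → List (List (Fin n))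
lists n zero    = [] ∷ []
lists n (suc k) = [] ∷ map (λ (x , xs) → x ∷ xs) (cartesianProduct (allFin n) (lists n k))

∈-lists : ∀ {n} k (xs : List (Fin n)) → length xs ≤ k → xs ∈ lists n k
∈-lists zero    []       _       = here refl
∈-lists (suc k) []       _       = here refl
∈-lists (suc k) (x ∷ xs) (s≤s l) = there (∈-map⁺ _ (∈-cartesianProduct⁺ (∈-allFin x) (∈-lists k xs l)))

lists-length : ∀ n k {xs} → xs ∈ lists n k → length xs ≤ k
lists-length n zero    (here refl) = z≤n
lists-length n (suc k) (here refl) = z≤n
lists-length n (suc k) (there m) with ∈-map⁻ _ m
... | (x , xs) , m′ , refl = s≤s (lists-length n k (proj₂ (∈-cartesianProduct⁻ (allFin n) (lists n k) m′)))

module HittingPath {n : ℕ} (G : Digraph n) {w : ℕ} (h : Reachability.Haven G w) where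

  open Reachability G
  open Haven h

  IsPath : List V → Set
  IsPath xs = Linked (Arc G) xs × Unique xs

  tail-path : ∀ {x xs} → IsPath (x ∷ xs) → IsPath xs
  tail-path ([-]   , _ ∷ u) = [] , u
  tail-path (_ ∷ l , _ ∷ u) = l , u

  record Onto (x : V) (zs R : List V) : Set where
    field
      new  : List V
      T    : List V
      new≡ : new ++ R ≡ x ∷ T
      path : IsPath (x ∷ T)
      new⊆ : new ⊆ zs

  drop-to : ∀ {x} zs {R} → x ∈ zs → IsPath (zs ++ R) → Onto x zs R
  drop-to (z ∷ zs) (here refl) p = record { new = z ∷ zs ; T = _ ; new≡ = refl ; path = p ; new⊆ = id }
  drop-to (z ∷ zs) (there m)   p with drop-to zs m (tail-path p)
  ... | record { new = new ; T = T ; new≡ = e ; path = q ; new⊆ = s } =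
    record { new = new ; T = T ; new≡ = e ; path = q ; new⊆ = there ∘ s }

  -- Loop erasure from the target end: a vertex that occurs already among the new ones discards
  -- everything before that occurrence, so the old path `u ∷ P` survives intact.
  prepend : ∀ {x u P} (p : Route (Arc G) x u) → IsPath (u ∷ P) → (∀ {z} → z ∈ verts p → z ∉ P) →
            Onto x (verts p) (u ∷ P)
  prepend ⟨ u ⟩ path _ = record { new = [] ; T = _ ; new≡ = refl ; path = path ; new⊆ = λ () }
  prepend {x} {u} {P} (e ◂ p) path apart with prepend p path (apart ∘ there)
  ... | record { new = new ; T = T ; new≡ = eq ; path = path′ ; new⊆ = s } with x ∈V? new | x Fin.≟ u
  ...   | yes x∈ | _ = record { Onto o ; new⊆ = there ∘ s ∘ Onto.new⊆ o }
    where
    o : Onto x new (u ∷ P)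
    o = drop-to new x∈ (subst IsPath (sym eq) path′)
  ...   | no _ | yes refl = record { new = [] ; T = P ; new≡ = refl ; path = path ; new⊆ = λ () }
  ...   | no x∉ | no x≢u = record
    { new = x ∷ new ; T = _ ∷ T ; new≡ = cong (x ∷_) eq
    ; path = e ∷ proj₁ path′ , All.¬Any⇒All¬ _ (λ m → fresh (subst (x ∈_) (sym eq) m)) ∷ proj₂ path′
    ; new⊆ = λ { (here refl) → here refl ; (there m) → there (s m) } }
    where
    fresh : x ∉ new ++ u ∷ P
    fresh m with ∈-++⁻ new m
    ... | inj₁ l = x∉ l
    ... | inj₂ (here x≡u) = x≢u x≡u
    ... | inj₂ (there r) = apart (here refl) r

  -- The first vertex of the path is its only vertex in the component Big S₀,
  -- so a route inside that component extends the path to any other component.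
  record Hitting : Set where
    field
      S₀   : List V
      u    : V
      P    : List V
      path : IsPath (u ∷ P)
      bu   : Big S₀ u
      only : ∀ {z} → z ∈ P → ¬ Big S₀ z

    all : List V
    all = u ∷ P

  hit : (H : Hitting) → ∀ S → length S ≤ w →
        Σ Hitting λ H′ → Hitting.all H ⊆ Hitting.all H′ × Any (Big S) (Hitting.all H′)
  hit H S S≤ with any? (big? S) (Hitting.all H)
  ... | yes hits = H , id , hits
  ... | no miss = H′ , kept , here qs
    where
    open Hitting H
    x : V
    x = proj₁ (common bu (proj₂ (exist S S≤)))
    r : Reach (Big S₀) x u
    r = conn (proj₁ (proj₂ (common bu (proj₂ (exist S S≤))))) bu
    open Hits {R = Arc G} (Big S) (big? S)
    -- Starting at the last visit to `Big S` makes `s` the only vertex of the route in `Big S`; the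
    -- old path has none, so the invariant holds with `S` in place of `S₀`.
    trimmed : ∃ λ s → Big S s × Σ (Route (Arc G) s u) λ b → LastHit b × verts b ⊆ verts (proj₁ r)
    trimmed = fromLastHit (proj₁ r) (lose (source∈ (proj₁ r)) (proj₂ (proj₂ (common bu (proj₂ (exist S S≤))))))
    s : V
    s = proj₁ trimmed
    qs : Big S s
    qs = proj₁ (proj₂ trimmed)
    b : Route (Arc G) s u
    b = proj₁ (proj₂ (proj₂ trimmed))
    lh : LastHit b
    lh = proj₁ (proj₂ (proj₂ (proj₂ trimmed)))
    b⊆ : verts b ⊆ verts (proj₁ r)
    b⊆ = proj₂ (proj₂ (proj₂ (proj₂ trimmed)))
    o : Onto s (verts b) (u ∷ P)
    o = prepend b path (λ m z∈P → only z∈P (proj₂ r (b⊆ m)))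
    kept : u ∷ P ⊆ s ∷ Onto.T o
    kept m = subst (_ ∈_) (Onto.new≡ o) (∈-++⁺ʳ (Onto.new o) m)
    H′ : Hitting
    H′ = record
      { S₀ = S ; u = s ; P = Onto.T o ; path = Onto.path o ; bu = qs ; only = only′ }
      where
      only′ : ∀ {z} → z ∈ Onto.T o → ¬ Big S z
      only′ {z} z∈T bz with ∈-++⁻ (Onto.new o) (subst (z ∈_) (sym (Onto.new≡ o)) (there z∈T))
      ... | inj₂ old = miss (lose old bz)
      ... | inj₁ fresh with proj₂ (Onto.path o)
      ...   | s∉ ∷ _ = All.lookup s∉ z∈T (sym (lastHit-start lh (Onto.new⊆ o fresh) bz))

  hitAll : ∀ Ss → (∀ {S} → S ∈ Ss → length S ≤ w) →
           Σ Hitting λ H → ∀ {S} → S ∈ Ss → Any (Big S) (Hitting.all H)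
  hitAll [] _ = record { S₀ = [] ; u = proj₁ (exist [] z≤n) ; P = [] ; path = [-] , [] ∷ []
                       ; bu = proj₂ (exist [] z≤n) ; only = λ () } , λ ()
  hitAll (S ∷ Ss) small with hitAll Ss (small ∘ there)
  ... | H , hits with hit H S (small (here refl))
  ...   | H′ , kept , new = H′ , λ { (here refl) → new
          ; (there m) → let _ , z∈ , bz = find (hits m) in lose (kept z∈) bz }

  record BigPath : Set where
    field
      N    : ℕ
      pt   : ℕ → V
      step : ∀ {l} → suc l < N → Arc G (pt l) (pt (suc l))
      pt-injective : ∀ {l l′} → l < N → l′ < N → pt l ≡ pt l′ → l ≡ l′
      meets : ∀ S → length S ≤ w → ∃ λ l → l < N × Big S (pt l)

  abstract
    bigPath : BigPath
    bigPath = record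
      { N = length all ; pt = nth u all
      ; step = nth-linked (proj₁ path) ; pt-injective = nth-injective (proj₂ path)
      ; meets = λ S S≤ → let _ , z∈ , bz = find (proj₂ H (∈-lists w S S≤)) ; l , l< , e = ∈-nth z∈ in
                  l , l< , subst (Big S) (sym e) bz }
      where
      H : Σ Hitting λ H → ∀ {S} → S ∈ lists n w → Any (Big S) (Hitting.all H)
      H = hitAll (lists n w) (lists-length n w)
      open Hitting (proj₁ H)

-- Path systems

-- All that the two cases need to know about the cut path. `Int p i j` stands for the half-open
-- stretch from `exit p i` to just before `exit p j`; applied to one stretch with `j` at most `i`,
-- `Int-disjoint` says that it is empty.
record PathSystem {n} (R : Fin n → Fin n → Set) (a B : ℕ) : Set₁ where
  field
    entry exit   : Fin a → Fin B → Fin n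
    centre       : Fin a → Fin n
    In           : Fin a → Fin n → Set
    In-unique    : ∀ {p p′ v} → In p v → In p′ v → p ≡ p′
    enter        : ∀ p i → Σ (Route R (entry p i) (centre p)) λ r → ∀ {z} → z ∈ verts r → In p z
    leave        : ∀ p i → Σ (Route R (centre p) (exit p i)) λ r → ∀ {z} → z ∈ verts r → In p z
    out          : ∀ p p′ → Matching R (exit p) (entry p′)
    back         : ∀ p p′ → Matching R (entry p′) (exit p)
    Int          : Fin a → Fin B → Fin B → Fin n → Set
    Int-disjoint : ∀ {p i j i′ j′ v} → toℕ j ≤ toℕ i′ → Int p i j v → ¬ Int p i′ j′ v
    along        : ∀ p {i j} → toℕ i ≤ toℕ j → Σ (Route R (exit p i) (exit p j)) λ r →
                     ∀ {z} → z ∈ verts r → Int p i j z ⊎ z ≡ exit p j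

-- Cutting the path into blocks that carry linked terminals

module Cutting {n : ℕ} (G : Digraph n) {w : ℕ} (h : Reachability.Haven G w)
               (P : HittingPath.BigPath G h) where

  open Reachability G
  open Haven h
  open HittingPath.BigPath P

  HitIn : ℕ → ℕ → List V → Set
  HitIn s e S = ∃ λ l → l < e × s ≤ l × Big S (pt l)

  hitIn? : ∀ s e → Decidable (HitIn s e)
  hitIn? s e S = ℕ.anyUpTo? (λ l → (s ℕ.≤? l) ×-dec big? S (pt l)) e

  Hits : ℕ → ℕ → ℕ → Set
  Hits c s e = ∀ S → length S ≤ c → HitIn s e S

  record Cut (b c s : ℕ) : Set where
    field
      e    : ℕ
      s≤e  : s ≤ e
      e≤N  : e ≤ N
      now  : Hits b s e
      rest : Hits c e N

  -- Take the shortest segment that meets `Big S` for all `S` of size at most `b`. Without its last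
  -- vertex `pt e` it misses some `S₁`. For `S` of size at most `c`, the path meets `Big` of `S₁`,
  -- `pt e` and `S` together, but neither before `e`, because of `S₁`, nor at `e`; so it does after
  -- `e`. This costs `b + 1 + c`.
  cut : ∀ {b c s} → s ≤ N → Hits (b + suc c) s N → Cut b c s
  cut {b} {c} {s} s≤N all = go (N ∸ s) s (ℕ.m+[n∸m]≡n s≤N) ℕ.≤-refl [] z≤n
                                 (λ { (l , l<s , s≤l , _) → ℕ.<⇒≱ l<s s≤l })
    where
    go : ∀ k e → e + k ≡ N → s ≤ e → ∀ S₁ → length S₁ ≤ b → ¬ HitIn s e S₁ → Cut b c s
    go zero e e≡ s≤e S₁ S₁≤ miss = contradiction
      (subst (λ e → HitIn s e S₁) (trans (sym e≡) (ℕ.+-identityʳ e)) (all S₁ (ℕ.≤-trans S₁≤ (ℕ.m≤m+n b (suc c))))) miss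
    go (suc k) e e≡ s≤e S₁ S₁≤ miss with search (hitIn? s (suc e)) b
    ... | inj₂ (S₂ , S₂≤ , miss′) = go k (suc e) (trans (sym (ℕ.+-suc e k)) e≡) (ℕ.m≤n⇒m≤1+n s≤e) S₂ S₂≤ miss′
    ... | inj₁ hits = record
      { e = suc e ; s≤e = ℕ.m≤n⇒m≤1+n s≤e
      ; e≤N = subst (suc e ≤_) (trans (sym (ℕ.+-suc e k)) e≡) (ℕ.m≤m+n (suc e) k)
      ; now = hits ; rest = rest }
      where
      rest : Hits c (suc e) N
      rest S S≤ with all (S₁ ++ pt e ∷ S) (subst (_≤ b + suc c) (sym (List.length-++ S₁)) (ℕ.+-mono-≤ S₁≤ (s≤s S≤)))
      ... | l , l<N , s≤l , bl with ℕ.<-cmp l e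
      ...   | tri< l<e _ _ = contradiction (l , l<e , s≤l , mono ∈-++⁺ˡ bl) miss
      ...   | tri≈ _ refl _ = contradiction (∈-++⁺ʳ S₁ (here refl)) (avoid bl)
      ...   | tri> _ _ e<l = l , l<N , e<l , mono (∈-++⁺ʳ S₁ ∘ there) bl

  -- The terminal is `pt mid`. A route out of it uses the half after `mid` to reach the large
  -- component, and a route into it comes through the half before.
  record Block (b s e : ℕ) : Set where
    field
      mid   : ℕ
      s≤mid : s ≤ mid
      mid≤e : mid ≤ e
      e≤N   : e ≤ N
      pre   : Hits b s mid
      post  : Hits b mid e

  blocks : ∀ b T {s} → s ≤ N → Hits (T * (suc b + suc b)) s N →
           ∃ λ (g : ℕ → ℕ) → g 0 ≡ s × (∀ i → i < T → Block b (g i) (g (suc i)))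
  blocks b zero {s} _ _ = (λ _ → s) , refl , λ _ ()
  blocks b (suc T) {s} s≤N all = g′ , refl , λ { zero _ → first ; (suc i) (s≤s i<T) → proj₂ (proj₂ more) i i<T }
    where
    c : ℕ
    c = T * (suc b + suc b)
    cost : suc b + suc b + c ≡ b + suc (b + suc c)
    cost = trans (ℕ.+-assoc (suc b) (suc b) c)
             (trans (sym (ℕ.+-suc b (suc b + c))) (cong (λ z → b + suc z) (sym (ℕ.+-suc b c))))
    cut₁ : Cut b (b + suc c) s
    cut₁ = cut s≤N (subst (λ z → Hits z s N) cost all)
    cut₂ : Cut b c (Cut.e cut₁)
    cut₂ = cut (Cut.e≤N cut₁) (Cut.rest cut₁)
    more : ∃ λ (g : ℕ → ℕ) → g 0 ≡ Cut.e cut₂ × (∀ i → i < T → Block b (g i) (g (suc i)))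
    more = blocks b T (Cut.e≤N cut₂) (Cut.rest cut₂)
    g′ : ℕ → ℕ
    g′ zero    = s
    g′ (suc i) = proj₁ more i
    first : Block b s (proj₁ more 0)
    first = subst (Block b s) (sym (proj₁ (proj₂ more))) (record
      { mid = Cut.e cut₁ ; s≤mid = Cut.s≤e cut₁ ; mid≤e = Cut.s≤e cut₂ ; e≤N = Cut.e≤N cut₂
      ; pre = Cut.now cut₁ ; post = Cut.now cut₂ })

  Between : ℕ → ℕ → V → Set
  Between i j v = ∃ λ l → i ≤ l × l ≤ j × v ≡ pt l

  walk : ∀ {i j} → i ≤ j → j < N → Reach (Between i j) (pt i) (pt j)
  walk {i} {j} i≤j j<N = subst (λ e → Reach (Between i j) (pt i) (pt e)) (ℕ.m+[n∸m]≡n i≤j)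
                           (go (j ∸ i) ℕ.≤-refl (ℕ.≤-reflexive (ℕ.m+[n∸m]≡n i≤j)))
    where
    go : ∀ k {s} → i ≤ s → s + k ≤ j → Reach (Between i j) (pt s) (pt (s + k))
    go zero {s} i≤s s+k≤j = subst (λ e → Reach (Between i j) (pt s) (pt e)) (sym (ℕ.+-identityʳ s))
                            (stay (s , i≤s , subst (_≤ j) (ℕ.+-identityʳ s) s+k≤j , refl))
    go (suc k) {s} i≤s s+k≤j with go k {suc s} (ℕ.m≤n⇒m≤1+n i≤s) (subst (_≤ j) (ℕ.+-suc s k) s+k≤j)
    ... | p , p-in = subst (λ e → Reach (Between i j) (pt s) (pt e)) (sym (ℕ.+-suc s k))
        (step (ℕ.≤-trans (s≤s (ℕ.≤-trans (subst (suc s ≤_) (sym (ℕ.+-suc s k)) (s≤s (ℕ.m≤m+n s k))) s+k≤j)) j<N) ◂ p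
        , λ { (here refl) → s , i≤s , ℕ.≤-trans (ℕ.m≤m+n s (suc k)) s+k≤j , refl ; (there m) → p-in m })

  module Terminals {b T : ℕ} (g : ℕ → ℕ) (block : ∀ i → i < T → Block b (g i) (g (suc i))) where

    g-mono : ∀ {i j} → i ≤ j → j ≤ T → g i ≤ g j
    g-mono {i} {zero} z≤n _ = ℕ.≤-refl
    g-mono {i} {suc j} i≤ j<T with ℕ.m≤n⇒m<n∨m≡n i≤
    ... | inj₂ refl = ℕ.≤-refl
    ... | inj₁ (s≤s i≤j) = ℕ.≤-trans (g-mono i≤j (ℕ.<⇒≤ j<T))
            (ℕ.≤-trans (Block.s≤mid (block j j<T)) (Block.mid≤e (block j j<T)))

    InBlock : ℕ → V → Set
    InBlock i v = ∃ λ l → l < g (suc i) × g i ≤ l × v ≡ pt l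

    inBlock? : ∀ i v → Dec (InBlock i v)
    inBlock? i v = ℕ.anyUpTo? (λ l → (g i ℕ.≤? l) ×-dec (v Fin.≟ pt l)) (g (suc i))

    e≤N : ∀ {i} → i < T → g (suc i) ≤ N
    e≤N i<T = Block.e≤N (block _ i<T)

    position-block : ∀ {i j l} → i < T → j < T → l < g (suc i) → g i ≤ l → l < g (suc j) → g j ≤ l → i ≡ j
    position-block {i} {j} i<T j<T l<i i≤l l<j j≤l with ℕ.<-cmp i j
    ... | tri≈ _ e _ = e
    ... | tri< i<j _ _ = contradiction (ℕ.≤-trans (g-mono i<j (ℕ.<⇒≤ j<T)) j≤l) (ℕ.<⇒≱ l<i)
    ... | tri> _ _ j<i = contradiction (ℕ.≤-trans (g-mono j<i (ℕ.<⇒≤ i<T)) i≤l) (ℕ.<⇒≱ l<j)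

    block-unique : ∀ {i j v} → i < T → j < T → InBlock i v → InBlock j v → i ≡ j
    block-unique {i} {j} i<T j<T (l , l<i , i≤l , v≡) (l′ , l′<j , j≤l′ , v≡′)
      with refl ← pt-injective (ℕ.≤-trans l<i (e≤N i<T)) (ℕ.≤-trans l′<j (e≤N j<T)) (trans (sym v≡) v≡′)
      = position-block i<T j<T l<i i≤l l′<j j≤l′

    clear-block : ∀ {k} (X : Fin k → ℕ) → (∀ i → X i < T) → (∀ {i j} → X i ≡ X j → i ≡ j) →
                  ∀ S → length S < k → ∃ λ i → ∀ {v} → v ∈ S → ¬ InBlock (X i) v
    clear-block {k} X X<T X-inj S S<k with Fin.any? (λ i → ¬? (any? (inBlock? (X i)) S))
    ... | yes (i , clear) = i , λ v∈ inb → clear (lose v∈ inb)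
    ... | no none = contradiction (Fin.injective⇒≤ {f = λ i → index (touched i)} inj) (ℕ.<⇒≱ S<k)
      where
      touched : ∀ i → Any (InBlock (X i)) S
      touched i = decidable-stable (any? (inBlock? (X i)) S) λ ¬t → none (i , ¬t)
      inj : ∀ {i j} → index (touched i) ≡ index (touched j) → i ≡ j
      inj {i} {j} e = X-inj (block-unique (X<T i) (X<T j) (lookup-index (touched i))
                              (subst (λ x → InBlock (X j) (lookup S x)) (sym e) (lookup-index (touched j))))

    mid : ∀ i → i < T → ℕ
    mid i i<T = Block.mid (block i i<T)

    mid<N : ∀ {i} (i<T : i < T) → mid i i<T < g (suc i)
    mid<N i<T with Block.post (block _ i<T) [] z≤n
    ... | l , l<e , mid≤l , _ = ℕ.≤-trans (s≤s mid≤l) l<e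

    -- A separator `S` with fewer than `k` vertices leaves some source block and some target block
    -- untouched. Since `S` has at most `b` vertices, following the source block from its terminal
    -- reaches `Big S`, and the target block has a vertex of `Big S` before its terminal. Joined
    -- inside `Big S`, these pieces avoid `S`, a contradiction.
    linkage : ∀ {k} → k ≤ suc b → (X Y : Fin k → ℕ) (X<T : ∀ i → X i < T) (Y<T : ∀ i → Y i < T) →
              (∀ {i j} → X i ≡ X j → i ≡ j) → (∀ {i j} → Y i ≡ Y j → i ≡ j) →
              Matching (Arc G) (λ i → pt (mid (X i) (X<T i))) (λ i → pt (mid (Y i) (Y<T i)))
    linkage {k} k≤ X Y X<T Y<T X-inj Y-inj with mengerG (tabulate tX) (tabulate tY) k
      where
      tX tY : Fin k → V
      tX i = pt (mid (X i) (X<T i))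
      tY i = pt (mid (Y i) (Y<T i))
    ... | inj₁ L = toMatching L
    ... | inj₂ (S , S<k , sep) with clear-block X X<T X-inj S S<k | clear-block Y Y<T Y-inj S S<k
    ... | i , clearX | j , clearY = contradiction (proj₂ (proj₂ crossing)) (proj₂ through (proj₁ (proj₂ crossing)))
      where
      module BX = Block (block (X i) (X<T i))
      module BY = Block (block (Y j) (Y<T j))
      S≤b : length S ≤ b
      S≤b = s≤s⁻¹ (ℕ.≤-trans S<k k≤)
      hx : HitIn BX.mid (g (suc (X i))) S
      hx = BX.post S S≤b
      hy : HitIn (g (Y j)) BY.mid S
      hy = BY.pre S S≤b
      x y : ℕ
      x = proj₁ hx
      y = proj₁ hy
      start : Reach (_∉ S) (pt BX.mid) (pt x)
      start = reach-mono (λ { (l , m≤l , l≤x , refl) l∈S → clearX l∈S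
                ( l , ℕ.≤-trans (s≤s l≤x) (proj₁ (proj₂ hx)) , ℕ.≤-trans BX.s≤mid m≤l , refl) })
                (walk (proj₁ (proj₂ (proj₂ hx))) (ℕ.≤-trans (proj₁ (proj₂ hx)) BX.e≤N))
      finish : Reach (_∉ S) (pt y) (pt BY.mid)
      finish = reach-mono (λ { (l , y≤l , l≤m , refl) l∈S → clearY l∈S
                ( l , ℕ.≤-trans (s≤s l≤m) (mid<N (Y<T j)) , ℕ.≤-trans (proj₁ (proj₂ (proj₂ hy))) y≤l , refl) })
                (walk (ℕ.<⇒≤ (proj₁ (proj₂ hy))) (ℕ.≤-trans (mid<N (Y<T j)) BY.e≤N))
      through : Reach (_∉ S) (pt BX.mid) (pt BY.mid)
      through = reach-trans start (reach-trans
                  (reach-mono avoid (conn (proj₂ (proj₂ (proj₂ hx))) (proj₂ (proj₂ (proj₂ hy))))) finish)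
      crossing : ∃ λ z → z ∈ verts (proj₁ through) × z ∈ S
      crossing = sep (∈-tabulate⁺ i) (∈-tabulate⁺ j) (proj₁ through)

    mid-mono : ∀ {i j} (i<T : i < T) (j<T : j < T) → i ≤ j → mid i i<T ≤ mid j j<T
    mid-mono {i} {j} i<T j<T i≤j with ℕ.m≤n⇒m<n∨m≡n i≤j
    ... | inj₂ refl = ℕ.≤-reflexive (cong (mid i) (ℕ.≤-irrelevant i<T j<T))
    ... | inj₁ i<j = ℕ.≤-trans (ℕ.<⇒≤ (mid<N i<T)) (ℕ.≤-trans (g-mono i<j (ℕ.<⇒≤ j<T)) (Block.s≤mid (block j j<T)))

  -- The terminals are grouped: path p carries b entries followed by b exits.
  module System {b a : ℕ} (g : ℕ → ℕ)
                (block : ∀ i → i < (a + a) * suc b → Block b (g i) (g (suc i))) where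

    B : ℕ
    B = suc b

    open Terminals {b} {(a + a) * B} g block

    slot : ℕ → Fin B → ℕ
    slot q i = q * B + toℕ i

    slot< : ∀ {q} i → slot q i < suc q * B
    slot< {q} i = subst (suc (q * B + toℕ i) ≤_) (ℕ.+-comm (q * B) B) (ℕ.+-monoʳ-< (q * B) (Fin.toℕ<n i))

    slot-injective : ∀ q {i j} → slot q i ≡ slot q j → i ≡ j
    slot-injective q e = Fin.toℕ-injective (ℕ.+-cancelˡ-≡ (q * B) _ _ e)

    entry-group exit-group : Fin a → ℕ
    entry-group p = toℕ p + toℕ p
    exit-group  p = suc (toℕ p + toℕ p)

    next≤ : ∀ {p q : ℕ} → p < q → suc (suc (p + p)) ≤ q + q
    next≤ {p} {q} p<q = subst (_≤ q + q) (cong suc (ℕ.+-suc p p)) (ℕ.+-mono-≤ p<q p<q)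

    slot<T : ∀ {q} i → suc q ≤ a + a → slot q i < (a + a) * B
    slot<T {q} i q< = ℕ.≤-trans (slot< {q} i) (ℕ.*-monoˡ-≤ B q<)

    exit<T : ∀ p i → slot (exit-group p) i < (a + a) * B
    exit<T p i = slot<T {exit-group p} i (next≤ (Fin.toℕ<n p))

    entry<T : ∀ p i → slot (entry-group p) i < (a + a) * B
    entry<T p i = slot<T {entry-group p} i (ℕ.<⇒≤ (next≤ (Fin.toℕ<n p)))

    mexit mentry : Fin a → Fin B → ℕ
    mexit  p i = mid (slot (exit-group p) i) (exit<T p i)
    mentry p i = mid (slot (entry-group p) i) (entry<T p i)

    lo hi : Fin a → ℕ
    lo p = g (entry-group p * B)
    hi p = g (suc (suc (toℕ p + toℕ p)) * B)

    pt<N : ∀ {i} (i<T : i < (a + a) * B) → mid i i<T < N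
    pt<N i<T = ℕ.≤-trans (mid<N i<T) (e≤N i<T)

    lo≤ : ∀ p i → lo p ≤ mentry p i
    lo≤ p i = ℕ.≤-trans (g-mono (ℕ.m≤m+n _ (toℕ i)) (ℕ.<⇒≤ (entry<T p i))) (Block.s≤mid (block _ (entry<T p i)))

    <hi : ∀ p i → mexit p i < hi p
    <hi p i = ℕ.≤-trans (mid<N (exit<T p i)) (g-mono (slot< {exit-group p} i) (ℕ.*-monoˡ-≤ B (next≤ (Fin.toℕ<n p))))

    entry≤exit : ∀ p i j → mentry p i ≤ mexit p j
    entry≤exit p i j = mid-mono (entry<T p i) (exit<T p j)
      (ℕ.≤-trans (ℕ.<⇒≤ (slot< {entry-group p} i)) (ℕ.m≤m+n _ (toℕ j)))

    Interior : Fin a → V → Set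
    Interior p v = ∃ λ l → lo p ≤ l × l < hi p × l < N × v ≡ pt l

    order : ∀ {p p′ l} → toℕ p < toℕ p′ → l < hi p → lo p′ ≤ l → ⊥
    order {p} {p′} p<p′ l<hi lo≤l = ℕ.<⇒≱ l<hi (ℕ.≤-trans
      (g-mono (ℕ.*-monoˡ-≤ B (next≤ p<p′)) (ℕ.*-monoˡ-≤ B (ℕ.+-mono-≤ (ℕ.<⇒≤ (Fin.toℕ<n p′)) (ℕ.<⇒≤ (Fin.toℕ<n p′))))) lo≤l)

    interior-unique : ∀ {p p′ v} → Interior p v → Interior p′ v → p ≡ p′
    interior-unique {p} {p′} (l , lo≤l , l<hi , l<N , v≡) (l′ , lo≤l′ , l′<hi , l′<N , v≡′)
      with refl ← pt-injective l<N l′<N (trans (sym v≡) v≡′) with ℕ.<-cmp (toℕ p) (toℕ p′)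
    ... | tri≈ _ e _ = Fin.toℕ-injective e
    ... | tri< p<p′ _ _ = ⊥-elim (order {p} {p′} p<p′ l<hi lo≤l′)
    ... | tri> _ _ p′<p = ⊥-elim (order {p′} {p} p′<p l′<hi lo≤l)

    pathSystem : PathSystem (Arc G) a B
    pathSystem = record
      { entry = λ p i → pt (mentry p i) ; exit = λ p i → pt (mexit p i)
      -- The first exit comes after all entries and not after any exit, so the path leads from every
      -- entry to it and from it to every exit.
      ; centre = λ p → pt (mexit p zero)
      ; In = Interior ; In-unique = interior-unique
      ; enter = λ p i → reach-mono (λ (l , m≤l , l≤m , e) →
                    l , ℕ.≤-trans (lo≤ p i) m≤l , ℕ.≤-trans (s≤s l≤m) (<hi p zero) , ℕ.≤-trans (s≤s l≤m) (pt<N (exit<T p zero)) , e)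
                    (walk (entry≤exit p i zero) (pt<N (exit<T p zero)))
      ; leave = λ p i → reach-mono (λ (l , m≤l , l≤m , e) →
                    l , ℕ.≤-trans (ℕ.≤-trans (lo≤ p zero) (entry≤exit p zero zero)) m≤l
                      , ℕ.≤-trans (s≤s l≤m) (<hi p i) , ℕ.≤-trans (s≤s l≤m) (pt<N (exit<T p i)) , e)
                    (walk (mid-mono (exit<T p zero) (exit<T p i) (ℕ.+-monoʳ-≤ (exit-group p * B) z≤n)) (pt<N (exit<T p i)))
      ; out = λ p p′ → linkage ℕ.≤-refl (slot (exit-group p)) (slot (entry-group p′)) (exit<T p) (entry<T p′)
                         (slot-injective (exit-group p)) (slot-injective (entry-group p′))
      ; back = λ p p′ → linkage ℕ.≤-refl (slot (entry-group p′)) (slot (exit-group p)) (entry<T p′) (exit<T p)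
                         (slot-injective (entry-group p′)) (slot-injective (exit-group p))
      ; Int = λ p i j v → ∃ λ l → mexit p i ≤ l × l < mexit p j × v ≡ pt l
      ; Int-disjoint = λ {p} {i} {j} {i′} {j′} j≤i′ (l , i≤l , l<j , e) (l′ , i′≤l′ , l′<j′ , e′) →
          ℕ.<⇒≱ l<j (subst (mexit p j ≤_) (sym (pt-injective (ℕ.<-trans l<j (pt<N (exit<T p j))) (ℕ.<-trans l′<j′ (pt<N (exit<T p j′))) (trans (sym e) e′)))
            (ℕ.≤-trans (mid-mono (exit<T p j) (exit<T p i′) (ℕ.+-monoʳ-≤ (exit-group p * B) j≤i′)) i′≤l′))
      ; along = λ p {i} {j} i≤j → reach-mono (λ (l , i≤l , l≤j , e) → tail p i≤l (ℕ.m≤n⇒m<n∨m≡n l≤j) e)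
                    (walk (mid-mono (exit<T p i) (exit<T p j) (ℕ.+-monoʳ-≤ (exit-group p * B) i≤j)) (pt<N (exit<T p j)))
      }
      where
      tail : ∀ p {i j : Fin B} {l v} → mexit p i ≤ l → l < mexit p j ⊎ l ≡ mexit p j → v ≡ pt l →
             (∃ λ l → mexit p i ≤ l × l < mexit p j × v ≡ pt l) ⊎ v ≡ pt (mexit p j)
      tail p i≤l (inj₁ l<j) e = inj₁ (_ , i≤l , l<j , e)
      tail p i≤l (inj₂ refl) e = inj₂ e

  abstract
    -- There are `2a` groups of `suc b` blocks, and each block costs `2 (suc b)`.
    system : ∀ {b a} → (a + a) * suc b * (suc b + suc b) ≤ w → PathSystem (Arc G) a (suc b)
    system {b} {a} cost≤w = System.pathSystem {b} {a} (proj₁ bs) (proj₂ (proj₂ bs))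
      where
      bs : ∃ λ (g : ℕ → ℕ) → g 0 ≡ 0 × (∀ i → i < (a + a) * suc b → Block b (g i) (g (suc i)))
      bs = blocks b ((a + a) * suc b) z≤n λ S S≤ → let l , l<N , bl = meets S (ℕ.≤-trans S≤ cost≤w) in l , l<N , z≤n , bl

-- Brambles from layered families

module Families {n : ℕ} (G : Digraph n) where

  open Reachability G

  Strong : List V → Set
  Strong xs = ∀ {u v} → u ∈ xs → v ∈ xs → Reach (_∈ xs) u v

  closed-strong : ∀ {x} (p : Route (Arc G) x x) → Strong (verts p)
  closed-strong p u∈ v∈ = reach-trans (reach-after (p , id) u∈) (reach-before (p , id) v∈)

  union : ∀ {k} → List V → (Fin k → List V) → List V
  union base c = base ++ concat (tabulate c)

  ∈-union⁺ʳ : ∀ {k base} {c : Fin k → List V} j {z} → z ∈ c j → z ∈ union base c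
  ∈-union⁺ʳ {base = base} j z∈ = ∈-++⁺ʳ base (∈-concat⁺′ z∈ (∈-tabulate⁺ j))

  ∈-union⁻ : ∀ {k} base {c : Fin k → List V} {z} → z ∈ union base c → z ∈ base ⊎ ∃ λ j → z ∈ c j
  ∈-union⁻ base {c} z∈ with ∈-++⁻ base z∈
  ... | inj₁ l = inj₁ l
  ... | inj₂ r with ∈-concat⁻′ (tabulate c) r
  ...   | ys , z∈ys , ys∈ with ∈-tabulate⁻ ys∈
  ...     | j , refl = inj₂ (j , z∈ys)

  union-strong : ∀ {k base} {c : Fin k → List V} → Strong base → (∀ j → Strong (c j)) →
                 (∀ j → ∃ λ z → z ∈ base × z ∈ c j) → Strong (union base c)
  union-strong {base = base} {c} sb sc meet u∈ v∈ with hub u∈ | hub v∈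
    where
    hub : ∀ {z} → z ∈ union base c → ∃ λ x → x ∈ base × Reach (_∈ union base c) z x × Reach (_∈ union base c) x z
    hub z∈ with ∈-union⁻ base z∈
    ... | inj₁ l = _ , l , stay z∈ , stay z∈
    ... | inj₂ (j , r) with meet j
    ...   | x , x∈b , x∈c = x , x∈b , reach-mono (∈-union⁺ʳ {base = base} j) (sc j r x∈c)
                                    , reach-mono (∈-union⁺ʳ {base = base} j) (sc j x∈c r)
  ... | x , x∈ , ux , _ | y , y∈ , _ , yv = reach-trans ux (reach-trans (reach-mono ∈-++⁺ˡ (sb x∈ y∈)) yv)

  -- A family of congestion at most c: its members are covered by c layers,
  -- in each of which the members occupy disjoint sets.
  record Layered (κ c : ℕ) : Set₁ where
    field
      X      : Fin κ → List V
      strong : ∀ i → Strong (X i)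
      meet   : ∀ i j → ∃ λ z → z ∈ X i × z ∈ X j
      T      : Fin c → Fin κ → V → Set
      cover  : ∀ {i z} → z ∈ X i → ∃ λ l → T l i z
      unique : ∀ {l i j z} → T l i z → T l j z → i ≡ j

  module Induced (X : List V) where

    inner? : ∀ u v → Dec (u ∈ X × v ∈ X × Arc G u v)
    inner? u v = (u ∈V? X) ×-dec (v ∈V? X) ×-dec arc? u v

    A : Digraph n
    A = Vec.tabulate λ u → Vec.tabulate λ v → ⌊ inner? u v ⌋

    arc⁻ : ∀ {u v} → Arc A u v → u ∈ X × v ∈ X × Arc G u v
    arc⁻ {u} {v} a = ⌊⌋⁻ (inner? u v)
      (∈-Vec-tabulate⁻ (subst (v Sub.∈_) (Vec.lookup∘tabulate (λ u → Vec.tabulate λ v → ⌊ inner? u v ⌋) u) a))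

    arc⁺ : ∀ {u v} → u ∈ X → v ∈ X → Arc G u v → Arc A u v
    arc⁺ {u} {v} u∈ v∈ a = subst (v Sub.∈_) (sym (Vec.lookup∘tabulate (λ u → Vec.tabulate λ v → ⌊ inner? u v ⌋) u))
      (∈-Vec-tabulate⁺ (⌊⌋⁺ (inner? u v) (u∈ , v∈ , a)))

    subgraph : Subgraph n
    subgraph = fromList X , A

    isSubgraph : IsSubgraph G subgraph
    isSubgraph u v a with arc⁻ a
    ... | u∈ , v∈ , g = (∈-fromList⁺ u∈ , ∈-fromList⁺ v∈) , g

    toWalk : ∀ {u v} (p : Route (Arc G) u v) → (∀ {z} → z ∈ verts p → z ∈ X) → Walk A u v
    toWalk ⟨ _ ⟩   _    = []
    toWalk (a ◂ p) p-in = arc⁺ (p-in (here refl)) (p-in (there (source∈ p))) a ∷ toWalk p (p-in ∘ there)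

    stronglyConnected : Strong X → (∃ λ z → z ∈ X) → StronglyConnected subgraph
    stronglyConnected s (z , z∈) = (z , ∈-fromList⁺ z∈) , λ u v u∈ v∈ →
      let p , p-in = s (∈-fromList⁻ X u∈) (∈-fromList⁻ X v∈) in toWalk p p-in

  module Collect {κ c : ℕ} (F : Layered κ c) where
    open Layered F

    sub : Fin κ → Subgraph n
    sub i = Induced.subgraph (X i)

    _≟S_ : (B B′ : Subgraph n) → Dec (B ≡ B′)
    _≟S_ = Product.≡-dec (Vec.≡-dec Bool._≟_) (Vec.≡-dec (Vec.≡-dec Bool._≟_))

    elems : List (Subgraph n)
    elems = deduplicate _≟S_ (tabulate sub)

    elems⁻ : ∀ {B} → B ∈ elems → ∃ λ i → B ≡ sub i
    elems⁻ B∈ = ∈-tabulate⁻ (∈-deduplicate⁻ _≟S_ (tabulate sub) B∈)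

    elems⁺ : ∀ i → sub i ∈ elems
    elems⁺ i = ∈-deduplicate⁺ _≟S_ (∈-tabulate⁺ i)

    bramble : Bramble G
    bramble = record
      { elems = elems ; distinct = deduplicate-! _≟S_ (tabulate sub)
      ; subgr = All.tabulate λ B∈ → let i , e = elems⁻ B∈ in subst (IsSubgraph G) (sym e) (Induced.isSubgraph (X i))
      ; strong = All.tabulate λ B∈ → let i , e = elems⁻ B∈ in subst StronglyConnected (sym e)
                   (Induced.stronglyConnected (X i) (strong i) (let z , z∈ , _ = meet i i in z , z∈))
      ; touching = λ {B₁} {B₂} B₁∈ B₂∈ → let i , e = elems⁻ B₁∈ ; j , e′ = elems⁻ B₂∈ ; z , z∈ , z∈′ = meet i j in
          inj₁ (z , subst (λ B → z Sub.∈ sgVerts B) (sym e) (∈-fromList⁺ z∈)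
                  , subst (λ B → z Sub.∈ sgVerts B) (sym e′) (∈-fromList⁺ z∈′)) }

    layer : ∀ {B v} → B ∈ elems → v Sub.∈ sgVerts B → ∃ λ i → B ≡ sub i × ∃ λ l → T l i v
    layer {v = v} B∈ v∈ with elems⁻ B∈
    ... | i , refl = i , refl , cover (∈-fromList⁻ (X i) v∈)

    -- Elements containing `v` are told apart by their layers, for within one layer `v` belongs to a
    -- single index.
    congestion : Bramble.HasCongestionAtMost bramble c
    congestion v = Fin.injective⇒≤ {f = λ p → proj₁ (proj₂ (proj₂ (at p)))} inj
      where
      loaded : List (Subgraph n)
      loaded = filter (λ B → v Sub.∈? sgVerts B) elems
      at : ∀ p → ∃ λ i → lookup loaded p ≡ sub i × ∃ λ l → T l i v
      at p = let B∈ , v∈ = ∈-filter⁻ (λ B → v Sub.∈? sgVerts B) {xs = elems} (∈-lookup {xs = loaded} p) in layer B∈ v∈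
      inj : ∀ {p q} → proj₁ (proj₂ (proj₂ (at p))) ≡ proj₁ (proj₂ (proj₂ (at q))) → p ≡ q
      inj {p} {q} e = Unique-lookup-injective (Unique.filter⁺ (λ B → v Sub.∈? sgVerts B) (deduplicate-! _≟S_ (tabulate sub)))
        (trans (proj₁ (proj₂ (at p))) (trans (cong sub i≡j) (sym (proj₁ (proj₂ (at q))))))
        where
        i≡j : proj₁ (at p) ≡ proj₁ (at q)
        i≡j = unique (proj₂ (proj₂ (proj₂ (at p))))
                     (subst (λ l → T l (proj₁ (at q)) v) (sym e) (proj₂ (proj₂ (proj₂ (at q)))))

    -- Equal members share a vertex, so at most c members are equal.
    size≥ : κ ≤ Bramble.size bramble * c
    size≥ = Fin.injective⇒≤ {f = λ i → combine (place i) (level i)} inj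
      where
      place : Fin κ → Fin (length elems)
      place i = index (elems⁺ i)
      rep : ∀ p → ∃ λ v → v Sub.∈ sgVerts (lookup elems p)
      rep p = let i , e = elems⁻ (∈-lookup {xs = elems} p) ; z , z∈ , _ = meet i i in
                z , subst (λ B → z Sub.∈ sgVerts B) (sym e) (∈-fromList⁺ z∈)
      on : ∀ i → ∃ λ l → T l i (proj₁ (rep (place i)))
      on i = cover (∈-fromList⁻ (X i) (subst (λ B → proj₁ (rep (place i)) Sub.∈ sgVerts B)
                                             (sym (lookup-index (elems⁺ i))) (proj₂ (rep (place i)))))
      level : Fin κ → Fin c
      level i = proj₁ (on i)
      inj : ∀ {i j} → combine (place i) (level i) ≡ combine (place j) (level j) → i ≡ j
      inj {i} {j} e = unique (proj₂ (on i))
        (subst₂ (λ l p → T l j (proj₁ (rep p)))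
                (sym (Fin.combine-injectiveʳ (place i) (level i) (place j) (level j) e))
                (sym (Fin.combine-injectiveˡ (place i) (level i) (place j) (level j) e)) (proj₂ (on j)))

  -- Up to `c` indices may give the same subgraph, and `c` is at most 8; hence `8k` indices for `k`
  -- elements.
  layered-bramble : ∀ {κ c k} → Layered κ c → c ≤ 8 → k * 8 ≤ κ →
                    Σ (Bramble G) λ B → Bramble.HasCongestionAtMost B 8 × k ≤ Bramble.size B
  layered-bramble {k = k} F c≤8 k8≤κ = bramble , (λ v → ℕ.≤-trans (congestion v) c≤8)
    , ℕ.*-cancelʳ-≤ k _ 8 (ℕ.≤-trans k8≤κ (ℕ.≤-trans size≥ (ℕ.*-monoʳ-≤ (Bramble.size bramble) c≤8)))
    where open Collect F

-- Counting

sum-mono : ∀ {n} {f g : Fin n → ℕ} → (∀ i → f i ≤ g i) → sum f ≤ sum g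
sum-mono {zero}  f≤g = z≤n
sum-mono {suc n} f≤g = ℕ.+-mono-≤ (f≤g zero) (sum-mono (f≤g ∘ suc))

sum-<⇒∃ : ∀ {n} {f g : Fin n → ℕ} → sum f < sum g → ∃ λ i → f i < g i
sum-<⇒∃ {f = f} {g} lt with Fin.any? (λ i → f i ℕ.<? g i)
... | yes found = found
... | no none = contradiction (sum-mono λ i → ℕ.≮⇒≥ (λ fi<gi → none (i , fi<gi))) (ℕ.<⇒≱ lt)

sum-const : ∀ n c → sum {n} (λ _ → c) ≡ n * c
sum-const zero    c = refl
sum-const (suc n) c = cong (c +_) (sum-const n c)

sum-scale : ∀ {n} c (f : Fin n → ℕ) → sum (λ i → c * f i) ≡ c * sum f
sum-scale c f = sym (*-distribˡ-sum c f)

sum₂-const : ∀ m n c → sum {m} (λ _ → sum {n} λ _ → c) ≡ m * (n * c)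
sum₂-const m n c = trans (sum-cong-≗ {m} (λ _ → sum-const n c)) (sum-const m (n * c))

sum₂-distrib : ∀ {m n} (f g : Fin m → Fin n → ℕ) →
               sum (λ i → sum λ j → f i j + g i j) ≡ sum (λ i → sum (f i)) + sum (λ i → sum (g i))
sum₂-distrib f g = trans (sum-cong-≗ λ i → ∑-distrib-+ (f i) (g i)) (∑-distrib-+ (λ i → sum (f i)) (λ i → sum (g i)))

sum₂-scale : ∀ {m n} c (f : Fin m → Fin n → ℕ) → sum (λ i → sum λ j → c * f i j) ≡ c * sum (λ i → sum (f i))
sum₂-scale c f = trans (sum-cong-≗ λ i → sum-scale c (f i)) (sum-scale c (λ i → sum (f i)))

sum₂-mono : ∀ {m n} {f g : Fin m → Fin n → ℕ} → (∀ i j → f i j ≤ g i j) →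
            sum (λ i → sum (f i)) ≤ sum (λ i → sum (g i))
sum₂-mono f≤g = sum-mono λ i → sum-mono (f≤g i)

sum₂-<⇒∃ : ∀ {m n} {f g : Fin m → Fin n → ℕ} → sum (λ i → sum (f i)) < sum (λ i → sum (g i)) →
           ∃₂ λ i j → f i j < g i j
sum₂-<⇒∃ lt with sum-<⇒∃ lt
... | i , lt′ with sum-<⇒∃ lt′
...   | j , lt″ = i , j , lt″

sum-product : ∀ {m n} (f : Fin m → ℕ) (g : Fin n → ℕ) → sum (λ i → sum λ j → f i * g j) ≡ sum f * sum g
sum-product f g = trans (sum-cong-≗ λ i → sum-scale (f i) g) (sym (*-distribʳ-sum (sum g) f))

term≤sum : ∀ {n} (f : Fin n → ℕ) i → f i ≤ sum f
term≤sum f zero    = ℕ.m≤m+n _ _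
term≤sum f (suc i) = ℕ.≤-trans (term≤sum (f ∘ suc) i) (ℕ.m≤n+m _ _)

sum-injective : ∀ {a b} (h : Fin a → Fin b) → (∀ {i j} → h i ≡ h j → i ≡ j) →
                ∀ (f : Fin b → ℕ) → sum (f ∘ h) ≤ sum f
sum-injective {zero}          h inj f = z≤n
sum-injective {suc a} {zero}  h inj f with () ← h zero
sum-injective {suc a} {suc b} h inj f = subst (sum (f ∘ h) ≤_) (sym (sum-remove {i = h zero} f))
  (ℕ.+-monoʳ-≤ (f (h zero)) (ℕ.≤-trans
    (ℕ.≤-reflexive (sum-cong-≗ λ i → cong f (sym (Fin.punchIn-punchOut (apart i)))))
    (sum-injective (λ i → punchOut (apart i))
                   (λ e → Fin.suc-injective (inj (Fin.punchOut-injective (apart _) (apart _) e)))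
                   (f ∘ punchIn (h zero)))))
  where
  apart : ∀ i → h zero ≢ h (suc i)
  apart i e with () ← inj e

♯ : ∀ {P : Set} → Dec P → ℕ
♯ (yes _) = 1
♯ (no _)  = 0

♯-yes : ∀ {P : Set} (d : Dec P) → P → ♯ d ≡ 1
♯-yes (yes _) p = refl
♯-yes (no ¬p) p = contradiction p ¬p

♯-× : ∀ {P Q : Set} (p : Dec P) (q : Dec Q) → ♯ (p ×-dec q) ≡ ♯ p * ♯ q
♯-× (yes _) (yes _) = refl
♯-× (yes _) (no _)  = refl
♯-× (no _)  _       = refl

♯-≤ : ∀ {P : Set} (p : Dec P) {n} → (P → 1 ≤ n) → ♯ p ≤ n
♯-≤ (yes p) f = f p
♯-≤ (no _)  f = z≤n

sum-♯≤1 : ∀ {n} {P : Fin n → Set} (P? : Decidable P) → (∀ {i j} → P i → P j → i ≡ j) → sum (♯ ∘ P?) ≤ 1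
sum-♯≤1 {zero}  P? one = z≤n
sum-♯≤1 {suc n} P? one with P? zero
... | no _ = sum-♯≤1 (P? ∘ suc) (λ p q → Fin.suc-injective (one p q))
... | yes p = s≤s (ℕ.≤-trans (sum-mono λ i → ♯-≤ (P? (suc i)) λ q → contradiction (one p q) λ ())
                             (ℕ.≤-reflexive (trans (sum-const n 0) (ℕ.*-zeroʳ n))))

sum-♯≤length : ∀ {n} {P : Fin n → Set} (P? : Decidable P) ex → (∀ {i} → P i → i ∈ ex) → sum (♯ ∘ P?) ≤ length ex
sum-♯≤length {n} P? [] P⊆ = ℕ.≤-trans (sum-mono λ i → ♯-≤ (P? i) λ p → contradiction (P⊆ p) λ ())
                             (ℕ.≤-reflexive (trans (sum-const n 0) (ℕ.*-zeroʳ n)))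
sum-♯≤length {P = P} P? (y ∷ ex) P⊆ = ℕ.≤-trans (sum-mono bound)
    (ℕ.≤-trans (ℕ.≤-reflexive (∑-distrib-+ (λ i → ♯ (i Fin.≟ y)) (λ i → ♯ (P? i ×-dec ¬? (i Fin.≟ y)))))
      (ℕ.+-mono-≤ (sum-♯≤1 (Fin._≟ y) λ e e′ → trans e (sym e′))
                  (sum-♯≤length (λ i → P? i ×-dec ¬? (i Fin.≟ y)) ex λ { (p , i≢y) → rest (P⊆ p) i≢y })))
  where
  rest : ∀ {i} → i ∈ y ∷ ex → i ≢ y → i ∈ ex
  rest (here e)  i≢y = contradiction e i≢y
  rest (there m) _   = m
  bound : ∀ i → ♯ (P? i) ≤ ♯ (i Fin.≟ y) + ♯ (P? i ×-dec ¬? (i Fin.≟ y))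
  bound i = ♯-≤ (P? i) λ p → case i Fin.≟ y of λ
    { (yes e) → ℕ.≤-trans (ℕ.≤-reflexive (sym (♯-yes (i Fin.≟ y) e))) (ℕ.m≤m+n _ _)
    ; (no ≢) → ℕ.≤-trans (ℕ.≤-reflexive (sym (♯-yes (P? i ×-dec ¬? (i Fin.≟ y)) (p , ≢)))) (ℕ.m≤n+m _ _) }

-- Greedy choice: every value taken joins the exclusion list, and each option set is large enough to
-- the end.
distinct-choice : ∀ N {K} {O : Fin N → Fin K → Set} (O? : ∀ s x → Dec (O s x)) (ex : List (Fin K)) →
  (∀ s → N + length ex ≤ sum (♯ ∘ O? s)) →
  ∃ λ (g : Fin N → Fin K) → (∀ s → O s (g s)) × (∀ {s s′} → g s ≡ g s′ → s ≡ s′) × (∀ s → g s ∉ ex)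
distinct-choice zero O? ex enough = (λ ()) , (λ ()) , (λ {s} → case s of λ ()) , λ ()
distinct-choice (suc N) {K} {O} O? ex enough = g′ , g′-in , g′-inj , g′-out
  where
  fresh : ∃ λ x → O zero x × x ∉ ex
  fresh with Fin.any? (λ x → O? zero x ×-dec ¬? (any? (x Fin.≟_) ex))
  ... | yes found = found
  ... | no none = contradiction
        (sum-♯≤length (O? zero) ex λ {x} o → decidable-stable (any? (x Fin.≟_) ex) λ x∉ → none (x , o , x∉))
        (ℕ.<⇒≱ (ℕ.≤-trans (s≤s (ℕ.m≤n+m _ N)) (enough zero)))
  x₀ : Fin K
  x₀ = proj₁ fresh
  more : ∃ λ (g : Fin N → Fin K) → (∀ s → O (suc s) (g s)) × (∀ {s s′} → g s ≡ g s′ → s ≡ s′) × (∀ s → g s ∉ x₀ ∷ ex)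
  more = distinct-choice N (O? ∘ suc) (x₀ ∷ ex) λ s → subst (_≤ sum (♯ ∘ O? (suc s))) (sym (ℕ.+-suc N (length ex))) (enough (suc s))
  g : Fin N → Fin K
  g = proj₁ more
  g′ : Fin (suc N) → Fin K
  g′ zero    = x₀
  g′ (suc s) = g s
  g′-in : ∀ s → O s (g′ s)
  g′-in zero    = proj₁ (proj₂ fresh)
  g′-in (suc s) = proj₁ (proj₂ more) s
  g′-inj : ∀ {s s′} → g′ s ≡ g′ s′ → s ≡ s′
  g′-inj {zero}  {zero}   e = refl
  g′-inj {zero}  {suc s′} e = contradiction (here (sym e)) (proj₂ (proj₂ (proj₂ more)) s′)
  g′-inj {suc s} {zero}   e = contradiction (here e) (proj₂ (proj₂ (proj₂ more)) s)
  g′-inj {suc s} {suc s′} e = cong suc (proj₁ (proj₂ (proj₂ more)) e)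
  g′-out : ∀ s → g′ s ∉ ex
  g′-out zero    = proj₂ (proj₂ fresh)
  g′-out (suc s) = λ m → proj₂ (proj₂ (proj₂ more)) s (there m)

-- Independent transversals: a random choice is conflict-free in expectation,
-- and the choices are made one by one keeping the expectation below one.

conflicts : ∀ r {b} → (Fin r → Fin r → Fin b → Fin b → ℕ) → ℕ
conflicts zero    h = 0
conflicts (suc r) h = sum (λ d → sum λ x → sum λ y → h zero (suc d) x y) + conflicts r (λ c d → h (suc c) (suc d))

-- The left side of the hypothesis is `b * b` times the expected cost of a uniformly random `f`.
-- Once a value is fixed, the clashes with it become unary costs of the remaining indices, which is
-- why `u` is carried along.
transversal : ∀ r {b} (u : Fin r → Fin b → ℕ) (h : Fin r → Fin r → Fin b → Fin b → ℕ) →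
  b * sum (λ c → sum (u c)) + conflicts r h < b * b →
  ∃ λ (f : Fin r → Fin b) → (∀ c → u c (f c) ≡ 0) × (∀ {c d} → toℕ c < toℕ d → h c d (f c) (f d) ≡ 0)
transversal zero u h lt = (λ ()) , (λ ()) , λ {c} → case c of λ ()
transversal (suc r) {b} u h lt = f , f-zero , f-free
  where
  u′ : Fin b → Fin r → Fin b → ℕ
  u′ x d y = u (suc d) y + h zero (suc d) x y
  E′ : ℕ
  E′ = conflicts r (λ c d → h (suc c) (suc d))
  -- `b * b` times the expected cost given the first value `x`. Its sum over `x` is `b` times the
  -- initial total, so some `x` stays below `b * b`, which also forces `u zero x` to vanish.
  Φ : Fin b → ℕ
  Φ x = b * b * u zero x + (b * sum (λ d → sum (u′ x d)) + E′)
  U : ℕ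
  U = sum (λ c → sum (u (suc c)))
  e₀ : ℕ
  e₀ = sum (λ d → sum λ x → sum λ y → h zero (suc d) x y)
  swap : sum (λ x → sum λ d → sum λ y → h zero (suc d) x y) ≡ e₀
  swap = ∑-comm (λ x d → sum λ y → h zero (suc d) x y)
  sumU′ : sum (λ x → sum (λ d → sum (u′ x d))) ≡ b * U + e₀
  sumU′ = trans (sum-cong-≗ λ x → sum₂-distrib (λ d → u (suc d)) (λ d → h zero (suc d) x))
           (trans (∑-distrib-+ (λ _ → U) (λ x → sum λ d → sum λ y → h zero (suc d) x y))
                  (cong₂ _+_ (sum-const b U) swap))
  rearrange : ∀ b s U e E → b * b * s + (b * (b * U + e) + b * E) ≡ b * (b * (s + U) + (e + E))
  rearrange = solve-∀
  sumΦ : sum Φ ≡ b * (b * (sum (u zero) + U) + (e₀ + E′))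
  sumΦ = trans (∑-distrib-+ (λ x → b * b * u zero x) (λ x → b * sum (λ d → sum (u′ x d)) + E′))
          (trans (cong₂ _+_ (sum-scale (b * b) (u zero))
                   (trans (∑-distrib-+ (λ x → b * sum (λ d → sum (u′ x d))) (λ _ → E′))
                          (cong₂ _+_ (trans (sum-scale b (λ x → sum (λ d → sum (u′ x d)))) (cong (b *_) sumU′))
                                     (sum-const b E′))))
                 (rearrange b (sum (u zero)) U e₀ E′))
  b-pos : NonZero b
  b-pos = nz b lt
    where
    nz : ∀ b {m} → m < b * b → NonZero b
    nz (suc _) _ = _
  small : ∃ λ x → Φ x < b * b
  small = sum-<⇒∃ (subst₂ _<_ (sym sumΦ) (sym (sum-const b (b * b))) (ℕ.*-monoʳ-< b {{b-pos}} lt))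
  x₀ : Fin b
  x₀ = proj₁ small
  u₀≡0 : u zero x₀ ≡ 0
  u₀≡0 with u zero x₀ in eq
  ... | zero = refl
  ... | suc k = contradiction (proj₂ small) (ℕ.≤⇒≯ (ℕ.≤-trans (ℕ.m≤m*n (b * b) (suc k))
                  (ℕ.≤-trans (ℕ.≤-reflexive (cong (b * b *_) (sym eq))) (ℕ.m≤m+n (b * b * u zero x₀) _))))
  rest : ∃ λ (f : Fin r → Fin b) → (∀ c → u′ x₀ c (f c) ≡ 0) × (∀ {c d} → toℕ c < toℕ d → h (suc c) (suc d) (f c) (f d) ≡ 0)
  rest = transversal r (u′ x₀) (λ c d → h (suc c) (suc d)) (ℕ.≤-trans (s≤s (ℕ.m≤n+m _ (b * b * u zero x₀))) (proj₂ small))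
  f : Fin (suc r) → Fin b
  f zero    = x₀
  f (suc c) = proj₁ rest c
  f-zero : ∀ c → u c (f c) ≡ 0
  f-zero zero    = u₀≡0
  f-zero (suc c) = ℕ.m+n≡0⇒m≡0 _ (proj₁ (proj₂ rest) c)
  f-free : ∀ {c d} → toℕ c < toℕ d → h c d (f c) (f d) ≡ 0
  f-free {zero}  {suc d} _       = ℕ.m+n≡0⇒n≡0 (u (suc d) (f (suc d))) (proj₁ (proj₂ rest) d)
  f-free {suc c} {suc d} (s≤s l) = proj₂ (proj₂ rest) l

conflicts≤ : ∀ r {b} (h : Fin r → Fin r → Fin b → Fin b → ℕ) →
             conflicts r h ≤ sum (λ c → sum λ d → sum λ x → sum λ y → h c d x y)
conflicts≤ zero    h = z≤n
conflicts≤ (suc r) h = ℕ.+-mono-≤ (ℕ.m≤n+m (sum (e zero ∘ suc)) (e zero zero))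
  (ℕ.≤-trans (conflicts≤ r (λ c d → h (suc c) (suc d)))
             (sum-mono λ c → ℕ.m≤n+m (sum (e (suc c) ∘ suc)) (e (suc c) zero)))
  where
  e : Fin (suc r) → Fin (suc r) → ℕ
  e c d = sum λ x → sum λ y → h c d x y

-- If every pair has fewer than `b * b / (r * r)` clashes, the `r * r` pairs together have fewer
-- than `b * b`, so the expected number of clashes is below one.
free-or-dense : ∀ r {b} (h : Fin r → Fin r → Fin b → Fin b → ℕ) → 1 ≤ r → 1 ≤ b →
  (∃ λ (f : Fin r → Fin b) → ∀ {c d} → toℕ c < toℕ d → h c d (f c) (f d) ≡ 0)
  ⊎ (∃₂ λ c d → b * b ≤ r * r * sum (λ x → sum λ y → h c d x y))
free-or-dense r@(suc _) {b} h _ 1≤b with Fin.any? (λ c → Fin.any? λ d → b * b ℕ.≤? r * r * sum (λ x → sum λ y → h c d x y))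
... | yes dense = inj₂ dense
... | no sparse = inj₁ (let f , _ , free = transversal r (λ _ _ → 0) h expectation in f , free)
  where
  e : Fin r → Fin r → ℕ
  e c d = sum (λ x → sum λ y → h c d x y)
  scaled : r * r * sum (λ c → sum (e c)) < r * r * (b * b)
  scaled = ℕ.≤-trans (ℕ.≤-trans (ℕ.≤-reflexive (ℕ.+-comm 1 _)) (ℕ.+-monoʳ-≤ (r * r * sum (λ c → sum (e c))) (s≤s z≤n)))
    (subst₂ _≤_ (trans (sum₂-distrib (λ c d → r * r * e c d) (λ _ _ → 1))
                       (cong₂ _+_ (sum₂-scale (r * r) e) (trans (sum₂-const r r 1) (cong (r *_) (ℕ.*-identityʳ r)))))
                (trans (sum₂-const r r (b * b)) (sym (ℕ.*-assoc r r (b * b))))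
                (sum₂-mono λ c d → subst (_≤ b * b) (ℕ.+-comm 1 _) (ℕ.≰⇒> λ big → sparse (c , d , big))))
  expectation : b * sum {r} (λ c → sum {b} λ _ → 0) + conflicts r h < b * b
  expectation = subst (λ z → b * z + conflicts r h < b * b)
    (sym (trans (sum₂-const r b 0) (trans (cong (r *_) (ℕ.*-zeroʳ b)) (ℕ.*-zeroʳ r))))
    (subst (λ z → z + conflicts r h < b * b) (sym (ℕ.*-zeroʳ b))
      (ℕ.≤-trans (s≤s (conflicts≤ r h)) (ℕ.*-cancelˡ-< (r * r) _ _ scaled)))

-- Dense relations

-- The orders `A` and `B` are parameters so that the north-east and the south-west corner are
-- instances with both orders reversed.
module Corner {m n : ℕ} {H : Fin m → Fin n → Set} (H? : ∀ i j → Dec (H i j))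
              {A : Fin m → Fin m → Set} (A? : ∀ i i′ → Dec (A i i′)) (A-connex : ∀ i i′ → A i i′ ⊎ i ≡ i′ ⊎ A i′ i)
              {B : Fin n → Fin n → Set} (B? : ∀ j j′ → Dec (B j j′)) (B-connex : ∀ j j′ → B j j′ ⊎ j ≡ j′ ⊎ B j′ j) where

  Cornered : Fin m → Fin n → Set
  Cornered i j = ∃₂ λ i′ j′ → H i′ j′ × A i′ i × B j′ j

  cornered? : ∀ i j → Dec (Cornered i j)
  cornered? i j = Fin.any? λ i′ → Fin.any? λ j′ → H? i′ j′ ×-dec A? i′ i ×-dec B? j′ j

  RowNext : Fin m → Fin n → Set
  RowNext i j = ∃ λ j′ → H i j′ × B j′ j

  rowNext? : ∀ i j → Dec (RowNext i j)
  rowNext? i j = Fin.any? λ j′ → H? i j′ ×-dec B? j′ j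

  ColNext : Fin m → Fin n → Set
  ColNext i j = ∃ λ i′ → (H i′ j × RowNext i′ j) × A i′ i

  colNext? : ∀ i j → Dec (ColNext i j)
  colNext? i j = Fin.any? λ i′ → (H? i′ j ×-dec rowNext? i′ j) ×-dec A? i′ i

  rowEnd? : ∀ i j → Dec (H i j × ¬ RowNext i j)
  rowEnd? i j = H? i j ×-dec ¬? (rowNext? i j)

  colEnd? : ∀ i j → Dec ((H i j × RowNext i j) × ¬ ColNext i j)
  colEnd? i j = (H? i j ×-dec rowNext? i j) ×-dec ¬? (colNext? i j)

  -- An uncornered cell is extreme in its row, or extreme in its column among the others.
  uncornered : sum (λ i → sum λ j → ♯ (H? i j ×-dec ¬? (cornered? i j))) ≤ m + n
  uncornered = ℕ.≤-trans (sum₂-mono pointwise) (ℕ.≤-trans (ℕ.≤-reflexive (sum₂-distrib (λ i j → ♯ (rowEnd? i j)) (λ i j → ♯ (colEnd? i j))))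
    (ℕ.+-mono-≤ rows (ℕ.≤-trans (ℕ.≤-reflexive (∑-comm (λ i j → ♯ (colEnd? i j)))) cols)))
    where
    pointwise : ∀ i j → ♯ (H? i j ×-dec ¬? (cornered? i j)) ≤ ♯ (rowEnd? i j) + ♯ (colEnd? i j)
    pointwise i j = ♯-≤ (H? i j ×-dec ¬? (cornered? i j)) λ (h , ¬c) → by h ¬c (rowNext? i j)
      where
      by : H i j → ¬ Cornered i j → Dec (RowNext i j) → 1 ≤ ♯ (rowEnd? i j) + ♯ (colEnd? i j)
      by h ¬c (no ¬r) = ℕ.≤-trans (ℕ.≤-reflexive (sym (♯-yes (rowEnd? i j) (h , ¬r)))) (ℕ.m≤m+n _ _)
      by h ¬c (yes r) = ℕ.≤-trans (ℕ.≤-reflexive (sym (♯-yes (colEnd? i j) ((h , r) ,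
        λ (i′ , (_ , j′ , h′ , b) , a) → ¬c (i′ , j′ , h′ , a , b))))) (ℕ.m≤n+m _ (♯ (rowEnd? i j)))
    rows : sum (λ i → sum λ j → ♯ (rowEnd? i j)) ≤ m
    rows = ℕ.≤-trans (sum-mono λ i → sum-♯≤1 (rowEnd? i) λ {j} {j′} → one i j j′) (ℕ.≤-reflexive (trans (sum-const m 1) (ℕ.*-identityʳ m)))
      where
      one : ∀ i j j′ → H i j × ¬ RowNext i j → H i j′ × ¬ RowNext i j′ → j ≡ j′
      one i j j′ (h , ¬r) (h′ , ¬r′) with B-connex j j′
      ... | inj₁ b = contradiction (j , h , b) ¬r′
      ... | inj₂ (inj₁ e) = e
      ... | inj₂ (inj₂ b) = contradiction (j′ , h′ , b) ¬r
    cols : sum (λ j → sum λ i → ♯ (colEnd? i j)) ≤ n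
    cols = ℕ.≤-trans (sum-mono λ j → sum-♯≤1 (λ i → colEnd? i j) λ {i} {i′} → one j i i′) (ℕ.≤-reflexive (trans (sum-const n 1) (ℕ.*-identityʳ n)))
      where
      one : ∀ j i i′ → (H i j × RowNext i j) × ¬ ColNext i j → (H i′ j × RowNext i′ j) × ¬ ColNext i′ j → i ≡ i′
      one j i i′ (h , ¬c) (h′ , ¬c′) with A-connex i i′
      ... | inj₁ a = contradiction (i , h , a) ¬c′
      ... | inj₂ (inj₁ e) = e
      ... | inj₂ (inj₂ a) = contradiction (i′ , h′ , a) ¬c

module Enclosed {m : ℕ} {H : Fin m → Fin m → Set} (H? : ∀ i j → Dec (H i j)) where

  private
    lt? gt? : (i j : Fin m) → Dec _
    lt? i j = toℕ i ℕ.<? toℕ j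
    gt? i j = toℕ j ℕ.<? toℕ i

    lt-connex : (i j : Fin m) → toℕ i < toℕ j ⊎ i ≡ j ⊎ toℕ j < toℕ i
    lt-connex i j with ℕ.<-cmp (toℕ i) (toℕ j)
    ... | tri< l _ _ = inj₁ l
    ... | tri≈ _ e _ = inj₂ (inj₁ (Fin.toℕ-injective e))
    ... | tri> _ _ g = inj₂ (inj₂ g)

    gt-connex : (i j : Fin m) → toℕ j < toℕ i ⊎ i ≡ j ⊎ toℕ i < toℕ j
    gt-connex i j with lt-connex i j
    ... | inj₁ l = inj₂ (inj₂ l)
    ... | inj₂ (inj₁ e) = inj₂ (inj₁ e)
    ... | inj₂ (inj₂ g) = inj₁ g

    module NE = Corner H? lt? lt-connex gt? gt-connex
    module SW = Corner H? gt? gt-connex lt? lt-connex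

  record Enclosed (i j : Fin m) : Set where
    constructor enclosed
    field
      here-H : H i j
      ne     : ∃₂ λ i′ j′ → H i′ j′ × toℕ i′ < toℕ i × toℕ j < toℕ j′
      sw     : ∃₂ λ i′ j′ → H i′ j′ × toℕ i < toℕ i′ × toℕ j′ < toℕ j

  enclosed? : ∀ i j → Dec (Enclosed i j)
  enclosed? i j = map′ (λ (h , n , s) → enclosed h n s) (λ (enclosed h n s) → h , n , s)
                       (H? i j ×-dec NE.cornered? i j ×-dec SW.cornered? i j)

  mostly-enclosed : sum (λ i → sum λ j → ♯ (H? i j)) ≤ sum (λ i → sum λ j → ♯ (enclosed? i j)) + ((m + m) + (m + m))
  mostly-enclosed = ℕ.≤-trans (sum₂-mono pointwise) (ℕ.≤-trans
    (ℕ.≤-reflexive (trans (sum₂-distrib e (λ i j → ne i j + sw i j)) (cong (sum (λ i → sum (e i)) +_) (sum₂-distrib ne sw))))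
    (ℕ.+-monoʳ-≤ (sum (λ i → sum (e i))) (ℕ.+-mono-≤ NE.uncornered SW.uncornered)))
    where
    e ne sw : Fin m → Fin m → ℕ
    e i j = ♯ (enclosed? i j)
    ne i j = ♯ (H? i j ×-dec ¬? (NE.cornered? i j))
    sw i j = ♯ (H? i j ×-dec ¬? (SW.cornered? i j))
    pointwise : ∀ i j → ♯ (H? i j) ≤ e i j + (ne i j + sw i j)
    pointwise i j = ♯-≤ (H? i j) λ h → by h (NE.cornered? i j) (SW.cornered? i j)
      where
      by : H i j → Dec (NE.Cornered i j) → Dec (SW.Cornered i j) → 1 ≤ e i j + (ne i j + sw i j)
      by h (yes n) (yes s) = ℕ.≤-trans (ℕ.≤-reflexive (sym (♯-yes (enclosed? i j) (enclosed h n s)))) (ℕ.m≤m+n _ _)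
      by h (no ¬n) _ = ℕ.≤-trans (ℕ.≤-reflexive (sym (♯-yes (H? i j ×-dec ¬? (NE.cornered? i j)) (h , ¬n))))
                         (ℕ.≤-trans (ℕ.m≤m+n (ne i j) (sw i j)) (ℕ.m≤n+m _ (e i j)))
      by h _ (no ¬s) = ℕ.≤-trans (ℕ.≤-reflexive (sym (♯-yes (H? i j ×-dec ¬? (SW.cornered? i j)) (h , ¬s))))
                         (ℕ.≤-trans (ℕ.m≤n+m (sw i j) (ne i j)) (ℕ.m≤n+m _ (e i j)))

-- Dependent random choice with two random columns.
module RichRows {K : ℕ} {H : Fin K → Fin K → Set} (H? : ∀ x c → Dec (H x c)) (D κ t : ℕ)
                (1≤K : 1 ≤ K) (dense : K * t ≤ sum λ x → sum λ c → ♯ (H? x c))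
                (big : K * (D * D + κ) ≤ t * t) where

  both? : ∀ x y c → Dec (H x c × H y c)
  both? x y c = H? x c ×-dec H? y c

  codeg : Fin K → Fin K → ℕ
  codeg x y = sum λ c → ♯ (both? x y c)

  deg : Fin K → ℕ
  deg x = sum λ c → ♯ (H? x c)

  U? : ∀ c d x → Dec (H x c × H x d)
  U? c d x = H? x c ×-dec H? x d

  poor? : ∀ x y → Dec (codeg x y < D)
  poor? x y = codeg x y ℕ.<? D

  PoorPair : Fin K → Fin K → Fin K → Fin K → Set
  PoorPair c d x y = (H x c × H x d) × (H y c × H y d) × codeg x y < D

  poorPair? : ∀ c d x y → Dec (PoorPair c d x y)
  poorPair? c d x y = U? c d x ×-dec U? c d y ×-dec poor? x y

  u β : Fin K → Fin K → ℕ
  u c d = sum λ x → ♯ (U? c d x)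
  β c d = sum λ x → sum λ y → ♯ (poorPair? c d x y)

  am-gm : ∀ d t → d * t + d * t ≤ d * d + t * t
  am-gm d t with ℕ.≤-total d t
  ... | inj₁ d≤t with ℕ.m≤n⇒∃[o]m+o≡n d≤t
  ...   | e , refl = subst (d * (d + e) + d * (d + e) ≤_) (sym (lemma d e)) (ℕ.m≤m+n _ (e * e))
    where
    lemma : ∀ d e → d * d + (d + e) * (d + e) ≡ d * (d + e) + d * (d + e) + e * e
    lemma = solve-∀
  am-gm d t | inj₂ t≤d with ℕ.m≤n⇒∃[o]m+o≡n t≤d
  ...   | e , refl = subst ((t + e) * t + (t + e) * t ≤_) (sym (lemma t e)) (ℕ.m≤m+n _ (e * e))
    where
    lemma : ∀ t e → (t + e) * (t + e) + t * t ≡ (t + e) * t + (t + e) * t + e * e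
    lemma = solve-∀

  -- Cauchy-Schwarz in the form `2dt ≤ d² + t²`, summed over all rows against the average degree
  -- `t`.
  many-squares : K * (t * t) ≤ sum λ x → deg x * deg x
  many-squares = ℕ.+-cancelʳ-≤ (K * (t * t)) _ _ (begin
    K * (t * t) + K * (t * t)                        ≡⟨ cong₂ _+_ (sym (ℕ.*-assoc K t t)) (sym (ℕ.*-assoc K t t)) ⟩
    K * t * t + K * t * t                            ≤⟨ ℕ.+-mono-≤ (ℕ.*-monoˡ-≤ t dense) (ℕ.*-monoˡ-≤ t dense) ⟩
    sum deg * t + sum deg * t                        ≡⟨ cong₂ _+_ (*-distribʳ-sum t deg) (*-distribʳ-sum t deg) ⟩
    sum (λ x → deg x * t) + sum (λ x → deg x * t)    ≡⟨ sym (∑-distrib-+ (λ x → deg x * t) (λ x → deg x * t)) ⟩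
    sum (λ x → deg x * t + deg x * t)                ≤⟨ sum-mono (λ x → am-gm (deg x) t) ⟩
    sum (λ x → deg x * deg x + t * t)                ≡⟨ ∑-distrib-+ (λ x → deg x * deg x) (λ _ → t * t) ⟩
    sum (λ x → deg x * deg x) + sum {K} (λ _ → t * t) ≡⟨ cong (sum (λ x → deg x * deg x) +_) (sum-const K (t * t)) ⟩
    sum (λ x → deg x * deg x) + K * (t * t)          ∎)
    where open ℕ.≤-Reasoning

  pull-in : ∀ (f : Fin K → Fin K → Fin K → ℕ) →
            sum (λ c → sum λ d → sum λ x → f c d x) ≡ sum λ x → sum λ c → sum λ d → f c d x
  pull-in f = trans (sum-cong-≗ λ c → ∑-comm (f c)) (∑-comm (λ c x → sum λ d → f c d x))

  sum-u : sum (λ c → sum (u c)) ≡ sum λ x → deg x * deg x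
  sum-u = trans (pull-in (λ c d x → ♯ (U? c d x))) (sum-cong-≗ λ x →
    trans (sum-cong-≗ λ c → sum-cong-≗ λ d → ♯-× (H? x c) (H? x d)) (sum-product (λ c → ♯ (H? x c)) (λ d → ♯ (H? x d))))

  -- Rows `x` and `y` both survive the choice of columns `c` and `d` only if both columns are common
  -- neighbours, and a poor pair has fewer than `D` of these.
  poor-count : ∀ x y → sum (λ c → sum λ d → ♯ (poorPair? c d x y)) ≤ D * D
  poor-count x y = by (poor? x y)
    where
    by : Dec (codeg x y < D) → sum (λ c → sum λ d → ♯ (poorPair? c d x y)) ≤ D * D
    by (no rich) = ℕ.≤-trans (sum₂-mono λ c d → ♯-≤ (poorPair? c d x y) λ (_ , _ , p) → contradiction p rich)
                    (ℕ.≤-trans (ℕ.≤-reflexive (trans (sum₂-const K K 0) (trans (cong (K *_) (ℕ.*-zeroʳ K)) (ℕ.*-zeroʳ K)))) z≤n)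
    by (yes p) = ℕ.≤-trans (sum₂-mono bound) (ℕ.≤-trans
        (ℕ.≤-reflexive (sum-product (λ c → ♯ (both? x y c)) (λ d → ♯ (both? x y d))))
        (ℕ.*-mono-≤ (ℕ.<⇒≤ p) (ℕ.<⇒≤ p)))
      where
      bound : ∀ c d → ♯ (poorPair? c d x y) ≤ ♯ (both? x y c) * ♯ (both? x y d)
      bound c d = ♯-≤ (poorPair? c d x y) λ ((xc , xd) , (yc , yd) , _) →
        ℕ.≤-reflexive (sym (cong₂ _*_ (♯-yes (both? x y c) (xc , yc)) (♯-yes (both? x y d) (xd , yd))))

  sum-β : sum (λ c → sum (β c)) ≤ K * (K * (D * D))
  sum-β = ℕ.≤-trans (ℕ.≤-reflexive (trans (pull-in (λ c d x → sum λ y → ♯ (poorPair? c d x y)))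
      (sum-cong-≗ λ x → pull-in (λ c d y → ♯ (poorPair? c d x y)))))
    (ℕ.≤-trans (sum₂-mono poor-count) (ℕ.≤-reflexive (sum₂-const K K (D * D))))

  -- On average over column pairs, the number of surviving rows exceeds the number of surviving poor
  -- pairs by `κ`.
  good-columns : ∃₂ λ c d → β c d + κ ≤ u c d
  good-columns with sum₂-<⇒∃ exceeds
    where
    open ℕ.≤-Reasoning
    distribute : ∀ K D κ → K * (K * (D * D)) + K * (K * κ) ≡ K * (K * (D * D + κ))
    distribute = solve-∀
    exceeds : sum (λ c → sum λ d → β c d + κ) < sum (λ c → sum λ d → u c d + 1)
    exceeds = begin-strict
      sum (λ c → sum λ d → β c d + κ)                         ≡⟨ sum₂-distrib β (λ _ _ → κ) ⟩
      sum (λ c → sum (β c)) + sum {K} (λ c → sum {K} λ d → κ) ≤⟨ ℕ.+-mono-≤ sum-β (ℕ.≤-reflexive (sum₂-const K K κ)) ⟩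
      K * (K * (D * D)) + K * (K * κ)                         ≡⟨ distribute K D κ ⟩
      K * (K * (D * D + κ))                                   ≤⟨ ℕ.*-monoʳ-≤ K big ⟩
      K * (t * t)                                             ≤⟨ many-squares ⟩
      sum (λ x → deg x * deg x)                               ≡⟨ sym sum-u ⟩
      sum (λ c → sum (u c))                                   <⟨ ℕ.m<m+n _ (ℕ.*-mono-≤ 1≤K (ℕ.*-mono-≤ 1≤K (ℕ.≤-refl {1}))) ⟩
      sum (λ c → sum (u c)) + K * (K * 1)                     ≡⟨ cong (sum (λ c → sum (u c)) +_) (sym (sum₂-const K K 1)) ⟩
      sum (λ c → sum (u c)) + sum {K} (λ _ → sum {K} λ _ → 1) ≡⟨ sym (sum₂-distrib u (λ _ _ → 1)) ⟩
      sum (λ c → sum λ d → u c d + 1)                         ∎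
  ... | c , d , lt = c , d , s≤s⁻¹ (subst (suc (β c d + κ) ≤_) (ℕ.+-comm (u c d) 1) lt)

  -- Discard every surviving row that lies in a poor pair; each discarded row accounts for at least
  -- one such pair. Pairs with `x = y` are included, so the chosen rows themselves have degree at
  -- least `D`.
  rich-rows : ∃ λ (z : Fin κ → Fin K) → (∀ {i j} → z i ≡ z j → i ≡ j) × (∀ i j → D ≤ codeg (z i) (z j))
  rich-rows = let z , z-good , z-inj , _ = chosen in z , z-inj , λ i j → ℕ.≮⇒≥ λ p →
      proj₂ (z-good i) (z j , proj₁ (z-good i) , proj₁ (z-good j) , p)
    where
    c d : Fin K
    c = proj₁ good-columns
    d = proj₁ (proj₂ good-columns)
    inPoor? : ∀ x → Dec (∃ λ y → PoorPair c d x y)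
    inPoor? x = Fin.any? (poorPair? c d x)
    good? : ∀ x → Dec ((H x c × H x d) × ¬ ∃ λ y → PoorPair c d x y)
    good? x = U? c d x ×-dec ¬? (inPoor? x)
    u≤ : u c d ≤ sum (♯ ∘ good?) + β c d
    u≤ = ℕ.≤-trans (sum-mono bound) (ℕ.≤-reflexive (∑-distrib-+ (♯ ∘ good?) (λ x → sum λ y → ♯ (poorPair? c d x y))))
      where
      bound : ∀ x → ♯ (U? c d x) ≤ ♯ (good? x) + sum (λ y → ♯ (poorPair? c d x y))
      bound x = ♯-≤ (U? c d x) λ ux → by ux (inPoor? x)
        where
        by : H x c × H x d → Dec (∃ λ y → PoorPair c d x y) → 1 ≤ ♯ (good? x) + sum (λ y → ♯ (poorPair? c d x y))
        by ux (no ¬p) = ℕ.≤-trans (ℕ.≤-reflexive (sym (♯-yes (good? x) (ux , ¬p)))) (ℕ.m≤m+n _ _)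
        by ux (yes (y , p)) = ℕ.≤-trans (ℕ.≤-reflexive (sym (♯-yes (poorPair? c d x y) p)))
          (ℕ.≤-trans (term≤sum (λ y → ♯ (poorPair? c d x y)) y) (ℕ.m≤n+m _ (♯ (good? x))))
    κ≤ : κ ≤ sum (♯ ∘ good?)
    κ≤ = ℕ.+-cancelʳ-≤ (β c d) _ _ (ℕ.≤-trans (ℕ.≤-reflexive (ℕ.+-comm κ (β c d))) (ℕ.≤-trans (proj₂ (proj₂ good-columns)) u≤))
    chosen : ∃ λ (z : Fin κ → Fin K) → (∀ s → (H (z s) c × H (z s) d) × ¬ ∃ λ y → PoorPair c d (z s) y)
                                       × (∀ {i j} → z i ≡ z j → i ≡ j) × (∀ s → z s ∉ [])
    chosen = distinct-choice κ (λ _ → good?) [] λ _ → subst (_≤ sum (♯ ∘ good?)) (sym (ℕ.+-identityʳ κ)) κ≤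

-- Threads

module Tour {b : ℕ} (π : Fin b → Fin b) (π-injective : ∀ {i j} → π i ≡ π j → i ≡ j) where

  -- From x on, the tour follows π; when the cycle started at s closes, it jumps to a larger start.
  data Tour (x s : Fin b) : List (Fin b) → Set where
    []     : Tour x s []
    follow : ∀ {ys} → Tour (π x) s ys → Tour x s (π x ∷ ys)
    jump   : ∀ {y ys} → π x ≡ s → toℕ s < toℕ y → Tour y y ys → Tour x s (y ∷ ys)

  -- The interval [π x , y) between consecutive stops x and y is empty.
  Empty : Fin b → List (Fin b) → ℕ → Set
  Empty d xs l = toℕ (nth d xs (suc l)) ≤ toℕ (π (nth d xs l))

  tour-step : ∀ {x s ys d} → Tour x s ys → ∀ {l} → suc l < length (x ∷ ys) →
              toℕ (π (nth d (x ∷ ys) l)) ≤ toℕ (nth d (x ∷ ys) (suc l))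
  tour-step [] (s≤s ())
  tour-step (follow t)       {zero}  _       = ℕ.≤-refl
  tour-step (follow t)       {suc l} (s≤s p) = tour-step t p
  tour-step (jump refl s<y t) {zero}  _       = ℕ.<⇒≤ s<y
  tour-step (jump e s<y t)   {suc l} (s≤s p) = tour-step t p

  tour-above : ∀ {x s ys d} → Tour x s ys → ∀ {l} → suc l < length (x ∷ ys) →
               Empty d (x ∷ ys) l ⊎ toℕ s ≤ toℕ (π (nth d (x ∷ ys) l))
  tour-above [] (s≤s ())
  tour-above (follow t)        {zero}  _       = inj₁ ℕ.≤-refl
  tour-above (follow t)        {suc l} (s≤s p) = tour-above t p
  tour-above (jump refl s<y t) {zero}  _       = inj₂ ℕ.≤-refl
  tour-above (jump e s<y t)    {suc l} (s≤s p) with tour-above t p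
  ... | inj₁ emp = inj₁ emp
  ... | inj₂ y≤  = inj₂ (ℕ.≤-trans (ℕ.<⇒≤ s<y) y≤)

  -- Only a jump leaves a nonempty interval, reaching from the start of the closed cycle to the next
  -- start. Starts increase, so later intervals lie higher.
  tour-ordered : ∀ {x s ys d} → Tour x s ys → ∀ {l l′} → l < l′ → suc l′ < length (x ∷ ys) →
                 Empty d (x ∷ ys) l ⊎ Empty d (x ∷ ys) l′ ⊎ toℕ (nth d (x ∷ ys) (suc l)) ≤ toℕ (π (nth d (x ∷ ys) l′))
  tour-ordered [] _ (s≤s ())
  tour-ordered (follow t) {zero}  {suc l′} _ _ = inj₁ ℕ.≤-refl
  tour-ordered (follow t) {suc l} {suc l′} (s≤s l<) (s≤s p) = tour-ordered t l< p
  tour-ordered (jump e s<y t) {zero}  {suc l′} _ (s≤s p) with tour-above t p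
  ... | inj₁ emp = inj₂ (inj₁ emp)
  ... | inj₂ y≤  = inj₂ (inj₂ y≤)
  tour-ordered (jump e s<y t) {suc l} {suc l′} (s≤s l<) (s≤s p) = tour-ordered t l< p

  smallest-missing : ∀ vs → length vs < b → ∃ λ y → y ∉ vs × (∀ {z} → toℕ z < toℕ y → z ∈ vs)
  smallest-missing vs short
    with Fin.¬∀⟶∃¬-smallest b (_∈ vs) (λ z → any? (z Fin.≟_) vs)
           (λ all → ℕ.<⇒≱ short (Fin.injective⇒≤ {f = λ z → index (all z)} λ {i} {j} e →
              trans (lookup-index (all i)) (trans (cong (lookup vs) e) (sym (lookup-index (all j))))))
  ... | y , y∉ , initial = y , y∉ , λ {z} z<y → subst (_∈ vs)
          (Fin.toℕ-injective (trans (Fin.toℕ-inject (fromℕ< z<y)) (Fin.toℕ-fromℕ< z<y))) (initial (fromℕ< z<y))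

  -- By `came`, every visited index except `s` is the image of a visited index other than `x`. If
  -- `π x` was visited before, injectivity thus leaves only `π x ≡ s`: the cycle closes. By
  -- `initial`, the smallest missing index is larger than `s`.
  record Visited (x s : Fin b) (vs : List (Fin b)) : Set where
    field
      x∈    : x ∈ vs
      initial : ∀ {z} → toℕ z ≤ toℕ s → z ∈ vs
      came  : ∀ {z} → z ∈ vs → z ≡ s ⊎ ∃ λ y → y ∈ vs × y ≢ x × π y ≡ z

  continue : ∀ k {x s vs} → Visited x s vs → length vs + k ≡ b →
             ∃ λ ys → length ys ≡ k × Tour x s ys × Unique ys × (∀ {z} → z ∈ ys → z ∉ vs)
  continue zero    V e = [] , refl , [] , [] , λ ()
  continue (suc k) {x} {s} {vs} V e with any? (π x Fin.≟_) vs
  ... | no new = let ys , len , t , u , out = continue k V′ (trans (sym (ℕ.+-suc (length vs) k)) e) in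
        π x ∷ ys , cong suc len , follow t
        , All.¬Any⇒All¬ ys (λ m → out m (here refl)) ∷ u
        , λ { (here refl) → new ; (there m) z∈ → out m (there z∈) }
    where
    open Visited V
    V′ : Visited (π x) s (π x ∷ vs)
    V′ = record { x∈ = here refl ; initial = there ∘ initial ; came = came′ }
      where
      came′ : ∀ {z} → z ∈ π x ∷ vs → z ≡ s ⊎ ∃ λ y → y ∈ π x ∷ vs × y ≢ π x × π y ≡ z
      came′ (here refl) = inj₂ (x , there x∈ , (λ x≡ → new (subst (_∈ vs) x≡ x∈)) , refl)
      came′ (there z∈) with came z∈
      ... | inj₁ e = inj₁ e
      ... | inj₂ (y , y∈ , _ , e) = inj₂ (y , there y∈ , (λ y≡ → new (subst (_∈ vs) y≡ y∈)) , e)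
  ... | yes old with smallest-missing vs (subst (length vs <_) e (ℕ.m<m+n (length vs) (s≤s z≤n)))
  ...   | y , y∉ , before = let ys , len , t , u , out = continue k V′ (trans (sym (ℕ.+-suc (length vs) k)) e) in
        y ∷ ys , cong suc len , jump closes (ℕ.≰⇒> (y∉ ∘ initial)) t
        , All.¬Any⇒All¬ ys (λ m → out m (here refl)) ∷ u
        , λ { (here refl) → y∉ ; (there m) z∈ → out m (there z∈) }
    where
    open Visited V
    closes : π x ≡ s
    closes with came old
    ... | inj₁ e = e
    ... | inj₂ (y , _ , y≢x , e) = contradiction (π-injective e) y≢x
    V′ : Visited y y (y ∷ vs)
    V′ = record { x∈ = here refl ; initial = initial′ ; came = came′ }
      where
      initial′ : ∀ {z} → toℕ z ≤ toℕ y → z ∈ y ∷ vs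
      initial′ z≤y with ℕ.m≤n⇒m<n∨m≡n z≤y
      ... | inj₁ z<y = there (before z<y)
      ... | inj₂ z≡y = here (Fin.toℕ-injective z≡y)
      came′ : ∀ {z} → z ∈ y ∷ vs → z ≡ y ⊎ ∃ λ y′ → y′ ∈ y ∷ vs × y′ ≢ y × π y′ ≡ z
      came′ (here e) = inj₁ e
      came′ (there z∈) with came z∈
      ... | inj₁ refl = inj₂ (x , there x∈ , (λ x≡ → y∉ (subst (_∈ vs) x≡ x∈)) , closes)
      ... | inj₂ (y′ , y′∈ , _ , e) = inj₂ (y′ , there y′∈ , (λ y≡ → y∉ (subst (_∈ vs) y≡ y′∈)) , e)

  record FullTour : Set where
    field
      ord       : ℕ → Fin b
      injective : ∀ {p q} → p < b → q < b → ord p ≡ ord q → p ≡ q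
      step      : ∀ {p} → suc p < b → toℕ (π (ord p)) ≤ toℕ (ord (suc p))
      ordered   : ∀ {p q} → p < q → suc q < b → toℕ (ord (suc p)) ≤ toℕ (π (ord p))
                    ⊎ toℕ (ord (suc q)) ≤ toℕ (π (ord q)) ⊎ toℕ (ord (suc p)) ≤ toℕ (π (ord q))

fullTour : ∀ {b} (π : Fin (suc b) → Fin (suc b)) (π-injective : ∀ {i j} → π i ≡ π j → i ≡ j) →
           Tour.FullTour π π-injective
fullTour {b} π π-injective with Tour.continue π π-injective b {zero} {zero} {zero ∷ []} start refl
  where
  open Tour π π-injective
  start : Visited zero zero (zero ∷ [])
  start = record { x∈ = here refl ; initial = λ { {zero} _ → here refl } ; came = λ { (here e) → inj₁ e } }
... | ys , len , t , u , out = record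
  { ord = nth zero (zero ∷ ys)
  ; injective = λ p< q< → nth-injective (All.¬Any⇒All¬ ys (λ m → out m (here refl)) ∷ u) (fits p<) (fits q<)
  ; step = λ p< → Tour.tour-step π π-injective t (fits p<)
  ; ordered = λ p<q q< → Tour.tour-ordered π π-injective t p<q (fits q<) }
  where
  fits : ∀ {p} → p < suc b → p < suc (length ys)
  fits {p} = subst (λ n → p < suc n) (sym len)

-- A walk through disjoint paths, in order; every vertex lies on at most three of its pieces.
record Thread {V : Set} (R : V → V → Set) (b : ℕ) : Set₁ where
  field
    st en    : ℕ → V
    path     : ∀ p → Route R (st p) (en p)
    T        : Fin 3 → ℕ → V → Set
    link     : ∀ {p} → suc p < b → Σ (Route R (en p) (st (suc p))) λ r →
                 ∀ {z} → z ∈ verts r → (∃ λ c → T c p z) ⊎ z ∈ verts (path (suc p))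
    path⊆    : ∀ p {z} → z ∈ verts (path p) → T zero p z
    T-unique : ∀ c {p q z} → p < b → q < b → T c p z → T c q z → p ≡ q

-- One round goes out from an exit of `p` to `p′`, back to the exit of `p` given by `π`, and
-- forwards along `p` to the next exit of the tour. The three layers are these three kinds of
-- pieces.
module Threading {n a b : ℕ} {R : Fin n → Fin n → Set} (P : PathSystem R a (suc b)) (p p′ : Fin a) where
  open PathSystem P

  module L = Matching (out p p′)
  module M = Matching (back p p′)

  π : Fin (suc b) → Fin (suc b)
  π = M.to ∘ L.to

  tour : Tour.FullTour π (L.to-injective ∘ M.to-injective)
  tour = fullTour π (L.to-injective ∘ M.to-injective)

  open Tour.FullTour tour public using (ord) renaming (injective to ord-injective)
  open Tour.FullTour tour using (step; ordered)

  Gap : ℕ → Fin n → Set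
  Gap q z = suc q < suc b × Int p (π (ord q)) (ord (suc q)) z

  Layer : Fin 3 → ℕ → Fin n → Set
  Layer zero             q z = z ∈ verts (L.route (ord q))
  Layer (suc zero)       q z = z ∈ verts (M.route (L.to (ord q)))
  Layer (suc (suc zero)) q z = Gap q z

  gap-order : ∀ {q q′ z} → q < q′ → Gap q z → ¬ Gap q′ z
  gap-order q<q′ (_ , g) (q′< , g′) with ordered q<q′ q′<
  ... | inj₁ empty = Int-disjoint empty g g
  ... | inj₂ (inj₁ empty) = Int-disjoint empty g′ g′
  ... | inj₂ (inj₂ before) = Int-disjoint before g g′

  thread : Thread R (suc b)
  thread = record
    { st = λ q → exit p (ord q) ; en = λ q → entry p′ (L.to (ord q))
    ; path = λ q → L.route (ord q) ; T = Layer
    ; link = λ {q} q< → let r , r-in = along p (step q<) in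
        M.route (L.to (ord q)) ⁀ r , λ z∈ → split-link q< r r-in (∈-⁀⁻ (M.route (L.to (ord q))) r z∈)
    ; path⊆ = λ _ z∈ → z∈
    ; T-unique = unique }
    where
    split-link : ∀ {q} (q< : suc q < suc b) (r : Route R (exit p (π (ord q))) (exit p (ord (suc q)))) →
      (∀ {z} → z ∈ verts r → Int p (π (ord q)) (ord (suc q)) z ⊎ z ≡ exit p (ord (suc q))) → ∀ {z} →
      z ∈ verts (M.route (L.to (ord q))) ⊎ z ∈ verts r →
      (∃ λ c → Layer c q z) ⊎ z ∈ verts (L.route (ord (suc q)))
    split-link q< r r-in (inj₁ m) = inj₁ (suc zero , m)
    split-link q< r r-in (inj₂ m) with r-in m
    ... | inj₁ int = inj₁ (suc (suc zero) , q< , int)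
    ... | inj₂ e = inj₂ (subst (_∈ verts (L.route (ord (suc _)))) (sym e) (source∈ (L.route (ord (suc _)))))
    unique : ∀ c {q q′ z} → q < suc b → q′ < suc b → Layer c q z → Layer c q′ z → q ≡ q′
    unique zero             q< q′< l l′ = ord-injective q< q′< (L.disjoint l l′)
    unique (suc zero)       q< q′< l l′ = ord-injective q< q′< (L.to-injective (M.disjoint l l′))
    unique (suc (suc zero)) {q} {q′} q< q′< l l′ with ℕ.<-cmp q q′
    ... | tri≈ _ e _ = e
    ... | tri< q<q′ _ _ = contradiction l′ (gap-order q<q′ l)
    ... | tri> _ _ q′<q = contradiction l (gap-order q′<q l′)

-- Reindexing sums by tours and by blocks

sum-reorder : ∀ {b} (o : Fin b → Fin b) → (∀ {i j} → o i ≡ o j → i ≡ j) → ∀ (f : Fin b → ℕ) → sum f ≤ sum (f ∘ o)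
sum-reorder {b} o o-inj f = ℕ.≤-trans
  (ℕ.≤-reflexive (sum-cong-≗ λ x → cong f (sym (proj₂ (inv x)))))
  (sum-injective (proj₁ ∘ inv) (λ e → trans (sym (proj₂ (inv _))) (trans (cong o e) (proj₂ (inv _)))) (f ∘ o))
  where
  inv : ∀ y → ∃ λ x → o x ≡ y
  inv = injective⇒surjective o o-inj

sum-++ : ∀ m {n} (f : Fin (m + n) → ℕ) → sum f ≡ sum (λ i → f (i ↑ˡ n)) + sum (λ j → f (m ↑ʳ j))
sum-++ zero    f = refl
sum-++ (suc m) f = trans (cong (f zero +_) (sum-++ m (f ∘ suc))) (sym (ℕ.+-assoc (f zero) _ _))

sum-combine : ∀ K {m} (f : Fin (K * m) → ℕ) → sum f ≡ sum λ (I : Fin K) → sum λ (i : Fin m) → f (combine I i)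
sum-combine zero        f = refl
sum-combine (suc K) {m} f = trans (sum-++ m f) (cong (sum (λ i → f (i ↑ˡ (K * m))) +_) (sum-combine K (λ j → f (m ↑ʳ j))))

-- The sparse case

module Sparse {n : ℕ} (G : Digraph n) {q b : ℕ} (P : PathSystem (Arc G) (q * q) b) where

  open Reachability G
  open Families G
  open PathSystem P

  Meets : List V → List V → Set
  Meets xs ys = Any (_∈ ys) xs

  meets? : ∀ xs ys → Dec (Meets xs ys)
  meets? xs ys = any? (_∈V? ys) xs

  grp : Fin q → Fin q → Fin (q * q)
  grp = combine

  hub : Fin q → Fin (q * q)
  hub i = grp i i

  -- Path (i , j) is joined in both directions to the hubs i and j.
  Index : Set
  Index = Fin 4 × Fin q × Fin q

  from to : Index → Fin (q * q)
  from (zero , i , j)                 = hub i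
  from (suc zero , i , j)             = grp i j
  from (suc (suc zero) , i , j)       = hub j
  from (suc (suc (suc zero)) , i , j) = grp i j
  to (zero , i , j)                   = grp i j
  to (suc zero , i , j)               = hub i
  to (suc (suc zero) , i , j)         = grp i j
  to (suc (suc (suc zero)) , i , j)   = hub j

  -- A link belongs to the member whose hub it is attached to.
  owner : Index → Fin q
  owner (zero , i , j)        = i
  owner (suc zero , i , j)    = i
  owner (suc (suc _) , i , j) = j

  link : (t : Index) → Matching (Arc G) (exit (from t)) (entry (to t))
  link t = out (from t) (to t)

  clash : Index → Index → Fin b → Fin b → ℕ
  clash t t′ x y = ♯ (meets? (verts (Matching.route (link t) x)) (verts (Matching.route (link t′) y)))

  encode : Index → Fin (4 * (q * q))
  encode (d , i , j) = combine d (combine i j)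

  decode : Fin (4 * (q * q)) → Index
  decode c = let d , p = remQuot {4} (q * q) c in d , remQuot {q} q p

  decode-encode : ∀ t → decode (encode t) ≡ t
  decode-encode (d , i , j) = trans
    (cong (λ (d , p) → d , remQuot {q} q p) (Fin.remQuot-combine {4} {q * q} d (combine i j)))
    (cong (d ,_) (Fin.remQuot-combine {q} {q} i j))

  module Free (f : Fin (4 * (q * q)) → Fin b)
              (free : ∀ {c d} → toℕ c < toℕ d → clash (decode c) (decode d) (f c) (f d) ≡ 0) where

    Q : (t : Index) → Route (Arc G) (exit (from t) (f (encode t))) (entry (to t) (Matching.to (link t) (f (encode t))))
    Q t = Matching.route (link t) (f (encode t))

    Q-apart : ∀ t t′ {z} → z ∈ verts (Q t) → z ∈ verts (Q t′) → ¬ toℕ (encode t) < toℕ (encode t′)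
    Q-apart t t′ z∈ z∈′ lt with trans (sym (♯-yes (meets? (verts (Q t)) (verts (Q t′))) (lose z∈ z∈′)))
      (subst₂ (λ s s′ → clash s s′ (f (encode t)) (f (encode t′)) ≡ 0) (decode-encode t) (decode-encode t′) (free lt))
    ... | ()

    Q-disjoint : ∀ t t′ {z} → z ∈ verts (Q t) → z ∈ verts (Q t′) → t ≡ t′
    Q-disjoint t t′ z∈ z∈′ with ℕ.<-cmp (toℕ (encode t)) (toℕ (encode t′))
    ... | tri< lt _ _ = contradiction lt (Q-apart t t′ z∈ z∈′)
    ... | tri> _ _ gt = contradiction gt (Q-apart t′ t z∈′ z∈)
    ... | tri≈ _ e _ = trans (sym (decode-encode t)) (trans (cong decode (Fin.toℕ-injective e)) (decode-encode t′))

    InLoop : Fin (q * q) → Fin (q * q) → Index → Index → V → Set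
    InLoop h p t t′ z = In h z ⊎ In p z ⊎ z ∈ verts (Q t) ⊎ z ∈ verts (Q t′)

    record Loop (h p : Fin (q * q)) (t t′ : Index) : Set where
      field
        loop    : Route (Arc G) (centre h) (centre h)
        loop⊆   : ∀ {z} → z ∈ verts loop → InLoop h p t t′ z
        centre∈ : centre p ∈ verts loop

    make-loop : ∀ h p t t′ → from t ≡ h → to t ≡ p → from t′ ≡ p → to t′ ≡ h → Loop h p t t′
    make-loop h p t t′ e₁ e₂ e₃ e₄ = record
      { loop = proj₁ way ⁀ proj₁ home
      ; loop⊆ = λ z∈ → [ proj₂ way , proj₂ home ]′ (∈-⁀⁻ (proj₁ way) (proj₁ home) z∈)
      ; centre∈ = ∈-⁀⁺ʳ (proj₁ way) (proj₁ home) (source∈ (proj₁ home)) }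
      where
      side : ∀ {h p} t → from t ≡ h → to t ≡ p → Reach (λ z → In h z ⊎ In p z ⊎ z ∈ verts (Q t)) (centre h) (centre p)
      side t refl refl = reach-trans (reach-mono inj₁ (leave (from t) _))
        (reach-trans (Q t , inj₂ ∘ inj₂) (reach-mono (inj₂ ∘ inj₁) (enter (to t) _)))
      way : Reach (InLoop h p t t′) (centre h) (centre p)
      way = reach-mono [ inj₁ , [ inj₂ ∘ inj₁ , inj₂ ∘ inj₂ ∘ inj₁ ]′ ]′ (side t e₁ e₂)
      home : Reach (InLoop h p t t′) (centre p) (centre h)
      home = reach-mono [ inj₂ ∘ inj₁ , [ inj₁ , inj₂ ∘ inj₂ ∘ inj₂ ]′ ]′ (side t′ e₃ e₄)

    row : ∀ i j → Loop (hub i) (grp i j) (zero , i , j) (suc zero , i , j)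
    row i j = make-loop _ _ _ _ refl refl refl refl

    col : ∀ i j → Loop (hub j) (grp i j) (suc (suc zero) , i , j) (suc (suc (suc zero)) , i , j)
    col i j = make-loop _ _ _ _ refl refl refl refl

    rows cols X : Fin q → List V
    rows i = union (centre (hub i) ∷ []) (λ j → verts (Loop.loop (row i j)))
    cols j = union (centre (hub j) ∷ []) (λ i → verts (Loop.loop (col i j)))
    X i = union {1} (rows i) (λ _ → cols i)

    single-strong : ∀ v → Strong (v ∷ [])
    single-strong v (here refl) (here refl) = stay (here refl)

    X-strong : ∀ i → Strong (X i)
    X-strong i = union-strong {k = 1} {base = rows i} {c = λ _ → cols i}
      (union-strong {base = centre (hub i) ∷ []} (single-strong _) (λ j → closed-strong (Loop.loop (row i j)))
                    (λ j → centre (hub i) , here refl , source∈ (Loop.loop (row i j))))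
      (λ _ → union-strong {base = centre (hub i) ∷ []} (single-strong _) (λ j → closed-strong (Loop.loop (col j i)))
                    (λ j → centre (hub i) , here refl , source∈ (Loop.loop (col j i))))
      (λ _ → centre (hub i) , here refl , here refl)

    -- A member uses paths as rows, paths as columns, and linking routes. A path lies in one row and
    -- in one column, and a route has one owner.
    T : Fin 3 → Fin q → V → Set
    T zero             i z = ∃ λ j → In (grp i j) z
    T (suc zero)       i z = ∃ λ j → In (grp j i) z
    T (suc (suc zero)) i z = ∃ λ t → z ∈ verts (Q t) × owner t ≡ i

    X-cover : ∀ {i z} → z ∈ X i → ∃ λ l → T l i z
    X-cover {i} {z} z∈ with ∈-union⁻ {1} (rows i) {λ _ → cols i} z∈
    ... | inj₁ r with ∈-union⁻ (centre (hub i) ∷ []) r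
    ...   | inj₁ (here refl) = zero , i , proj₂ (leave (hub i) (f (encode (zero , i , i)))) (source∈ (proj₁ (leave (hub i) (f (encode (zero , i , i))))))
    ...   | inj₂ (j , m) with Loop.loop⊆ (row i j) m
    ...     | inj₁ h = zero , i , h
    ...     | inj₂ (inj₁ p) = zero , j , p
    ...     | inj₂ (inj₂ (inj₁ m′)) = suc (suc zero) , (zero , i , j) , m′ , refl
    ...     | inj₂ (inj₂ (inj₂ m′)) = suc (suc zero) , (suc zero , i , j) , m′ , refl
    X-cover {i} {z} z∈ | inj₂ (_ , c) with ∈-union⁻ (centre (hub i) ∷ []) c
    ...   | inj₁ (here refl) = zero , i , proj₂ (leave (hub i) (f (encode (zero , i , i)))) (source∈ (proj₁ (leave (hub i) (f (encode (zero , i , i))))))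
    ...   | inj₂ (j , m) with Loop.loop⊆ (col j i) m
    ...     | inj₁ h = zero , i , h
    ...     | inj₂ (inj₁ p) = suc zero , j , p
    ...     | inj₂ (inj₂ (inj₁ m′)) = suc (suc zero) , (suc (suc zero) , j , i) , m′ , refl
    ...     | inj₂ (inj₂ (inj₂ m′)) = suc (suc zero) , (suc (suc (suc zero)) , j , i) , m′ , refl

    T-unique : ∀ {l i j z} → T l i z → T l j z → i ≡ j
    T-unique {zero}     {i} {j} (k , a) (k′ , a′) = Fin.combine-injectiveˡ i k j k′ (In-unique a a′)
    T-unique {suc zero} {i} {j} (k , a) (k′ , a′) = Fin.combine-injectiveʳ k i k′ j (In-unique a a′)
    T-unique {suc (suc zero)} (t , m , o) (t′ , m′ , o′) = trans (sym o) (trans (cong owner (Q-disjoint t t′ m m′)) o′)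

    layered : Layered q 3
    layered = record
      { X = X ; strong = X-strong
      ; meet = λ i j → centre (grp i j)
          , ∈-++⁺ˡ (∈-union⁺ʳ {base = centre (hub i) ∷ []} j (Loop.centre∈ (row i j)))
          , ∈-union⁺ʳ {k = 1} {base = rows j} {c = λ _ → cols j} zero (∈-union⁺ʳ {base = centre (hub j) ∷ []} i (Loop.centre∈ (col i j)))
      ; T = T ; cover = X-cover ; unique = T-unique }

-- The dense case

sum₂-≤⇒∃ : ∀ {m n} {f g : Fin m → Fin n → ℕ} → 1 ≤ m → 1 ≤ n →
           sum (λ i → sum (f i)) ≤ sum (λ i → sum (g i)) → ∃₂ λ i j → f i j ≤ g i j
sum₂-≤⇒∃ {m} {n} {f} {g} 1≤m 1≤n le with sum₂-<⇒∃ {f = f} {g = λ i j → g i j + 1} exceeds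
  where
  open ℕ.≤-Reasoning
  exceeds : sum (λ i → sum (f i)) < sum (λ i → sum λ j → g i j + 1)
  exceeds = begin-strict
    sum (λ i → sum (f i))                                  ≤⟨ le ⟩
    sum (λ i → sum (g i))                                  <⟨ ℕ.m<m+n _ (ℕ.*-mono-≤ 1≤m (ℕ.*-mono-≤ 1≤n (ℕ.≤-refl {1}))) ⟩
    sum (λ i → sum (g i)) + m * (n * 1)                    ≡⟨ cong (sum (λ i → sum (g i)) +_) (sym (sum₂-const m n 1)) ⟩
    sum (λ i → sum (g i)) + sum {m} (λ _ → sum {n} λ _ → 1) ≡⟨ sym (sum₂-distrib g (λ _ _ → 1)) ⟩
    sum (λ i → sum λ j → g i j + 1)                        ∎
... | i , j , lt = i , j , s≤s⁻¹ (subst (suc (f i j) ≤_) (ℕ.+-comm (g i j) 1) lt)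

-- Dropping the columns with fewer than `D` entries costs at most `K * D`. In every column that
-- remains, distinct rows for the connecting cycles can be chosen greedily.
module Pruning {K : ℕ} {E : Fin K → Fin K → Set} (E? : ∀ I J → Dec (E I J)) (D : ℕ) where

  cdeg : Fin K → ℕ
  cdeg J = sum λ I → ♯ (E? I J)

  kept? : ∀ I J → Dec (E I J × D ≤ cdeg J)
  kept? I J = E? I J ×-dec (D ℕ.≤? cdeg J)

  prune : sum (λ I → sum λ J → ♯ (E? I J)) ≤ sum (λ I → sum λ J → ♯ (kept? I J)) + K * D
  prune = begin
    sum (λ I → sum λ J → ♯ (E? I J))               ≡⟨ ∑-comm (λ I J → ♯ (E? I J)) ⟩
    sum cdeg                                       ≤⟨ sum-mono column ⟩
    sum (λ J → sum (λ I → ♯ (kept? I J)) + D)      ≡⟨ ∑-distrib-+ (λ J → sum λ I → ♯ (kept? I J)) (λ _ → D) ⟩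
    sum (λ J → sum λ I → ♯ (kept? I J)) + sum {K} (λ _ → D)
      ≡⟨ cong₂ _+_ (sym (∑-comm (λ I J → ♯ (kept? I J)))) (sum-const K D) ⟩
    sum (λ I → sum λ J → ♯ (kept? I J)) + K * D    ∎
    where
    open ℕ.≤-Reasoning
    column : ∀ J → cdeg J ≤ sum (λ I → ♯ (kept? I J)) + D
    column J with D ℕ.≤? cdeg J in eq
    ... | no small = ℕ.≤-trans (ℕ.<⇒≤ (ℕ.≰⇒> small)) (ℕ.m≤n+m D _)
    ... | yes rich = ℕ.≤-trans (sum-mono λ I → ♯-≤ (E? I J) λ e →
                        ℕ.≤-reflexive (sym (♯-yes (E? I J ×-dec yes rich) (e , rich)))) (ℕ.m≤m+n _ D)

  kept-cdeg : ∀ {I J} → E I J × D ≤ cdeg J → D ≤ sum (λ I → ♯ (kept? I J))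
  kept-cdeg {_} {J} (_ , rich) = ℕ.≤-trans rich (sum-mono λ I → ♯-≤ (E? I J) λ e →
    ℕ.≤-reflexive (sym (♯-yes (kept? I J) (e , rich))))

module Stretch {n : ℕ} (G : Digraph n) {b : ℕ} (W : Thread (Arc G) b) where
  open Reachability G
  open Thread W

  Span : ℕ → ℕ → V → Set
  Span p q z = ∃₂ λ c l → p ≤ l × l ≤ q × T c l z

  path-span : ∀ {p q l z} → p ≤ l → l ≤ q → z ∈ verts (path l) → Span p q z
  path-span p≤l l≤q z∈ = zero , _ , p≤l , l≤q , path⊆ _ z∈

  link-reach : ∀ {p q} → suc p < b → suc p ≤ q → Reach (Span p q) (en p) (st (suc p))
  link-reach {p} {q} p< p<q = proj₁ (link p<) , λ z∈ → by (proj₂ (link p<) z∈)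
    where
    by : ∀ {z} → (∃ λ c → T c p z) ⊎ z ∈ verts (path (suc p)) → Span p q z
    by (inj₁ (c , t)) = c , p , ℕ.≤-refl , ℕ.<⇒≤ p<q , t
    by (inj₂ m) = path-span (ℕ.n≤1+n p) p<q m

  widen : ∀ {p p′ q z} → p′ ≤ p → Span p q z → Span p′ q z
  widen p′≤p (c , l , p≤l , l≤q , t) = c , l , ℕ.≤-trans p′≤p p≤l , l≤q , t

  onward : ∀ k {p} → suc (p + k) < b → Reach (Span p (suc (p + k))) (en p) (st (suc (p + k)))
  onward zero {p} p< = subst (λ q → Reach (Span p (suc q)) (en p) (st (suc q))) (sym (ℕ.+-identityʳ p))
    (link-reach (subst (λ q → suc q < b) (ℕ.+-identityʳ p) p<) ℕ.≤-refl)
  onward (suc k) {p} p< = subst (λ q → Reach (Span p (suc q)) (en p) (st (suc q))) (sym (ℕ.+-suc p k))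
    (reach-trans (link-reach (ℕ.≤-trans (s≤s (s≤s (ℕ.m≤n⇒m≤1+n (ℕ.m≤m+n p k)))) p<′) (s≤s (ℕ.m≤n⇒m≤1+n (ℕ.m≤m+n p k))))
      (reach-trans (path (suc p) , path-span (ℕ.n≤1+n p) (s≤s (ℕ.m≤n⇒m≤1+n (ℕ.m≤m+n p k))))
        (reach-mono (widen (ℕ.n≤1+n p)) (onward k p<′))))
    where
    p<′ : suc (suc p + k) < b
    p<′ = subst (λ q → suc q < b) (ℕ.+-suc p k) p<

  stretch : ∀ {p q} → p < q → q < b → Reach (Span p q) (en p) (st q)
  stretch {p} p<q q<b with ℕ.m≤n⇒∃[o]m+o≡n p<q
  ... | k , refl = onward k q<b

  traverse : ∀ {p q r x y} → p < q → q < r → r < b → x ∈ verts (path p) → y ∈ verts (path r) →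
             Σ (Reach (Span p r) x y) λ w → verts (path q) ⊆ verts (proj₁ w)
  traverse {p} {q} {r} p<q q<r r<b x∈ y∈ =
    reach-trans before (reach-trans middle after)
    , λ m → ∈-⁀⁺ʳ (proj₁ before) _ (∈-⁀⁺ˡ (path q) (proj₁ after) m)
    where
    p<r : p < r
    p<r = ℕ.<-trans p<q q<r
    before : Reach (Span p r) _ (st q)
    before = reach-trans
      (reach-after (path p , path-span ℕ.≤-refl (ℕ.<⇒≤ p<r)) x∈)
      (reach-mono (λ (c , l , p≤l , l≤q , t) → c , l , p≤l , ℕ.≤-trans l≤q (ℕ.<⇒≤ q<r) , t) (stretch p<q (ℕ.<-trans q<r r<b)))
    middle : Reach (Span p r) (st q) (en q)
    middle = path q , path-span (ℕ.<⇒≤ p<q) (ℕ.<⇒≤ q<r)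
    after : Reach (Span p r) (en q) _
    after = reach-trans (reach-mono (widen (ℕ.<⇒≤ p<q)) (stretch q<r r<b))
                        (reach-before (path r , path-span (ℕ.<⇒≤ p<r) ℕ.≤-refl) y∈)

module Dense {n : ℕ} (G : Digraph n) (q K m t : ℕ)
             (1≤K : 1 ≤ K) (1≤m : 1 ≤ m)
             (W U : Thread (Arc G) (K * m)) where

  open Reachability G
  open Families G

  -- The number of cycles to be built, `q` main ones and `q * q` connecting ones, each with a block
  -- row and a block column of its own.
  D : ℕ
  D = q * suc q

  private
    module W = Thread W
    module U = Thread U
    module SW = Stretch G W
    module SU = Stretch G U

  Meets : ℕ → ℕ → Set
  Meets x y = Any (_∈ verts (U.path y)) (verts (W.path x))

  meets? : ∀ x y → Dec (Meets x y)
  meets? x y = any? (_∈V? verts (U.path y)) (verts (W.path x))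

  pos : Fin K → Fin m → ℕ
  pos I i = toℕ (combine I i)

  pos< : ∀ I i → pos I i < K * m
  pos< I i = Fin.toℕ<n (combine I i)

  pos≡ : ∀ I i → pos I i ≡ m * toℕ I + toℕ i
  pos≡ = Fin.toℕ-combine

  pos-mono : ∀ I {i j} → toℕ i < toℕ j → pos I i < pos I j
  pos-mono I {i} {j} i<j = subst₂ _<_ (sym (pos≡ I i)) (sym (pos≡ I j)) (ℕ.+-monoʳ-< (m * toℕ I) i<j)

  InBlock : Fin K → ℕ → Set
  InBlock I l = m * toℕ I ≤ l × l < m * suc (toℕ I) × l < K * m

  inBlock : ∀ I i j {l} → pos I i ≤ l → l ≤ pos I j → InBlock I l
  inBlock I i j i≤l l≤j =
      ℕ.≤-trans (ℕ.m≤m+n _ (toℕ i)) (ℕ.≤-trans (ℕ.≤-reflexive (sym (pos≡ I i))) i≤l)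
    , ℕ.≤-trans (s≤s (ℕ.≤-trans l≤j (ℕ.≤-reflexive (pos≡ I j))))
        (subst (m * toℕ I + toℕ j <_) (trans (ℕ.+-comm (m * toℕ I) m) (sym (ℕ.*-suc m (toℕ I)))) (ℕ.+-monoʳ-< (m * toℕ I) (Fin.toℕ<n j)))
    , ℕ.≤-trans (s≤s l≤j) (pos< I j)

  block-unique : ∀ {I J l} → InBlock I l → InBlock J l → I ≡ J
  block-unique {I} {J} (lo , hi , _) (lo′ , hi′ , _) with ℕ.<-cmp (toℕ I) (toℕ J)
  ... | tri≈ _ e _ = Fin.toℕ-injective e
  ... | tri< I<J _ _ = contradiction (ℕ.≤-trans (ℕ.*-monoʳ-≤ m I<J) lo′) (ℕ.<⇒≱ hi)
  ... | tri> _ _ J<I = contradiction (ℕ.≤-trans (ℕ.*-monoʳ-≤ m J<I) lo) (ℕ.<⇒≱ hi′)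

  Layer : (Fin 3 → ℕ → V → Set) → Fin 3 → Fin K → V → Set
  Layer T c I z = ∃ λ l → InBlock I l × T c l z

  module Block (I J : Fin K) = Enclosed {m} {λ i j → Meets (pos I i) (pos J j)} (λ i j → meets? (pos I i) (pos J j))

  -- A north-east and a south-west intersection in one block close a walk through rows and columns in between.
  record Cycle (x y : ℕ) (I J : Fin K) : Set where
    field
      base   : V
      cycle  : Route (Arc G) base base
      cycle⊆ : ∀ {z} → z ∈ verts cycle → (∃ λ c → Layer W.T c I z) ⊎ (∃ λ c → Layer U.T c J z)
      row⊆   : verts (W.path x) ⊆ verts cycle
      col⊆   : verts (U.path y) ⊆ verts cycle

  -- With both threads followed forwards, `W` leads from row `i₁` through `i` to `i₂`, hence from
  -- the north-east intersection to the south-west one, and `U` leads from column `j₁` through `j`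
  -- to `j₂` and so back.
  close : ∀ I J i j → Block.Enclosed I J i j → Cycle (pos I i) (pos J j) I J
  close I J i j (Block.enclosed _ (i₁ , j₂ , ne , i₁<i , j<j₂) (i₂ , j₁ , sw , i<i₂ , j₁<j)) = record
    { base = proj₁ found-ne
    ; cycle = proj₁ (proj₁ across) ⁀ proj₁ (proj₁ down)
    ; cycle⊆ = λ z∈ → by (∈-⁀⁻ (proj₁ (proj₁ across)) (proj₁ (proj₁ down)) z∈)
    ; row⊆ = ∈-⁀⁺ˡ (proj₁ (proj₁ across)) (proj₁ (proj₁ down)) ∘ proj₂ across
    ; col⊆ = ∈-⁀⁺ʳ (proj₁ (proj₁ across)) (proj₁ (proj₁ down)) ∘ proj₂ down }
    where
    found-ne : ∃ λ z → z ∈ verts (W.path (pos I i₁)) × z ∈ verts (U.path (pos J j₂))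
    found-ne = find ne
    found-sw : ∃ λ z → z ∈ verts (W.path (pos I i₂)) × z ∈ verts (U.path (pos J j₁))
    found-sw = find sw
    across : Σ (Reach (SW.Span (pos I i₁) (pos I i₂)) (proj₁ found-ne) (proj₁ found-sw)) λ w → verts (W.path (pos I i)) ⊆ verts (proj₁ w)
    across = SW.traverse (pos-mono I i₁<i) (pos-mono I i<i₂) (pos< I i₂) (proj₁ (proj₂ found-ne)) (proj₁ (proj₂ found-sw))
    down : Σ (Reach (SU.Span (pos J j₁) (pos J j₂)) (proj₁ found-sw) (proj₁ found-ne)) λ w → verts (U.path (pos J j)) ⊆ verts (proj₁ w)
    down = SU.traverse (pos-mono J j₁<j) (pos-mono J j<j₂) (pos< J j₂) (proj₂ (proj₂ found-sw)) (proj₂ (proj₂ found-ne))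
    by : ∀ {z} → z ∈ verts (proj₁ (proj₁ across)) ⊎ z ∈ verts (proj₁ (proj₁ down)) →
         (∃ λ c → Layer W.T c I z) ⊎ (∃ λ c → Layer U.T c J z)
    by (inj₁ z∈) = let c , l , lo , hi , t = proj₂ (proj₁ across) z∈ in inj₁ (c , l , inBlock I i₁ i₂ lo hi , t)
    by (inj₂ z∈) = let c , l , lo , hi , t = proj₂ (proj₁ down) z∈ in inj₂ (c , l , inBlock J j₁ j₂ lo hi , t)

  module Assemble
    {pr pc : Fin q → Fin (suc q) → ℕ} (ρ γ : Fin q → Fin (suc q) → Fin K)
    (ρ-injective : ∀ {a b a′ b′} → ρ a b ≡ ρ a′ b′ → a ≡ a′)
    (γ-injective : ∀ {a b a′ b′} → γ a b ≡ γ a′ b′ → a ≡ a′)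
    (cyc : ∀ a b → Cycle (pr a b) (pc a b) (ρ a b) (γ a b))
    (own   : ∀ a b → ∃ λ v → v ∈ verts (Cycle.cycle (cyc a zero)) × v ∈ verts (Cycle.cycle (cyc a (suc b))))
    (other : ∀ a b → ∃ λ v → v ∈ verts (Cycle.cycle (cyc b zero)) × v ∈ verts (Cycle.cycle (cyc a (suc b)))) where

    C : Fin q → Fin (suc q) → List V
    C a b = verts (Cycle.cycle (cyc a b))

    X : Fin q → List V
    X a = union (C a zero) (λ b → C a (suc b))

    layerOf : Fin 3 ⊎ Fin 3 → Fin q → V → Set
    layerOf (inj₁ w) a v = ∃ λ b → Layer W.T w (ρ a b) v
    layerOf (inj₂ u) a v = ∃ λ b → Layer U.T u (γ a b) v

    layerOf-unique : ∀ c {a a′ v} → layerOf c a v → layerOf c a′ v → a ≡ a′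
    layerOf-unique (inj₁ w) (b , x , inB , t) (b′ , x′ , inB′ , t′)
      with refl ← W.T-unique w (proj₂ (proj₂ inB)) (proj₂ (proj₂ inB′)) t t′ = ρ-injective (block-unique inB inB′)
    layerOf-unique (inj₂ u) (b , x , inB , t) (b′ , x′ , inB′ , t′)
      with refl ← U.T-unique u (proj₂ (proj₂ inB)) (proj₂ (proj₂ inB′)) t t′ = γ-injective (block-unique inB inB′)

    C-cover : ∀ {a} b {v} → v ∈ C a b → ∃ λ c → layerOf (Fin.splitAt 3 c) a v
    C-cover {a} b {v} v∈ with Cycle.cycle⊆ (cyc a b) v∈
    ... | inj₁ (w , l) = w ↑ˡ 3 , subst (λ s → layerOf s a v) (sym (Fin.splitAt-↑ˡ 3 w 3)) (b , l)
    ... | inj₂ (u , l) = 3 ↑ʳ u , subst (λ s → layerOf s a v) (sym (Fin.splitAt-↑ʳ 3 3 u)) (b , l)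

    layered : Layered q 6
    layered = record
      { X = X
      ; strong = λ a → union-strong {base = C a zero} (closed-strong (Cycle.cycle (cyc a zero)))
                   (λ b → closed-strong (Cycle.cycle (cyc a (suc b)))) (own a)
      ; meet = λ a b → let v , v∈ , v∈′ = other a b in
                 v , ∈-union⁺ʳ {base = C a zero} b v∈′ , ∈-++⁺ˡ v∈
      ; T = λ c → layerOf (Fin.splitAt 3 c)
      ; cover = λ {a} v∈ → [ C-cover zero , (λ (b , m) → C-cover (suc b) m) ]′ (∈-union⁻ (C a zero) v∈)
      ; unique = λ {c} → layerOf-unique (Fin.splitAt 3 c) }

  -- With one offset `(i , j)` for all blocks, each block row and each block column has a single
  -- distinguished path. Whether two cycles from different blocks meet is then read off from the
  -- relation `E` between blocks.
  module Offset (i j : Fin m) where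

    E : Fin K → Fin K → Set
    E I J = Block.Enclosed I J i j

    e? : ∀ I J → Dec (E I J)
    e? I J = Block.enclosed? I J i j

    open Pruning e? D

    module _ (dense : K * t ≤ sum λ I → sum λ J → ♯ (kept? I J)) (big : K * (D * D + q) ≤ t * t) where

      open RichRows kept? D q t 1≤K dense big

      z : Fin q → Fin K
      z = proj₁ rich-rows

      z-injective : ∀ {a b} → z a ≡ z b → a ≡ b
      z-injective = proj₁ (proj₂ rich-rows)

      -- Member (a , zero) is the main cycle of a, member (a , suc b) connects it to the main cycle of b.
      Shared : Fin q → Fin (suc q) → Fin K → Set
      Shared a zero    c = (E (z a) c × D ≤ cdeg c) × (E (z a) c × D ≤ cdeg c)
      Shared a (suc b) c = (E (z a) c × D ≤ cdeg c) × (E (z b) c × D ≤ cdeg c)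

      shared? : ∀ a b c → Dec (Shared a b c)
      shared? a zero    c = both? (z a) (z a) c
      shared? a (suc b) c = both? (z a) (z b) c

      shared-many : ∀ a b → D ≤ sum (♯ ∘ shared? a b)
      shared-many a zero    = proj₂ (proj₂ rich-rows) a a
      shared-many a (suc b) = proj₂ (proj₂ rich-rows) a b

      columns : ∃ λ (g : Fin (q * suc q) → Fin K) → (∀ s → let a , b = remQuot {q} (suc q) s in Shared a b (g s))
                  × (∀ {s s′} → g s ≡ g s′ → s ≡ s′) × (∀ s → g s ∉ [])
      columns = distinct-choice (q * suc q) (λ s → let a , b = remQuot {q} (suc q) s in shared? a b) []
        (λ s → let a , b = remQuot {q} (suc q) s in ℕ.≤-trans (ℕ.≤-reflexive (ℕ.+-identityʳ D)) (shared-many a b))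

      γ : Fin q → Fin (suc q) → Fin K
      γ a b = proj₁ columns (combine a b)

      γ-shared : ∀ a b → Shared a b (γ a b)
      γ-shared a b = subst (λ (a′ , b′) → Shared a′ b′ (γ a b)) (Fin.remQuot-combine {q} {suc q} a b) (proj₁ (proj₂ columns) (combine a b))

      γ-injective : ∀ {a b a′ b′} → γ a b ≡ γ a′ b′ → a ≡ a′
      γ-injective {a} {b} {a′} {b′} e = Fin.combine-injectiveˡ a b a′ b′ (proj₁ (proj₂ (proj₂ columns)) e)

      -- The column of a connecting cycle is rich by pruning. The `q` main rows are excluded, and
      -- `q * q + q` is exactly `D`.
      rows : ∃ λ (g : Fin (q * q) → Fin K) → (∀ s → let a , b = remQuot {q} q s ; c = γ a (suc b) in E (g s) c × D ≤ cdeg c)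
                  × (∀ {s s′} → g s ≡ g s′ → s ≡ s′) × (∀ s → g s ∉ tabulate z)
      rows = distinct-choice (q * q) (λ s r → let a , b = remQuot {q} q s in kept? r (γ a (suc b))) (tabulate z)
        (λ s → let a , b = remQuot {q} q s in ℕ.≤-trans
          (ℕ.≤-reflexive (trans (cong (q * q +_) (List.length-tabulate z)) (trans (ℕ.+-comm (q * q) q) (sym (ℕ.*-suc q q)))))
          (kept-cdeg {z a} {γ a (suc b)} (proj₁ (γ-shared a (suc b)))))

      ρ : Fin q → Fin (suc q) → Fin K
      ρ a zero    = z a
      ρ a (suc b) = proj₁ rows (combine a b)

      ρ-injective : ∀ {a b a′ b′} → ρ a b ≡ ρ a′ b′ → a ≡ a′
      ρ-injective {a} {zero}  {a′} {zero}   e = z-injective e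
      ρ-injective {a} {zero}  {a′} {suc b′} e = contradiction (subst (_∈ tabulate z) e (∈-tabulate⁺ a)) (proj₂ (proj₂ (proj₂ rows)) (combine a′ b′))
      ρ-injective {a} {suc b} {a′} {zero}   e = contradiction (subst (_∈ tabulate z) (sym e) (∈-tabulate⁺ a′)) (proj₂ (proj₂ (proj₂ rows)) (combine a b))
      ρ-injective {a} {suc b} {a′} {suc b′} e = Fin.combine-injectiveˡ a b a′ b′ (proj₁ (proj₂ (proj₂ rows)) e)

      ργ : ∀ a b → E (ρ a b) (γ a b)
      ργ a zero    = proj₁ (proj₁ (γ-shared a zero))
      ργ a (suc b) = subst (λ (a′ , b′) → E (ρ a (suc b)) (γ a′ (suc b′))) (Fin.remQuot-combine {q} {q} a b)
                           (proj₁ (proj₁ (proj₂ rows) (combine a b)))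

      cyc : ∀ a b → Cycle (pos (ρ a b) i) (pos (γ a b) j) (ρ a b) (γ a b)
      cyc a b = close (ρ a b) (γ a b) i j (ργ a b)

      C : Fin q → Fin (suc q) → List V
      C a b = verts (Cycle.cycle (cyc a b))

      -- The main cycle contains the whole distinguished row of its block and the connecting cycle
      -- the whole distinguished column of its own; `E` says that these two paths intersect.
      crossing : ∀ a b c → E (z a) (γ b (suc c)) → ∃ λ v → v ∈ C a zero × v ∈ C b (suc c)
      crossing a b c (Block.enclosed h _ _) = let v , v∈ , v∈′ = find h in
        v , Cycle.row⊆ (cyc a zero) v∈ , Cycle.col⊆ (cyc b (suc c)) v∈′

      layered : Layered q 6
      layered = Assemble.layered ρ γ (λ {a} {b} {a′} {b′} → ρ-injective {a} {b} {a′} {b′}) (λ {a} {b} {a′} {b′} → γ-injective {a} {b} {a′} {b′}) cyc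
        (λ a b → crossing a a b (proj₁ (proj₁ (γ-shared a (suc b)))))
        (λ a b → crossing b a b (proj₁ (proj₂ (γ-shared a (suc b)))))

  intersections : ℕ
  intersections = sum λ (x : Fin (K * m)) → sum λ (y : Fin (K * m)) → ♯ (meets? (toℕ x) (toℕ y))

  enclosures : Fin m → Fin m → ℕ
  enclosures i j = sum λ I → sum λ J → ♯ (Offset.e? i j I J)

  many-enclosures : intersections ≤ sum (λ i → sum (enclosures i)) + K * (K * ((m + m) + (m + m)))
  many-enclosures = begin
    intersections
      ≡⟨ sum-combine K (λ x → sum λ (y : Fin (K * m)) → h (toℕ x) (toℕ y)) ⟩
    sum (λ I → sum λ i → sum λ (y : Fin (K * m)) → h (pos I i) (toℕ y))
      ≡⟨ sum-cong-≗ {K} (λ I → sum-cong-≗ {m} λ i → sum-combine K (λ y → h (pos I i) (toℕ y))) ⟩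
    sum (λ I → sum λ i → sum λ J → sum λ j → h (pos I i) (pos J j))
      ≡⟨ sum-cong-≗ {K} (λ I → ∑-comm {m} {K} (λ i J → sum λ j → h (pos I i) (pos J j))) ⟩
    sum (λ I → sum λ J → sum λ i → sum λ j → h (pos I i) (pos J j))
      ≤⟨ sum₂-mono (λ I J → Block.mostly-enclosed I J) ⟩
    sum (λ I → sum λ J → sum (λ i → sum λ j → ♯ (Block.enclosed? I J i j)) + ((m + m) + (m + m)))
      ≡⟨ sum₂-distrib (λ I J → sum (λ i → sum λ j → ♯ (Block.enclosed? I J i j))) (λ _ _ → (m + m) + (m + m)) ⟩
    sum (λ I → sum λ J → sum (λ i → sum λ j → ♯ (Block.enclosed? I J i j))) + sum {K} (λ _ → sum {K} λ _ → (m + m) + (m + m))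
      ≡⟨ cong₂ _+_ regroup (sum₂-const K K ((m + m) + (m + m))) ⟩
    sum (λ i → sum (enclosures i)) + K * (K * ((m + m) + (m + m))) ∎
    where
    open ℕ.≤-Reasoning
    h : ℕ → ℕ → ℕ
    h x y = ♯ (meets? x y)
    e : Fin K → Fin K → Fin m → Fin m → ℕ
    e I J i j = ♯ (Block.enclosed? I J i j)
    regroup : sum (λ I → sum λ J → sum λ i → sum λ j → e I J i j) ≡ sum (λ i → sum λ j → sum λ I → sum λ J → e I J i j)
    regroup = trans (sum-cong-≗ λ I → trans (∑-comm (λ J i → sum (e I J i))) (sum-cong-≗ λ i → ∑-comm (λ J j → e I J i j)))
               (trans (∑-comm (λ I i → sum λ j → sum λ J → e I J i j)) (sum-cong-≗ λ i → ∑-comm (λ I j → sum λ J → e I J i j)))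

  -- Each of the `K * K` pairs of blocks loses at most `4m` intersections that are not enclosed.
  -- Averaging the others over `m * m` offsets leaves `K * t + K * D` at one offset, and pruning
  -- takes `K * D`.
  dense-layered : m * (m * (K * t + K * D)) + K * (K * ((m + m) + (m + m))) ≤ intersections →
                  K * (D * D + q) ≤ t * t → Layered q 6
  dense-layered many big = at-offset (sum₂-≤⇒∃ {f = λ _ _ → K * t + K * D} {g = enclosures} 1≤m 1≤m average)
    where
    average : sum {m} (λ _ → sum {m} λ _ → K * t + K * D) ≤ sum (λ i → sum (enclosures i))
    average = ℕ.≤-trans (ℕ.≤-reflexive (sum₂-const m m (K * t + K * D)))
                (ℕ.+-cancelʳ-≤ (K * (K * ((m + m) + (m + m)))) _ _ (ℕ.≤-trans many many-enclosures))
    at-offset : (∃₂ λ i j → K * t + K * D ≤ enclosures i j) → Layered q 6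
    at-offset (i , j , le) = Offset.layered i j (ℕ.+-cancelʳ-≤ (K * D) _ _ (ℕ.≤-trans le (Pruning.prune (Offset.e? i j) D))) big

-- The bound

module Congested {n : ℕ} (G : Digraph n) {q b : ℕ} (K m t : ℕ) (b≡ : suc b ≡ K * m)
                 (1≤q : 1 ≤ q) (1≤K : 1 ≤ K) (1≤m : 1 ≤ m)
                 (many : 4 * (q * q) * (4 * (q * q)) * (m * (m * (K * t + K * (q * suc q))) + K * (K * ((m + m) + (m + m))))
                         ≤ suc b * suc b)
                 (big : K * (q * suc q * (q * suc q) + q) ≤ t * t)
                 (P : PathSystem (Arc G) (q * q) (suc b)) where

  open Families G
  open Sparse G {q} P using (clash; decode; from; to; link)

  r : ℕ
  r = 4 * (q * q)

  1≤r : 1 ≤ r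
  1≤r = ℕ.*-mono-≤ {1} {4} (s≤s z≤n) (ℕ.*-mono-≤ 1≤q 1≤q)

  N : ℕ
  N = m * (m * (K * t + K * (q * suc q))) + K * (K * ((m + m) + (m + m)))

  dense : ∀ c d → suc b * suc b ≤ r * r * sum (λ x → sum λ y → clash (decode c) (decode d) x y) → Layered q 6
  dense c d le = use b≡ W.thread U.thread enough
    where
    module W = Threading P (from (decode c)) (to (decode c))
    module U = Threading P (from (decode d)) (to (decode d))

    meets : (W U : Thread (Arc G) (suc b)) → ℕ → ℕ → ℕ
    meets W U x y = ♯ (any? (λ z → any? (z Fin.≟_) (verts (Thread.path U y))) (verts (Thread.path W x)))

    r*r≢0 : NonZero (r * r)
    r*r≢0 = positive (ℕ.*-mono-≤ 1≤r 1≤r)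
      where
      positive : ∀ {k} → 1 ≤ k → NonZero k
      positive (s≤s _) = _

    original : N ≤ sum λ x → sum λ y → clash (decode c) (decode d) x y
    original = ℕ.*-cancelˡ-≤ (r * r) {{r*r≢0}} (ℕ.≤-trans many le)

    injective : (f : ℕ → Fin (suc b)) → (∀ {p q} → p < suc b → q < suc b → f p ≡ f q → p ≡ q) →
                ∀ {i j : Fin (suc b)} → f (toℕ i) ≡ f (toℕ j) → i ≡ j
    injective f inj e = Fin.toℕ-injective (inj (Fin.toℕ<n _) (Fin.toℕ<n _) e)

    -- The threads list the routes in tour order, which permutes both indices of the sum.
    enough : N ≤ sum λ (x : Fin (suc b)) → sum λ (y : Fin (suc b)) → meets W.thread U.thread (toℕ x) (toℕ y)
    enough = ℕ.≤-trans original (ℕ.≤-trans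
      (sum-mono {suc b} λ x → sum-reorder {suc b} (U.ord ∘ toℕ) (injective U.ord U.ord-injective) (λ y → clash (decode c) (decode d) x y))
      (sum-reorder {suc b} (W.ord ∘ toℕ) (injective W.ord W.ord-injective) (λ x → sum λ (y : Fin (suc b)) → clash (decode c) (decode d) x (U.ord (toℕ y)))))

    -- With the length as a variable, `b≡` can be matched against `refl`.
    use : ∀ {B} → B ≡ K * m → (W U : Thread (Arc G) B) →
          N ≤ (sum λ (x : Fin B) → sum λ (y : Fin B) → ♯ (any? (λ z → any? (z Fin.≟_) (verts (Thread.path U (toℕ y)))) (verts (Thread.path W (toℕ x))))) →
          Layered q 6
    use refl W U le = Dense.dense-layered G q K m t 1≤K 1≤m W U le big

  congested : ∀ {k} → k * 8 ≤ q → Σ (Bramble G) λ B → Bramble.HasCongestionAtMost B 8 × k ≤ Bramble.size B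
  congested k8≤q with free-or-dense r (λ c d → clash (decode c) (decode d)) 1≤r (s≤s z≤n)
  ... | inj₁ (f , free) = layered-bramble (Sparse.Free.layered G {q} P f free) (s≤s (s≤s (s≤s z≤n))) k8≤q
  ... | inj₂ (c , d , le) = layered-bramble (dense c d le) (s≤s (s≤s (s≤s (s≤s (s≤s (s≤s z≤n)))))) k8≤q

-- Choice of parameters

^-distribʳ-* : ∀ n x y → (x * y) ^ n ≡ x ^ n * y ^ n
^-distribʳ-* zero    x y = refl
^-distribʳ-* (suc n) x y = trans (cong (x * y *_) (^-distribʳ-* n x y)) (interchange x y (x ^ n) (y ^ n))
  where
  interchange : ∀ a b c d → a * b * (c * d) ≡ a * c * (b * d)
  interchange = solve-∀

module Parameters (q : ℕ) (16≤q : 16 ≤ q) where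

  -- `c` is the block length and `K` the number of blocks. By `big`, `t` must be of order `a` times
  -- the root of `K`, so `K` is the square of `a * c`. Both terms of `many` then ask that `c` exceed
  -- a constant multiple of `a * a`, which `c = a ^ 3` does for `a` at least 256.
  a c K t B w D : ℕ
  a = q * q
  c = a * a * a
  K = c * (a * a * c)
  t = 4 * (a * a * c)
  B = K * c
  D = q * suc q
  w = (a + a) * B * (B + B)

  open ℕ.≤-Reasoning

  1≤q : 1 ≤ q
  1≤q = ℕ.≤-trans (s≤s z≤n) 16≤q

  256≤a : 256 ≤ a
  256≤a = ℕ.*-mono-≤ 16≤q 16≤q

  1≤a : 1 ≤ a
  1≤a = ℕ.*-mono-≤ 1≤q 1≤q

  1≤c : 1 ≤ c
  1≤c = ℕ.*-mono-≤ (ℕ.*-mono-≤ 1≤a 1≤a) 1≤a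

  1≤K : 1 ≤ K
  1≤K = ℕ.*-mono-≤ 1≤c (ℕ.*-mono-≤ (ℕ.*-mono-≤ 1≤a 1≤a) 1≤c)

  1≤B : 1 ≤ B
  1≤B = ℕ.*-mono-≤ 1≤K 1≤c

  grow : ∀ {x y} → 1 ≤ y → x ≤ x * y
  grow {x} {y} 1≤y = ℕ.≤-trans (ℕ.≤-reflexive (sym (ℕ.*-identityʳ x))) (ℕ.*-monoʳ-≤ x 1≤y)

  D≤2a : D ≤ a + a
  D≤2a = begin
    q * suc q   ≡⟨ ℕ.*-suc q q ⟩
    q + q * q   ≤⟨ ℕ.+-monoˡ-≤ (q * q) (grow 1≤q) ⟩
    q * q + q * q ∎

  D≤ : D ≤ a * a * c
  D≤ = begin
    D               ≤⟨ D≤2a ⟩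
    a + a           ≡⟨ double a ⟩
    a * 2           ≤⟨ ℕ.*-monoʳ-≤ a (ℕ.≤-trans (s≤s (s≤s z≤n)) 256≤a) ⟩
    a * a           ≤⟨ grow 1≤c ⟩
    a * a * c       ∎
    where
    double : ∀ a → a + a ≡ a * 2
    double = solve-∀

  many : 4 * a * (4 * a) * (c * (c * (K * t + K * D)) + K * (K * ((c + c) + (c + c)))) ≤ B * B
  many = begin
    4 * a * (4 * a) * (c * (c * (K * t + K * D)) + K * (K * ((c + c) + (c + c))))
      ≤⟨ ℕ.*-monoʳ-≤ (4 * a * (4 * a)) (ℕ.+-monoˡ-≤ _ (ℕ.*-monoʳ-≤ c (ℕ.*-monoʳ-≤ c (ℕ.+-monoʳ-≤ (K * t) (ℕ.*-monoʳ-≤ K D≤))))) ⟩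
    4 * a * (4 * a) * (c * (c * (K * t + K * (a * a * c))) + K * (K * ((c + c) + (c + c))))
      ≡⟨ gather a c ⟩
    -- 144 is `16 * 5` from `t` and `D`, with `D` estimated by `a * a * c`, plus `16 * 4` from the
    -- cells that are not enclosed.
    144 * (a * a * (a * a * (c * c * c * K)))
      ≤⟨ ℕ.*-monoˡ-≤ (a * a * (a * a * (c * c * c * K))) (ℕ.≤-trans (ℕ.m≤m+n 144 112) 256≤a) ⟩
    a * (a * a * (a * a * (c * c * c * K)))
      ≡⟨ expand a (a * a * (c * c * c * K)) ⟩
    c * (a * a * (c * c * c * K))
      ≡⟨ final a c ⟩
    B * B ∎
    where
    gather : ∀ a c → 4 * a * (4 * a) * (c * (c * (c * (a * a * c) * (4 * (a * a * c)) + c * (a * a * c) * (a * a * c)))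
                + c * (a * a * c) * (c * (a * a * c) * ((c + c) + (c + c))))
              ≡ 144 * (a * a * (a * a * (c * c * c * (c * (a * a * c)))))
    gather = solve-∀
    expand : ∀ a x → a * (a * a * x) ≡ a * a * a * x
    expand = solve-∀
    final : ∀ a c → c * (a * a * (c * c * c * (c * (a * a * c)))) ≡ c * (a * a * c) * c * (c * (a * a * c) * c)
    final = solve-∀

  big : K * (D * D + q) ≤ t * t
  big = begin
    K * (D * D + q)                 ≤⟨ ℕ.*-monoʳ-≤ K (ℕ.+-mono-≤ (ℕ.*-mono-≤ D≤2a D≤2a) (ℕ.≤-trans (grow 1≤q) (grow 1≤a))) ⟩
    K * ((a + a) * (a + a) + a * a) ≡⟨ five a K ⟩
    K * (a * a) * 5                 ≤⟨ ℕ.*-monoʳ-≤ (K * (a * a)) (ℕ.m≤m+n 5 11) ⟩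
    K * (a * a) * 16                ≡⟨ square a c ⟩
    t * t                           ∎
    where
    five : ∀ a K → K * ((a + a) * (a + a) + a * a) ≡ K * (a * a) * 5
    five = solve-∀
    square : ∀ a c → c * (a * a * c) * (a * a) * 16 ≡ 4 * (a * a * c) * (4 * (a * a * c))
    square = solve-∀

  B≡a^11 : B ≡ a ^ 11
  B≡a^11 = eleven a
    where
    eleven : ∀ a → a * a * a * (a * a * (a * a * a)) * (a * a * a)
                 ≡ a * (a * (a * (a * (a * (a * (a * (a * (a * (a * (a * 1))))))))))
    eleven = solve-∀

  q^48 : q ^ 48 ≡ a * (a * (B * B))
  q^48 = begin-equality
    q ^ 48                    ≡⟨ ℕ.^-distribˡ-+-* q 24 24 ⟩
    q ^ 24 * q ^ 24           ≡⟨ sym (^-distribʳ-* 24 q q) ⟩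
    a * (a * a ^ 22)          ≡⟨ cong (λ z → a * (a * z)) (ℕ.^-distribˡ-+-* a 11 11) ⟩
    a * (a * (a ^ 11 * a ^ 11)) ≡⟨ cong (λ z → a * (a * (z * z))) (sym B≡a^11) ⟩
    a * (a * (B * B))         ∎

  w-small : suc (2 * w) + suc w < q ^ 48
  w-small = begin-strict
    suc (2 * w) + suc w     ≡⟨ count-up a B ⟩
    12 * (a * (B * B)) + 2  ≤⟨ ℕ.+-monoʳ-≤ (12 * (a * (B * B))) (ℕ.+-mono-≤ 1≤aBB 1≤aBB) ⟩
    12 * (a * (B * B)) + (a * (B * B) + a * (B * B)) <⟨ ℕ.m<m+n _ 1≤aBB ⟩
    12 * (a * (B * B)) + (a * (B * B) + a * (B * B)) + a * (B * B) ≡⟨ fifteen (a * (B * B)) ⟩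
    15 * (a * (B * B))      ≤⟨ ℕ.*-monoˡ-≤ (a * (B * B)) (ℕ.≤-trans (ℕ.m≤m+n 15 241) 256≤a) ⟩
    a * (a * (B * B))       ≡⟨ sym q^48 ⟩
    q ^ 48                  ∎
    where
    1≤aBB : 1 ≤ a * (B * B)
    1≤aBB = ℕ.*-mono-≤ 1≤a (ℕ.*-mono-≤ 1≤B 1≤B)
    count-up : ∀ a B → suc (2 * ((a + a) * B * (B + B))) + suc ((a + a) * B * (B + B)) ≡ 12 * (a * (B * B)) + 2
    count-up = solve-∀
    fifteen : ∀ x → 12 * x + (x + x) + x ≡ 15 * x
    fifteen = solve-∀

  congested-bramble : ∀ {n k} (G : Digraph n) → k * 8 ≤ q → DTWAtLeast G (q ^ 48) →
    Σ (Bramble G) λ B → Bramble.HasCongestionAtMost B 8 × k ≤ Bramble.size B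
  congested-bramble {n} {k} G k8≤q dtw = with-size B refl 1≤B
    where
    h : Reachability.Haven G w
    h = haven G w w-small dtw
    -- `B` is a product; passing it as a variable together with its equation lets it be matched as
    -- `suc b`.
    with-size : ∀ B′ → B′ ≡ B → 1 ≤ B′ → Σ (Bramble G) λ B → Bramble.HasCongestionAtMost B 8 × k ≤ Bramble.size B
    with-size (suc b) e _ = Congested.congested G {q} {b} K c t e 1≤q 1≤K 1≤c
      (subst (λ z → 4 * a * (4 * a) * (c * (c * (K * t + K * D)) + K * (K * ((c + c) + (c + c)))) ≤ z * z) (sym e) many) big
      (Cutting.system G h (HittingPath.bigPath G h) {b} {a} (ℕ.≤-reflexive (cong (λ z → (a + a) * z * (z + z)) e))) k8≤q

-- For `k` at least 2 the logarithm is at least 1; at `k = 1` it is 0, hence the threshold 2.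
order : BigO-k48log13 (λ k → (16 * k) ^ 48)
order = 16 ^ 48 , 2 , λ k 2≤k → begin
  (16 * k) ^ 48                          ≡⟨ ^-distribʳ-* 48 16 k ⟩
  16 ^ 48 * k ^ 48                       ≤⟨ ℕ.*-monoʳ-≤ (16 ^ 48) (log-factor k 2≤k) ⟩
  16 ^ 48 * (k ^ 48 * ⌈log₂ k ⌉ ^ 13)    ∎
  where
  open ℕ.≤-Reasoning
  log-factor : ∀ k → 2 ≤ k → k ^ 48 ≤ k ^ 48 * ⌈log₂ k ⌉ ^ 13
  log-factor k 2≤k = ℕ.≤-trans (ℕ.≤-reflexive (sym (ℕ.*-identityʳ (k ^ 48))))
    (ℕ.*-monoʳ-≤ (k ^ 48) (ℕ.≤-trans (ℕ.≤-reflexive (sym (ℕ.^-zeroˡ 13))) (ℕ.^-monoˡ-≤ 13 (⌈log₂⌉-mono-≤ 2≤k))))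

theorem2 : ∃[ t ] (BigO-k48log13 t
    × (∀ (k : ℕ) → 1 ≤ k → ∀ (n : ℕ) (G : Digraph n) → DTWAtLeast G (t k) →
    Σ (Bramble G) (λ B → Bramble.HasCongestionAtMost B 8 × k ≤ Bramble.size B)))
theorem2 = (λ k → (16 * k) ^ 48) , order , λ k 1≤k n G dtw →
  -- `16 * k` is at least 16, as the numerical estimates require, and at least `8 * k`, as the size
  -- of the bramble requires.
  Parameters.congested-bramble (16 * k) (ℕ.*-monoʳ-≤ 16 1≤k) G
    (ℕ.≤-trans (ℕ.≤-reflexive (ℕ.*-comm k 8)) (ℕ.*-monoˡ-≤ k (ℕ.m≤m+n 8 8))) dtw
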